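{- Let $\alpha$ be a positive root of $\Phi$ with depth growth rate $t$, and let $\chi_n(q)$ be the characteristic polynomial of the arrangement of fractures of $\mathrm{st}_n(\alpha)^\perp$ (an arrangement of hyperplanes in the space $\mathrm{st}_n(\alpha)^\perp$). Then there exist polynomials $p_0(q),\dots,p_t(q)$ and an integer $e$ such that for all sufficiently large $n$, $$\chi_n(q)=\sum_{k=0}^{t}p_k(q)(q-k)^{n-e}.$$
   Context: $\Phi$ is the root system of a crystallographic Cartan matrix $A$ for a Coxeter group with diagram $G$ (simple roots $\alpha_i$ indexed by vertices, $s_i(\beta)=\beta-(\alpha_i,\beta)\alpha_i$ with $(\alpha_i,\alpha_j)=A_{ij}$); roots are identified with integer-valued functions on vertices. Depth: $1+$ minimal $\ell$ in $\gamma=s_{y_\ell}\cdots s_{y_1}(\alpha_{y_0})$. Elastic data $(x,L_x,R_x)$: a vertex and partition of its neighbors. $\mathrm{st}_n(G)$ replaces $x$ by a path $x_0-\cdots-x_n$ of unlabeled edges, $x_0$ joined to $L_x$ and $x_n$ to $R_x$ by the original labeled edges; $\mathrm{st}_n(A)$ has entries $A_{yz}$ off the path, $A_{xz}$ at $(x_0,z)$ for $z\in L_x$ and $(x_n,z)$ for $z\in R_x$, $A_{yx}$ at $(y,x_0)$ for $y\in L_x$ and $(y,x_n)$ for $y\in R_x$, $2$ at $(x_i,x_i)$, $-1$ at $(x_i,x_{i\pm1})$, $0$ otherwise; $\mathrm{st}_n(\Phi)\subset V_n$ is its root system; $\mathrm{st}_n(\alpha)$ takes value $\alpha(x)$ at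 each $x_i$, agreeing with $\alpha$ elsewhere. Depth growth rate: the integer $t$ with $\mathrm{depth}(\mathrm{st}_n(\alpha))=tn+\mathrm{depth}(\alpha)$ for all $n$. Fractures: in $V_n^*$, $v^\perp=\{f:f(v)=0\}$; base region $D=\{f: f(\alpha_y)>0\ \forall y\}$. For distinct root hyperplanes $H_1,H_2$, their rank 2 subarrangement is the set of root hyperplanes containing $H_1\cap H_2$; the region containing $D$ is bounded by two basic hyperplanes. $H_1$ cuts $H_2$ if $H_1$ is basic and $H_2$ is not; then $H_1\cap H_2$ is a fracture of $H_2$. The characteristic polynomial of a finite arrangement of hyperplanes in a real vector space $E$ is $\chi(q)=\sum_X\mu(E,X)q^{\dim X}$, summed over the intersection lattice (intersections of subfamilies, including $E$), with $\mu$ its Möbius function.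
   Formalization: The space V_n^* and its hyperplanes are taken over the rationals rather than the reals, and the identity for χ_n(q) is stated at all rational q; since roots are integer vectors, the intersection lattice, dimensions and χ_n are the same over the reals. -}

module Defs where

open import Data.Nat as ℕ using (ℕ; zero; suc)
open import Data.Integer as ℤ using (ℤ; +_)
open import Data.Rational as ℚ using (ℚ; 0ℚ; 1ℚ)
open import Data.Fin as Fin using (Fin; splitAt; toℕ)
open import Data.Bool using (Bool; true; false; if_then_else_; not)
open import Data.Sum using (_⊎_; inj₁; inj₂)
open import Data.Product using (Σ; _×_; _,_; ∃)
open import Data.List using (List; []; _∷_; foldr; map)
open import Data.List.Relation.Unary.All using (All)
open import Data.List.Relation.Unary.Any using (Any)
open import Data.List.Relation.Unary.AllPairs using (AllPairs)
open import Relation.Nullary using (¬_; yes; no)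
open import Relation.Binary.PropositionalEquality using (_≡_)

sumℤ : ∀ {N} → (Fin N → ℤ) → ℤ
sumℤ {zero}  f = + 0
sumℤ {suc N} f = f Fin.zero ℤ.+ sumℤ (λ i → f (Fin.suc i))

sumℚ : ∀ {N} → (Fin N → ℚ) → ℚ
sumℚ {zero}  f = 0ℚ
sumℚ {suc N} f = f Fin.zero ℚ.+ sumℚ (λ i → f (Fin.suc i))

sumℚList : List ℚ → ℚ
sumℚList = foldr ℚ._+_ 0ℚ

sumℤList : List ℤ → ℤ
sumℤList = foldr ℤ._+_ (+ 0)

toℚ : ℤ → ℚ
toℚ z = z ℚ./ 1

_^ℚ_ : ℚ → ℕ → ℚ
q ^ℚ zero  = 1ℚ
q ^ℚ suc k = q ℚ.* (q ^ℚ k)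

Poly : Set
Poly = List ℚ

eval : Poly → ℚ → ℚ
eval []       q = 0ℚ
eval (c ∷ cs) q = c ℚ.+ q ℚ.* eval cs q

-- Cartan matrices, simple reflections, roots, depth
-- Vertices of the diagram are Fin N; roots are integer-valued
-- functions on vertices (coordinates w.r.t. the simple roots).

Matrix : ℕ → Set
Matrix N = Fin N → Fin N → ℤ

Vecℤ : ℕ → Set
Vecℤ N = Fin N → ℤ

-- crystallographic Cartan matrix of a Coxeter group: integer entries,
-- A_ii = 2, A_ij ≤ 0 for i ≠ j, A_ij = 0 iff A_ji = 0.
-- (The Coxeter condition A_ij A_ji = 4cos²(π/m_ij) or ≥ 4 is then
-- automatic: A_ij A_ji is a nonnegative integer, 0,1,2,3 ↦ m = 2,3,4,6,
-- ≥ 4 ↦ m = ∞.)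
record IsCartan {N : ℕ} (A : Matrix N) : Set where
  field
    diag    : ∀ i → A i i ≡ + 2
    offdiag : ∀ i j → ¬ (i ≡ j) → A i j ℤ.≤ + 0
    zeroSym : ∀ i j → A i j ≡ + 0 → A j i ≡ + 0

simple : ∀ {N} → Fin N → Vecℤ N
simple y z with y Fin.≟ z
... | yes _ = + 1
... | no  _ = + 0

form : ∀ {N} → Matrix N → Fin N → Vecℤ N → ℤ
form A i β = sumℤ (λ j → A i j ℤ.* β j)

reflect : ∀ {N} → Matrix N → Fin N → Vecℤ N → Vecℤ N
reflect A i β z = β z ℤ.- form A i β ℤ.* simple i z

data Reach {N : ℕ} (A : Matrix N) : ℕ → Vecℤ N → Set where
  base : ∀ y → Reach A zero (simple y)
  step : ∀ {ℓ β} i → Reach A ℓ β → Reach A (suc ℓ) (reflect A i β)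

-- pointwise version (avoids function extensionality)
RootAt : ∀ {N} → Matrix N → ℕ → Vecℤ N → Set
RootAt {N} A ℓ γ = Σ (Vecℤ N) λ β → Reach A ℓ β × (∀ z → β z ≡ γ z)

IsRoot : ∀ {N} → Matrix N → Vecℤ N → Set
IsRoot A γ = Σ ℕ λ ℓ → RootAt A ℓ γ

IsPositiveRoot : ∀ {N} → Matrix N → Vecℤ N → Set
IsPositiveRoot A γ = IsRoot A γ × (∀ z → + 0 ℤ.≤ γ z)

DepthIs : ∀ {N} → Matrix N → Vecℤ N → ℕ → Set
DepthIs A γ d = Σ ℕ λ ℓ → (d ≡ suc ℓ) × RootAt A ℓ γ
                  × (∀ ℓ′ → RootAt A ℓ′ γ → ℓ ℕ.≤ ℓ′)

-- Elastic data and stretching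
-- Elastic data (x, L_x, R_x): a vertex x and a partition of its
-- neighbours; onLeft y = true means y ∈ L_x, false means y ∈ R_x
-- (the value on non-neighbours is irrelevant since A_xy = A_yx = 0).

record Elastic (m : ℕ) : Set where
  field
    x      : Fin m
    onLeft : Fin m → Bool

-- Vertices of st_n(G) are Fin (m + n):  inj₁ y (via splitAt) is the
-- original vertex y for y ≠ x, inj₁ x is x_0, inj₂ i is x_{i+1}.
data Place (m : ℕ) : Set where
  off : Fin m → Place m     -- an original vertex y ≠ x
  on  : ℕ → Place m         -- path vertex x_i

place : ∀ {m n} → Elastic m → Fin (m ℕ.+ n) → Place m
place {m} E v with splitAt m v
... | inj₂ i = on (suc (toℕ i))
... | inj₁ y with y Fin.≟ Elastic.x E
...   | yes _ = on 0
...   | no  _ = off y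

pathEntry : ℕ → ℕ → ℤ
pathEntry i j with i ℕ.≟ j | suc i ℕ.≟ j | i ℕ.≟ suc j
... | yes _ | _     | _     = + 2
... | no _  | yes _ | _     = ℤ.- (+ 1)
... | no _  | no _  | yes _ = ℤ.- (+ 1)
... | no _  | no _  | no _  = + 0

joined : ∀ {m} → Elastic m → ℕ → ℕ → Fin m → Bool
joined E n i y with i ℕ.≟ 0 | i ℕ.≟ n
... | yes _ | yes _ = true
... | yes _ | no _  = Elastic.onLeft E y
... | no _  | yes _ = not (Elastic.onLeft E y)
... | no _  | no _  = false

stEntry : ∀ {m} → Matrix m → Elastic m → ℕ → Place m → Place m → ℤ
stEntry A E n (off y) (off z) = A y z
stEntry A E n (on i)  (on j)  = pathEntry i j
stEntry A E n (on i)  (off z) =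
  if joined E n i z then A (Elastic.x E) z else + 0
stEntry A E n (off y) (on j)  =
  if joined E n j y then A y (Elastic.x E) else + 0

stA : ∀ {m} → Matrix m → Elastic m → (n : ℕ) → Matrix (m ℕ.+ n)
stA A E n u v = stEntry A E n (place E u) (place E v)

stVec : ∀ {m} → Elastic m → (n : ℕ) → Vecℤ m → Vecℤ (m ℕ.+ n)
stVec E n α v with place {n = n} E v
... | off y = α y
... | on _  = α (Elastic.x E)

-- Root hyperplanes, basic hyperplanes, fractures (in V* over ℚ; all
-- hyperplanes are defined over ℚ, so the intersection lattice and
-- dimensions agree with those over ℝ).
-- A functional f ∈ V* is given by its values f(α_y).

Fun : ℕ → Set
Fun N = Fin N → ℚ

pair : ∀ {N} → Fun N → Vecℤ N → ℚ
pair f v = sumℚ (λ i → f i ℚ.* toℚ (v i))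

InD : ∀ {N} → Fun N → Set
InD f = ∀ y → 0ℚ ℚ.< f y

SameHyp : ∀ {N} → Vecℤ N → Vecℤ N → Set
SameHyp γ δ = ∀ f → (pair f γ ≡ 0ℚ → pair f δ ≡ 0ℚ)
                  × (pair f δ ≡ 0ℚ → pair f γ ≡ 0ℚ)

ContainsMeet : ∀ {N} → Vecℤ N → Vecℤ N → Vecℤ N → Set
ContainsMeet γ β₁ β₂ =
  ∀ f → pair f β₁ ≡ 0ℚ → pair f β₂ ≡ 0ℚ → pair f γ ≡ 0ℚ

InRank2 : ∀ {N} → Matrix N → Vecℤ N → Vecℤ N → Vecℤ N → Set
InRank2 B β₁ β₂ γ = IsRoot B γ × ContainsMeet γ β₁ β₂

-- γ^⊥ is one of the basic hyperplanes of the rank 2 subarrangement of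
-- β₁^⊥, β₂^⊥, i.e. a wall of the region of that subarrangement
-- containing D: some point of γ^⊥ lies strictly on the same side as D
-- of every other hyperplane of the subarrangement.
Basic : ∀ {N} → Matrix N → Vecℤ N → Vecℤ N → Vecℤ N → Set
Basic B β₁ β₂ γ =
  InRank2 B β₁ β₂ γ ×
  Σ (Fun _) λ f → pair f γ ≡ 0ℚ ×
    (∀ δ → InRank2 B β₁ β₂ δ → ¬ SameHyp δ γ →
       ∀ g → InD g → 0ℚ ℚ.< pair f δ ℚ.* pair g δ)

-- β₁^⊥ cuts β₂^⊥ (β₂ a root)
Cuts : ∀ {N} → Matrix N → Vecℤ N → Vecℤ N → Set
Cuts B β₁ β₂ = IsRoot B β₁ × ¬ SameHyp β₁ β₂
               × Basic B β₁ β₂ β₁ × ¬ Basic B β₁ β₂ β₂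

SameFracture : ∀ {N} → Vecℤ N → Vecℤ N → Vecℤ N → Set
SameFracture η β φ = ∀ f → pair f η ≡ 0ℚ →
  (pair f β ≡ 0ℚ → pair f φ ≡ 0ℚ) × (pair f φ ≡ 0ℚ → pair f β ≡ 0ℚ)

ListsFractures : ∀ {N} → Matrix N → Vecℤ N → (k : ℕ) → (Fin k → Vecℤ N) → Set
ListsFractures B η k Fs =
  (∀ i → Cuts B (Fs i) η) ×
  (∀ β → Cuts B β η → Σ (Fin k) λ i → SameFracture η β (Fs i))

-- Characteristic polynomial of the arrangement {Fs i^⊥ ∩ η^⊥} in
-- E = η^⊥.  A subfamily is a subset S : Fin k → Bool; its intersection
-- (the flat of S, with the empty subfamily giving E) is:

Subfam : ℕ → Set
Subfam k = Fin k → Bool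

InFlat : ∀ {N k} → Vecℤ N → (Fin k → Vecℤ N) → Subfam k → Fun N → Set
InFlat η Fs S f = pair f η ≡ 0ℚ × (∀ i → S i ≡ true → pair f (Fs i) ≡ 0ℚ)

FlatSub : ∀ {N k} → Vecℤ N → (Fin k → Vecℤ N) → Subfam k → Subfam k → Set
FlatSub η Fs S S′ = ∀ f → InFlat η Fs S f → InFlat η Fs S′ f

FlatEq : ∀ {N k} → Vecℤ N → (Fin k → Vecℤ N) → Subfam k → Subfam k → Set
FlatEq η Fs S S′ = FlatSub η Fs S S′ × FlatSub η Fs S′ S

emptyS : ∀ {k} → Subfam k
emptyS i = false

fullS : ∀ {k} → Subfam k
fullS i = true

LinIndep : ∀ {N d} → (Fin d → Fun N) → Set
LinIndep {N} {d} g = ∀ (c : Fin d → ℚ) →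
  (∀ i → sumℚ (λ j → c j ℚ.* g j i) ≡ 0ℚ) → ∀ j → c j ≡ 0ℚ

DimIs : ∀ {N k} → Vecℤ N → (Fin k → Vecℤ N) → Subfam k → ℕ → Set
DimIs {N} η Fs S d =
  (Σ (Fin d → Fun N) λ g → (∀ j → InFlat η Fs S (g j)) × LinIndep g) ×
  (∀ d′ → d ℕ.< d′ → (g : Fin d′ → Fun N) →
     (∀ j → InFlat η Fs S (g j)) → ¬ LinIndep g)

EnumAbove : ∀ {N k} → Vecℤ N → (Fin k → Vecℤ N) → Subfam k → List (Subfam k) → Set
EnumAbove η Fs S Ls =
  All (λ C → FlatSub η Fs S C) Ls ×
  AllPairs (λ C C′ → ¬ FlatEq η Fs C C′) Ls ×
  (∀ C → FlatSub η Fs S C → Any (λ C′ → FlatEq η Fs C C′) Ls)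

-- μ(E, ·) : the Möbius function of the intersection lattice (ordered by
-- reverse inclusion, bottom E):  Σ_{E ≤ Y ≤ X} μ(E,Y) = [X = E]
IsMobius : ∀ {N k} → Vecℤ N → (Fin k → Vecℤ N) → (Subfam k → ℤ) → Set
IsMobius η Fs μ =
  (∀ C C′ → FlatEq η Fs C C′ → μ C ≡ μ C′) ×
  (∀ S Ls → EnumAbove η Fs S Ls →
     (FlatEq η Fs S emptyS → sumℤList (map μ Ls) ≡ + 1) ×
     (¬ FlatEq η Fs S emptyS → sumℤList (map μ Ls) ≡ + 0))

IsCharPoly : ∀ {N k} → Vecℤ N → (Fin k → Vecℤ N) → (ℚ → ℚ) → Set
IsCharPoly {N} {k} η Fs χ =
  Σ (Subfam k → ℤ) λ μ → IsMobius η Fs μ ×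
  Σ (List (Subfam k)) λ Ls → EnumAbove η Fs fullS Ls ×
  Σ (Subfam k → ℕ) λ dim → (∀ C → DimIs η Fs C (dim C)) ×
  (∀ q → χ q ≡ sumℚList (map (λ C → toℚ (μ C) ℚ.* (q ^ℚ dim C)) Ls))

module Submission where

-- The fractures of η^⊥ are the planes ⟨η , β⟩ with β a positive root made negative by the reflection t_η.  If η = w αᵢ, then
-- up to the exchange β ↔ -t_η β, which does not change the plane, these β are among the prefix roots of the word w.
--
-- In st_n(Φ) the reflection in X = x₀ + ⋯ + x_n plays the role of s_x, so that st_n(α) has a word in the blocks s_y (y ≠ x) and
-- s_X.  The positive roots made negative by s_X are X, e_j and X - e_j, where e_j = x₀ + ⋯ + x_{j-1} for 1 ≤ j ≤ n, and a block
-- sends e_j + st_n(g) to e_j + st_n(g′) with g′ depending neither on j nor on n.  Hence there are finite lists of vectors b and g,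
-- independent of n, such that the fractures of st_n(α)^⊥ are given by all the st_n(b) and all the e_j + st_n(g).  There are at
-- least n fractures for each g, but fewer than the depth t n + d, so there are at most t vectors g.
--
-- In the coordinates e_1 , … , e_n and y on the base, the arrangement says that no e_j takes one of the values -g(y).  The
-- characteristic polynomial is Whitney's alternating sum over subfamilies.  By deletion and restriction with respect to the
-- hyperplanes g = g′ of the base it becomes a sum of terms in which k of the values remain and are distinct, and such a term is a
-- polynomial in q times (q - k)^n.

-- The Cartan matrix may fail to be symmetrizable, so there is no invariant bilinear form: each
-- reflection carries its own coroot functional, transported along a word for its root. Words stand
-- for group elements throughout, and even the dichotomy of positive and negative roots is derived
-- from them.
--
-- Being cut is a statement about walls, while inversions are combinatorial. The link is that a
-- reflection inverting no other positive root of a plane gives a wall of the plane, and one that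
-- inverts another root does not. The first alternative quantifies over infinitely many roots, but
-- it is decidable, since it suffices to test the prefix roots of a word. If the test fails, the
-- search continues with a proper prefix, and it ends at a wall that cuts.
--
-- The polynomials p_k must not depend on n. For this reason deletion and restriction only insert
-- hyperplanes of the base: eliminating all path coordinates leaves a function of lists of base
-- forms, and one recursion splits it for all n at once.

open import Defs
open import Data.Bool using (Bool; true; false; not; if_then_else_)
import Data.Bool.Properties as BoolP
open import Data.Empty using (⊥; ⊥-elim)
open import Data.Fin as Fin using (Fin; toℕ)
import Data.Fin.Properties as FinP
open import Data.Integer as ℤ using (ℤ; +_; -[1+_]; _+_; _*_; _-_; -_; _≤_; _<_; 0ℤ; 1ℤ; -1ℤ)
import Data.Integer.Properties as ℤP
import Data.Integer.Tactic.RingSolver as ℤS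
open import Data.List as List using (List; []; _∷_; _++_; length; reverse; map)
import Data.List.Membership.Propositional.Properties as MemP
import Data.List.Properties as ListP
open import Data.List.Relation.Binary.Permutation.Propositional as Perm using (_↭_)
import Data.List.Relation.Binary.Permutation.Propositional.Properties as PermP
open import Data.List.Relation.Unary.All as All using (All; []; _∷_)
import Data.List.Relation.Unary.All.Properties as AllP
open import Data.List.Relation.Unary.AllPairs using (AllPairs; []; _∷_)
open import Data.List.Relation.Unary.Any as Any using (Any; here; there)
import Data.List.Relation.Unary.Any.Properties as AnyP
open import Data.Nat as ℕ using (ℕ; zero; suc)
import Data.Nat.Properties as ℕP
open import Data.Product using (Σ; _×_; _,_; proj₁; proj₂)
open import Data.Rational as ℚ using (ℚ; 0ℚ; 1ℚ) renaming (_+_ to _+ℚ_; _*_ to _*ℚ_; _-_ to _-ℚ_; -_ to -ℚ_; _<_ to _<ℚ_; _≤_ to _≤ℚ_)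
import Data.Rational.Properties as ℚP
import Data.Rational.Unnormalised as ℚᵘ
import Data.Rational.Unnormalised.Properties as ℚᵘP
open import Data.Sum using (_⊎_; inj₁; inj₂; [_,_]′)
open import Level using (0ℓ)
open import Relation.Binary.Definitions using (Tri; tri<; tri≈; tri>)
open import Relation.Binary.PropositionalEquality using (_≡_; _≢_; refl; sym; trans; cong; cong₂; subst; module ≡-Reasoning)
open import Relation.Nullary using (¬_; Dec; yes; no)
open import Relation.Nullary.Decidable using (_×-dec_; _⊎-dec_; _→-dec_; does; toWitness; True; ¬?; dec⇒maybe)
import Tactic.RingSolver as RS
import Tactic.RingSolver.Core.AlmostCommutativeRing as ACR

-- Integer vectors and simple reflections

infix 4 _≈_
infixl 6 _⊞_
infixr 7 _⊡_
infix 8 ⊟_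

-- Pointwise equality, for want of function extensionality. The record keeps the type from
-- unfolding, so that the two vectors can be inferred from it.
record _≈_ {N} (u v : Vecℤ N) : Set where
  constructor ptwise
  field at : ∀ z → u z ≡ v z
open _≈_ public

_⊞_ : ∀ {N} → Vecℤ N → Vecℤ N → Vecℤ N
(u ⊞ v) z = u z + v z

_⊡_ : ∀ {N} → ℤ → Vecℤ N → Vecℤ N
(c ⊡ v) z = c * v z

⊟_ : ∀ {N} → Vecℤ N → Vecℤ N
(⊟ v) z = - v z

sumℤ-cong : ∀ {N} {f g : Fin N → ℤ} → (∀ i → f i ≡ g i) → sumℤ f ≡ sumℤ g
sumℤ-cong {zero}  h = refl
sumℤ-cong {suc N} h = cong₂ _+_ (h Fin.zero) (sumℤ-cong (λ i → h (Fin.suc i)))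

interchange : ∀ a b c d → (a + b) + (c + d) ≡ (a + c) + (b + d)
interchange = ℤS.solve-∀

sumℤ-+ : ∀ {N} (f g : Fin N → ℤ) → sumℤ (λ i → f i + g i) ≡ sumℤ f + sumℤ g
sumℤ-+ {zero}  f g = refl
sumℤ-+ {suc N} f g = trans (cong (_+_ (f Fin.zero + g Fin.zero)) (sumℤ-+ (λ i → f (Fin.suc i)) (λ i → g (Fin.suc i))))
  (interchange (f Fin.zero) (g Fin.zero) _ _)

sumℤ-* : ∀ {N} c (f : Fin N → ℤ) → sumℤ (λ i → c * f i) ≡ c * sumℤ f
sumℤ-* {zero}  c f = sym (ℤP.*-zeroʳ c)
sumℤ-* {suc N} c f = trans (cong (_+_ (c * f Fin.zero)) (sumℤ-* c (λ i → f (Fin.suc i))))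
  (sym (ℤP.*-distribˡ-+ c _ _))

sumℤ-zero : ∀ {N} {f : Fin N → ℤ} → (∀ i → f i ≡ 0ℤ) → sumℤ f ≡ 0ℤ
sumℤ-zero {zero}  h = refl
sumℤ-zero {suc N} h = cong₂ _+_ (h Fin.zero) (sumℤ-zero (λ i → h (Fin.suc i)))

simple-self : ∀ {N} (i : Fin N) → simple i i ≡ 1ℤ
simple-self i with i Fin.≟ i
... | yes _ = refl
... | no ¬p = ⊥-elim (¬p refl)

simple-other : ∀ {N} {i z : Fin N} → i ≢ z → simple i z ≡ 0ℤ
simple-other {i = i} {z} i≢z with i Fin.≟ z
... | yes p = ⊥-elim (i≢z p)
... | no _  = refl

simple-suc : ∀ {N} (i z : Fin N) → simple (Fin.suc i) (Fin.suc z) ≡ simple i z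
simple-suc i z = by-cases (i Fin.≟ z)
  where
  by-cases : Dec (i ≡ z) → simple (Fin.suc i) (Fin.suc z) ≡ simple i z
  by-cases (yes refl) = trans (simple-self (Fin.suc i)) (sym (simple-self i))
  by-cases (no i≢z)   = trans (simple-other (λ e → i≢z (FinP.suc-injective e))) (sym (simple-other i≢z))

sumℤ-simple : ∀ {N} (f : Fin N → ℤ) i → sumℤ (λ z → f z * simple i z) ≡ f i
sumℤ-simple {suc N} f Fin.zero =
  trans (cong₂ _+_ (ℤP.*-identityʳ (f Fin.zero)) (sumℤ-zero (λ z → ℤP.*-zeroʳ (f (Fin.suc z)))))
        (ℤP.+-identityʳ _)
sumℤ-simple {suc N} f (Fin.suc i) =
  trans (cong₂ _+_ (ℤP.*-zeroʳ (f Fin.zero))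
          (trans (sumℤ-cong (λ z → cong (f (Fin.suc z) *_) (simple-suc i z))) (sumℤ-simple (λ z → f (Fin.suc z)) i)))
        (ℤP.+-identityˡ _)

module _ {N} (A : Matrix N) where

  form-cong : ∀ i {u v} → u ≈ v → form A i u ≡ form A i v
  form-cong i e = sumℤ-cong (λ j → cong (A i j *_) (at e j))

  form-⊞ : ∀ i u v → form A i (u ⊞ v) ≡ form A i u + form A i v
  form-⊞ i u v = trans (sumℤ-cong (λ j → ℤP.*-distribˡ-+ (A i j) (u j) (v j))) (sumℤ-+ (λ j → A i j * u j) (λ j → A i j * v j))

  form-⊡ : ∀ i c v → form A i (c ⊡ v) ≡ c * form A i v
  form-⊡ i c v = trans (sumℤ-cong (λ j → comm₃ (A i j) c (v j))) (sumℤ-* c (λ j → A i j * v j))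
    where
    comm₃ : ∀ a b c → a * (b * c) ≡ b * (a * c)
    comm₃ = ℤS.solve-∀

  form-simple : ∀ i j → form A i (simple j) ≡ A i j
  form-simple i j = sumℤ-simple (A i) j

Pos Neg : ∀ {N} → Vecℤ N → Set
Pos v = ∀ z → 0ℤ ≤ v z
Neg v = ∀ z → v z ≤ 0ℤ

Pos-≈ : ∀ {N} {u v : Vecℤ N} → u ≈ v → Pos u → Pos v
Pos-≈ e p z = subst (0ℤ ≤_) (at e z) (p z)

Neg-≈ : ∀ {N} {u v : Vecℤ N} → u ≈ v → Neg u → Neg v
Neg-≈ e p z = subst (_≤ 0ℤ) (at e z) (p z)

Neg-⊟ : ∀ {N} {v : Vecℤ N} → Pos v → Neg (⊟ v)
Neg-⊟ p z = ℤP.neg-mono-≤ (p z)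

Pos-⊟ : ∀ {N} {v : Vecℤ N} → Neg v → Pos (⊟ v)
Pos-⊟ p z = ℤP.neg-mono-≤ (p z)

⊟-swap : ∀ {N} {u v : Vecℤ N} → u ≈ ⊟ v → v ≈ (⊟ u)
⊟-swap {u = u} {v} e = ptwise λ z → trans (sym (ℤP.neg-involutive (v z))) (cong -_ (sym (at e z)))

≈-sym : ∀ {N} {u v : Vecℤ N} → u ≈ v → v ≈ u
≈-sym e = ptwise λ z → sym (at e z)

≈-trans : ∀ {N} {u v w : Vecℤ N} → u ≈ v → v ≈ w → u ≈ w
≈-trans e f = ptwise λ z → trans (at e z) (at f z)

≈-refl : ∀ {N} {u : Vecℤ N} → u ≈ u
≈-refl = ptwise λ z → refl

≈-reflexive : ∀ {N} {u v : Vecℤ N} → u ≡ v → u ≈ v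
≈-reflexive refl = ≈-refl

⊟-⊡ : ∀ {N} (v : Vecℤ N) → ⊟ v ≈ -1ℤ ⊡ v
⊟-⊡ v = ptwise λ z → sym (ℤP.-1*i≡-i (v z))

⊟-cong : ∀ {N} {u v : Vecℤ N} → u ≈ v → ⊟ u ≈ ⊟ v
⊟-cong e = ptwise λ z → cong -_ (at e z)

⊟-invol : ∀ {N} (v : Vecℤ N) → ⊟ ⊟ v ≈ v
⊟-invol v = ptwise λ z → ℤP.neg-involutive (v z)

*-nonneg : ∀ {a b} → 0ℤ ≤ a → 0ℤ ≤ b → 0ℤ ≤ a * b
*-nonneg {+ a} {+ b} _ _ = subst (0ℤ ≤_) (ℤP.pos-* a b) (ℤ.+≤+ ℕ.z≤n)
*-nonneg { -[1+ a ]} {b} () _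
*-nonneg {+ a} { -[1+ b ]} _ ()

module Reflections {N : ℕ} (A : Matrix N) (cartan : IsCartan A) where
  open IsCartan cartan

  s : Fin N → Vecℤ N → Vecℤ N
  s = reflect A

  s-cong : ∀ i {u v} → u ≈ v → s i u ≈ s i v
  s-cong i e = ptwise λ z → cong₂ (λ a b → a - b * simple i z) (at e z) (form-cong A i e)

  s-⊞ : ∀ i u v → s i (u ⊞ v) ≈ s i u ⊞ s i v
  s-⊞ i u v = ptwise λ z → trans (cong (λ b → (u z + v z) - b * simple i z) (form-⊞ A i u v))
    (lem (u z) (v z) (form A i u) (form A i v) (simple i z))
    where
    lem : ∀ a b p q x → (a + b) - (p + q) * x ≡ (a - p * x) + (b - q * x)
    lem = ℤS.solve-∀

  s-⊡ : ∀ i c v → s i (c ⊡ v) ≈ c ⊡ s i v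
  s-⊡ i c v = ptwise λ z → trans (cong (λ b → c * v z - b * simple i z) (form-⊡ A i c v))
    (lem c (v z) (form A i v) (simple i z))
    where
    lem : ∀ c a p x → c * a - (c * p) * x ≡ c * (a - p * x)
    lem = ℤS.solve-∀

  s-expand : ∀ i v → s i v ≈ v ⊞ (- form A i v) ⊡ simple i
  s-expand i v = ptwise λ z → lem (v z) (form A i v) (simple i z)
    where
    lem : ∀ a p x → a - p * x ≡ a + (- p) * x
    lem = ℤS.solve-∀

  form-s : ∀ i v → form A i (s i v) ≡ - form A i v
  form-s i v = begin
    form A i (s i v)                                       ≡⟨ form-cong A i (s-expand i v) ⟩
    form A i (v ⊞ (- form A i v) ⊡ simple i)               ≡⟨ form-⊞ A i v ((- form A i v) ⊡ simple i) ⟩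
    form A i v + form A i ((- form A i v) ⊡ simple i)      ≡⟨ cong (_+_ (form A i v)) (form-⊡ A i (- form A i v) (simple i)) ⟩
    form A i v + (- form A i v) * form A i (simple i)      ≡⟨ cong (λ b → form A i v + (- form A i v) * b) (trans (form-simple A i i) (diag i)) ⟩
    form A i v + (- form A i v) * + 2                      ≡⟨ lem (form A i v) ⟩
    - form A i v ∎
    where
    open ≡-Reasoning
    lem : ∀ p → p + (- p) * + 2 ≡ - p
    lem = ℤS.solve-∀

  s-invol : ∀ i v → s i (s i v) ≈ v
  s-invol i v = ptwise λ z → trans (cong (λ b → (v z - form A i v * simple i z) - b * simple i z) (form-s i v))
    (lem (v z) (form A i v) (simple i z))
    where
    lem : ∀ a p x → (a - p * x) - (- p) * x ≡ a
    lem = ℤS.solve-∀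

  s-self : ∀ i → s i (simple i) ≈ ⊟ simple i
  s-self i = ptwise λ z → trans (cong (λ b → simple i z - b * simple i z) (trans (form-simple A i i) (diag i)))
    (lem (simple i z))
    where
    lem : ∀ x → x - + 2 * x ≡ - x
    lem = ℤS.solve-∀

  s-off : ∀ {i z} → i ≢ z → ∀ v → s i v z ≡ v z
  s-off {i} {z} i≢z v = trans (cong (λ b → v z - form A i v * b) (simple-other i≢z)) (lem (v z) (form A i v))
    where
    lem : ∀ a p → a - p * 0ℤ ≡ a
    lem = ℤS.solve-∀

  act : List (Fin N) → Vecℤ N → Vecℤ N
  act []      v = v
  act (i ∷ w) v = s i (act w v)

  act-cong : ∀ w {u v} → u ≈ v → act w u ≈ act w v
  act-cong []      e = e
  act-cong (i ∷ w) e = s-cong i (act-cong w e)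

  act-⊞ : ∀ w u v → act w (u ⊞ v) ≈ act w u ⊞ act w v
  act-⊞ []      u v = ≈-refl
  act-⊞ (i ∷ w) u v = ≈-trans (s-cong i (act-⊞ w u v)) (s-⊞ i (act w u) (act w v))

  act-⊡ : ∀ w c v → act w (c ⊡ v) ≈ c ⊡ act w v
  act-⊡ []      c v = ≈-refl
  act-⊡ (i ∷ w) c v = ≈-trans (s-cong i (act-⊡ w c v)) (s-⊡ i c (act w v))

  act-⊟ : ∀ w v → act w (⊟ v) ≈ ⊟ act w v
  act-⊟ w v = ≈-trans (act-cong w (⊟-⊡ v)) (≈-trans (act-⊡ w -1ℤ v) (≈-sym (⊟-⊡ (act w v))))

  act-++ : ∀ u w v → act (u ++ w) v ≡ act u (act w v)
  act-++ []      w v = refl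
  act-++ (i ∷ u) w v = cong (s i) (act-++ u w v)

  act-reverse-∷ : ∀ i w v → act (reverse (i ∷ w)) v ≡ act (reverse w) (s i v)
  act-reverse-∷ i w v = trans (cong (λ l → act l v) (ListP.unfold-reverse i w)) (act-++ (reverse w) (i ∷ []) v)

  act-reverseˡ : ∀ w v → act (reverse w) (act w v) ≈ v
  act-reverseˡ []      v = ≈-refl
  act-reverseˡ (i ∷ w) v = ≈-trans (≈-reflexive (act-reverse-∷ i w (s i (act w v))))
    (≈-trans (act-cong (reverse w) (s-invol i (act w v))) (act-reverseˡ w v))

  act-reverseʳ : ∀ w v → act w (act (reverse w) v) ≈ v
  act-reverseʳ []      v = ≈-refl
  act-reverseʳ (i ∷ w) v = ≈-trans (≈-reflexive (cong (λ f → s i (act w f)) (act-reverse-∷ i w v)))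
    (≈-trans (s-cong i (act-reverseʳ w (s i v))) (s-invol i v))

  root : List (Fin N) → Fin N → Vecℤ N
  root w i = act w (simple i)

-- Dihedral subgroups

≤-by : ∀ {x y} d → 0ℤ ≤ d → y ≡ x + d → x ≤ y
≤-by {x} d p refl = subst (_≤ x + d) (ℤP.+-identityʳ x) (ℤP.+-monoʳ-≤ x p)

0≤-diff : ∀ {x y} → x ≤ y → 0ℤ ≤ y - x
0≤-diff = ℤP.i≤j⇒0≤j-i

+-nonneg : ∀ {x y} → 0ℤ ≤ x → 0ℤ ≤ y → 0ℤ ≤ x + y
+-nonneg = ℤP.+-mono-≤

halve : ∀ {x} → 0ℤ ≤ + 2 * x → 0ℤ ≤ x
halve {+ x} _ = ℤ.+≤+ ℕ.z≤n
halve { -[1+ x ]} ()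

Quad : Set
Quad = ℤ × ℤ × ℤ × ℤ

module Dihedral (a b : ℤ) where

  -- (x₁ , x₂ , y₁ , y₂) stands for v ↦ v + (x₁p + x₂r)αᵢ + (y₁p + y₂r)αⱼ, where p = (αᵢ , v) and r = (αⱼ , v).
  stepQ : Bool → Quad → Quad
  stepQ true  (x₁ , x₂ , y₁ , y₂) = (a * y₁ - x₁ - 1ℤ , a * y₂ - x₂ , y₁ , y₂)
  stepQ false (x₁ , x₂ , y₁ , y₂) = (x₁ , x₂ , b * x₁ - y₁ , b * x₂ - y₂ - 1ℤ)

  quad : List Bool → Quad
  quad []      = (0ℤ , 0ℤ , 0ℤ , 0ℤ)
  quad (c ∷ d) = stepQ c (quad d)

  -- The coefficients of αᵢ and αⱼ in the image of v = αᵢ, for which p = 2 and r = -b.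
  imageᵢ imageⱼ : Quad → ℤ
  imageᵢ (x₁ , x₂ , y₁ , y₂) = 1ℤ + (x₁ * + 2 + x₂ * (- b))
  imageⱼ (x₁ , x₂ , y₁ , y₂) = y₁ * + 2 + y₂ * (- b)

parity : ℕ → Bool → Bool
parity zero    c = c
parity (suc k) c = not (parity k c)

-- The alternating word whose last letter, the first to act, is `c`; the leading letter therefore
-- depends on the parity of the length.
alternating : Bool → ℕ → List Bool
alternating c zero    = []
alternating c (suc k) = parity k c ∷ alternating c k

parity-not : ∀ k c → parity k (not c) ≡ not (parity k c)
parity-not zero    c = refl
parity-not (suc k) c = cong not (parity-not k c)

alternating-snoc : ∀ c k → alternating c (suc k) ≡ alternating (not c) k ++ c ∷ []
alternating-snoc c zero    = refl
alternating-snoc c (suc k) = cong₂ _∷_ (sym (parity-not k c)) (alternating-snoc c k)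

length-alternating : ∀ c k → length (alternating c k) ≡ k
length-alternating c zero    = refl
length-alternating c (suc k) = cong suc (length-alternating c k)

module Signs {N : ℕ} (A : Matrix N) (cartan : IsCartan A) where
  open Reflections A cartan public
  open IsCartan cartan

  s-by : ∀ i v {f} → form A i v ≡ f → ∀ z → s i v z ≡ v z - f * simple i z
  s-by i v e z = cong (λ g → v z - g * simple i z) e

  -- Replaces the condition that w sᵢ is shorter than w. Only the actions are compared, so no
  -- presentation of the group enters.
  Short : List (Fin N) → Fin N → Set
  Short w i = Σ (List (Fin N)) λ w′ → length w′ ℕ.< length w × (∀ v → act w′ v ≈ act w (s i v))

  module _ (i j : Fin N) (i≢j : i ≢ j) where

    letter : Bool → Fin N
    letter true  = i
    letter false = j

    actᵈ : List Bool → Vecℤ N → Vecℤ N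
    actᵈ d = act (map letter d)

    Shortᵈ : List Bool → Set
    Shortᵈ d = Σ (List Bool) λ d′ → length d′ ℕ.< length d × (∀ v → actᵈ d′ v ≈ actᵈ d (s i v))

    Shortᵈ-∷ : ∀ c {d} → Shortᵈ d → Shortᵈ (c ∷ d)
    Shortᵈ-∷ c (d′ , l , e) = c ∷ d′ , ℕ.s≤s l , λ v → s-cong (letter c) (e v)

    Nonneg : List Bool → Set
    Nonneg d = Σ ℤ λ x → Σ ℤ λ y → 0ℤ ≤ x × 0ℤ ≤ y × (actᵈ d (simple i) ≈ x ⊡ simple i ⊞ y ⊡ simple j)

    actᵈ-∷ʳ : ∀ d v → actᵈ (d ++ true ∷ []) v ≡ actᵈ d (s i v)
    actᵈ-∷ʳ d v = trans (cong (λ l → act l v) (ListP.map-++ letter d (true ∷ []))) (act-++ (map letter d) (i ∷ []) v)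

    -- A cancellation removes two letters. This leaves room for the letter i that has to be appended
    -- to obtain a word for d sᵢ shorter than d.
    data Reduced : List Bool → Set where
      cancels : ∀ {d} d′ → 2 ℕ.+ length d′ ℕ.≤ length d → (∀ v → actᵈ d′ v ≈ actᵈ d v) → Reduced d
      alt     : ∀ c k → Reduced (alternating c k)

    reduced-∷ : ∀ c {d} → Reduced d → Reduced (c ∷ d)
    reduced-∷ c (cancels d′ l e) = cancels (c ∷ d′) (ℕ.s≤s l) (λ v → s-cong (letter c) (e v))
    reduced-∷ c (alt c′ zero)    = alt c 1
    reduced-∷ true (alt c′ (suc k)) with parity k c′ in eq
    ... | true  = cancels (alternating c′ k) ℕP.≤-refl (λ v → ≈-sym (s-invol i (actᵈ (alternating c′ k) v)))
    ... | false = subst Reduced (cong₂ (λ x y → x ∷ y ∷ alternating c′ k) (cong not eq) eq) (alt c′ (2 ℕ.+ k))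
    reduced-∷ false (alt c′ (suc k)) with parity k c′ in eq
    ... | false = cancels (alternating c′ k) ℕP.≤-refl (λ v → ≈-sym (s-invol j (actᵈ (alternating c′ k) v)))
    ... | true  = subst Reduced (cong₂ (λ x y → x ∷ y ∷ alternating c′ k) (cong not eq) eq) (alt c′ (2 ℕ.+ k))

    reduced : ∀ d → Reduced d
    reduced []      = alt true zero
    reduced (c ∷ d) = reduced-∷ c (reduced d)

    -- An alternating word ending in i gets shorter when sᵢ is appended, and a word that is not
    -- alternating has two letters to spare. Hence only the alternating words ending in j need an
    -- argument.
    nonneg-or-short : (∀ k → Nonneg (alternating false k) ⊎ Shortᵈ (alternating false k)) →
                      ∀ d → Nonneg d ⊎ Shortᵈ d
    nonneg-or-short h d with reduced d
    ... | cancels d′ l e = inj₂ (d′ ++ true ∷ [] ,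
          subst (ℕ._< length d) (sym (trans (ListP.length-++ d′) (ℕP.+-comm (length d′) 1))) l ,
          λ v → ≈-trans (≈-reflexive (actᵈ-∷ʳ d′ v)) (e (s i v)))
    ... | alt false k = h k
    ... | alt true zero = inj₁ (1ℤ , 0ℤ , ℤ.+≤+ ℕ.z≤n , ℤ.+≤+ ℕ.z≤n , ptwise λ z → lem (simple i z) (simple j z))
      where
      lem : ∀ x y → x ≡ 1ℤ * x + 0ℤ * y
      lem = ℤS.solve-∀
    ... | alt true (suc k) = inj₂ (alternating false k , ℕ.s≤s (ℕP.≤-reflexive
        (trans (length-alternating false k) (sym (length-alternating true k)))) ,
          λ v → ≈-sym (≈-trans (≈-reflexive (cong (λ d → actᵈ d (s i v)) (alternating-snoc true k)))
                  (≈-trans (≈-reflexive (actᵈ-∷ʳ (alternating false k) (s i v))) (act-cong (map letter (alternating false k)) (s-invol i v)))))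

    module _ (a b : ℤ) (Aij : A i j ≡ - a) (Aji : A j i ≡ - b) where
      open Dihedral a b

      apply : Quad → Vecℤ N → Vecℤ N
      apply (x₁ , x₂ , y₁ , y₂) v = v ⊞ (x₁ * form A i v + x₂ * form A j v) ⊡ simple i ⊞ (y₁ * form A i v + y₂ * form A j v) ⊡ simple j

      actᵈ-quad : ∀ d v → actᵈ d v ≈ apply (quad d) v
      actᵈ-quad [] v = ptwise λ z → lem (v z) (form A i v) (form A j v) (simple i z) (simple j z)
        where
        lem : ∀ c p r x y → c ≡ c + (0ℤ * p + 0ℤ * r) * x + (0ℤ * p + 0ℤ * r) * y
        lem = ℤS.solve-∀
      actᵈ-quad (true ∷ d) v with quad d | actᵈ-quad d v
      ... | (x₁ , x₂ , y₁ , y₂) | ih = ≈-trans (s-cong i ih) (ptwise λ z →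
          trans (s-by i (v ⊞ X ⊡ simple i ⊞ Y ⊡ simple j) formula z)
            (lem x₁ x₂ y₁ y₂ a (form A i v) (form A j v) (v z) (simple i z) (simple j z)))
        where
        X Y : ℤ
        X = x₁ * form A i v + x₂ * form A j v
        Y = y₁ * form A i v + y₂ * form A j v
        formula : form A i (v ⊞ X ⊡ simple i ⊞ Y ⊡ simple j) ≡ form A i v + X * + 2 + Y * (- a)
        formula = trans (form-⊞ A i (v ⊞ X ⊡ simple i) (Y ⊡ simple j))
          (cong₂ _+_ (trans (form-⊞ A i v (X ⊡ simple i)) (cong (_+_ (form A i v))
              (trans (form-⊡ A i X (simple i)) (cong (X *_) (trans (form-simple A i i) (diag i))))))
                     (trans (form-⊡ A i Y (simple j)) (cong (Y *_) (trans (form-simple A i j) Aij))))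
        lem : ∀ x₁ x₂ y₁ y₂ a p r c x y →
              c + (x₁ * p + x₂ * r) * x + (y₁ * p + y₂ * r) * y - (p + (x₁ * p + x₂ * r) * + 2 + (y₁ * p + y₂ * r) * (- a)) * x
              ≡ c + ((a * y₁ - x₁ - 1ℤ) * p + (a * y₂ - x₂) * r) * x + (y₁ * p + y₂ * r) * y
        lem = ℤS.solve-∀
      actᵈ-quad (false ∷ d) v with quad d | actᵈ-quad d v
      ... | (x₁ , x₂ , y₁ , y₂) | ih = ≈-trans (s-cong j ih) (ptwise λ z →
          trans (s-by j (v ⊞ X ⊡ simple i ⊞ Y ⊡ simple j) formula z)
            (lem x₁ x₂ y₁ y₂ b (form A i v) (form A j v) (v z) (simple i z) (simple j z)))
        where
        X Y : ℤ
        X = x₁ * form A i v + x₂ * form A j v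
        Y = y₁ * form A i v + y₂ * form A j v
        formula : form A j (v ⊞ X ⊡ simple i ⊞ Y ⊡ simple j) ≡ form A j v + X * (- b) + Y * + 2
        formula = trans (form-⊞ A j (v ⊞ X ⊡ simple i) (Y ⊡ simple j))
          (cong₂ _+_ (trans (form-⊞ A j v (X ⊡ simple i)) (cong (_+_ (form A j v))
              (trans (form-⊡ A j X (simple i)) (cong (X *_) (trans (form-simple A j i) Aji)))))
                     (trans (form-⊡ A j Y (simple j)) (cong (Y *_) (trans (form-simple A j j) (diag j)))))
        lem : ∀ x₁ x₂ y₁ y₂ b p r c x y →
              c + (x₁ * p + x₂ * r) * x + (y₁ * p + y₂ * r) * y - (r + (x₁ * p + x₂ * r) * (- b) + (y₁ * p + y₂ * r) * + 2) * y
              ≡ c + (x₁ * p + x₂ * r) * x + ((b * x₁ - y₁) * p + (b * x₂ - y₂ - 1ℤ) * r) * y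
        lem = ℤS.solve-∀

      nonneg-quad : ∀ d → 0ℤ ≤ imageᵢ (quad d) → 0ℤ ≤ imageⱼ (quad d) → Nonneg d
      nonneg-quad d with quad d | actᵈ-quad d (simple i)
      ... | (x₁ , x₂ , y₁ , y₂) | e = λ p q → _ , _ , p , q , ≈-trans e (ptwise λ z →
          trans (cong₂ (λ f g → simple i z + (x₁ * f + x₂ * g) * simple i z + (y₁ * f + y₂ * g) * simple j z)
                   (trans (form-simple A i i) (diag i)) (trans (form-simple A j i) Aji))
                (lem x₁ x₂ y₁ y₂ b (simple i z) (simple j z)))
        where
        lem : ∀ x₁ x₂ y₁ y₂ b x y → x + (x₁ * + 2 + x₂ * (- b)) * x + (y₁ * + 2 + y₂ * (- b)) * y
              ≡ (1ℤ + (x₁ * + 2 + x₂ * (- b))) * x + (y₁ * + 2 + y₂ * (- b)) * y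
        lem = ℤS.solve-∀

      -- Here `suc m` is the order of sᵢsⱼ, and `braid` is the braid relation on the level of
      -- coefficients. It turns an alternating word of that length ending in j into one ending in i,
      -- which is short; longer words inherit this from their tails.
      finite : ∀ m → quad (alternating false (suc m)) ≡ quad (alternating true (suc m)) →
               (∀ {k} → k ℕ.< suc m → 0ℤ ≤ imageᵢ (quad (alternating false k)) × 0ℤ ≤ imageⱼ (quad (alternating false k))) →
               ∀ d → Nonneg d ⊎ Shortᵈ d
      finite m braid nn = nonneg-or-short by-length
        where
        short-m : Shortᵈ (alternating false (suc m))
        short-m = alternating false m , ℕ.s≤s ℕP.≤-refl , λ v → ≈-sym
          (≈-trans (actᵈ-quad (alternating false (suc m)) (s i v))
          (≈-trans (≈-reflexive (cong (λ q → apply q (s i v)) braid))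
          (≈-trans (≈-sym (actᵈ-quad (alternating true (suc m)) (s i v)))
          (≈-trans (≈-reflexive (cong (λ d → actᵈ d (s i v)) (alternating-snoc true m)))
          (≈-trans (≈-reflexive (actᵈ-∷ʳ (alternating false m) (s i v)))
                   (act-cong (map letter (alternating false m)) (s-invol i v)))))))
        short-long : ∀ r → Shortᵈ (alternating false (r ℕ.+ suc m))
        short-long zero    = short-m
        short-long (suc r) = Shortᵈ-∷ (parity (r ℕ.+ suc m) false) {alternating false (r ℕ.+ suc m)} (short-long r)
        by-length : ∀ k → Nonneg (alternating false k) ⊎ Shortᵈ (alternating false k)
        by-length k with k ℕP.<? suc m
        ... | yes k<m = inj₁ (nonneg-quad (alternating false k) (proj₁ (nn k<m)) (proj₂ (nn k<m)))
        ... | no k≮m  = inj₂ (subst (λ k → Shortᵈ (alternating false k)) (ℕP.m∸n+n≡m (ℕP.≮⇒≥ k≮m)) (short-long (k ℕ.∸ suc m)))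

      module _ (0≤a : 0ℤ ≤ a) (0≤b : 0ℤ ≤ b) (4≤ab : + 4 ≤ a * b) where

        -- The slope condition propagates because ab ≥ 4.
        Slope : Bool → ℤ → ℤ → Set
        Slope true  x y = a * y ≤ + 2 * x
        Slope false x y = b * x ≤ + 2 * y

        infinite-step : ∀ c {d x y} → 0ℤ ≤ x → 0ℤ ≤ y → actᵈ d (simple i) ≈ x ⊡ simple i ⊞ y ⊡ simple j → Slope c x y →
          Σ ℤ λ x′ → Σ ℤ λ y′ → 0ℤ ≤ x′ × 0ℤ ≤ y′ × (actᵈ (not c ∷ d) (simple i) ≈ x′ ⊡ simple i ⊞ y′ ⊡ simple j) × Slope (not c) x′ y′
        infinite-step true {d} {x} {y} 0≤x 0≤y e sl = x , b * x - y , 0≤x ,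
          subst (0ℤ ≤_) (lem₂ b x y) (+-nonneg t 0≤y) ,
          ≈-trans (s-cong j e) (ptwise λ z → trans (s-by j (x ⊡ simple i ⊞ y ⊡ simple j) formula z) (lem b x y (simple i z) (simple j z))) ,
          ≤-by (b * x - + 2 * y) t (lem₃ b x y)
          where
          t : 0ℤ ≤ b * x - + 2 * y
          t = halve (subst (0ℤ ≤_) (lem₁ a b x y) (+-nonneg (*-nonneg 0≤b (0≤-diff sl)) (*-nonneg (0≤-diff 4≤ab) 0≤y)))
            where
            lem₁ : ∀ a b x y → b * (+ 2 * x - a * y) + (a * b - + 4) * y ≡ + 2 * (b * x - + 2 * y)
            lem₁ = ℤS.solve-∀
          lem₂ : ∀ b x y → b * x - + 2 * y + y ≡ b * x - y
          lem₂ = ℤS.solve-∀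
          lem₃ : ∀ b x y → + 2 * (b * x - y) ≡ b * x + (b * x - + 2 * y)
          lem₃ = ℤS.solve-∀
          formula : form A j (x ⊡ simple i ⊞ y ⊡ simple j) ≡ x * (- b) + y * + 2
          formula = trans (form-⊞ A j (x ⊡ simple i) (y ⊡ simple j))
            (cong₂ _+_ (trans (form-⊡ A j x (simple i)) (cong (x *_) (trans (form-simple A j i) Aji)))
                       (trans (form-⊡ A j y (simple j)) (cong (y *_) (trans (form-simple A j j) (diag j)))))
          lem : ∀ b x y u v → x * u + y * v - (x * (- b) + y * + 2) * v ≡ x * u + (b * x - y) * v
          lem = ℤS.solve-∀
        infinite-step false {d} {x} {y} 0≤x 0≤y e sl = a * y - x , y ,
          subst (0ℤ ≤_) (lem₂ a x y) (+-nonneg t 0≤x) , 0≤y ,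
          ≈-trans (s-cong i e) (ptwise λ z → trans (s-by i (x ⊡ simple i ⊞ y ⊡ simple j) formula z) (lem a x y (simple i z) (simple j z))) ,
          ≤-by (a * y - + 2 * x) t (lem₃ a x y)
          where
          t : 0ℤ ≤ a * y - + 2 * x
          t = halve (subst (0ℤ ≤_) (lem₁ a b x y) (+-nonneg (*-nonneg 0≤a (0≤-diff sl)) (*-nonneg (0≤-diff 4≤ab) 0≤x)))
            where
            lem₁ : ∀ a b x y → a * (+ 2 * y - b * x) + (a * b - + 4) * x ≡ + 2 * (a * y - + 2 * x)
            lem₁ = ℤS.solve-∀
          lem₂ : ∀ a x y → a * y - + 2 * x + x ≡ a * y - x
          lem₂ = ℤS.solve-∀
          lem₃ : ∀ a x y → + 2 * (a * y - x) ≡ a * y + (a * y - + 2 * x)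
          lem₃ = ℤS.solve-∀
          formula : form A i (x ⊡ simple i ⊞ y ⊡ simple j) ≡ x * + 2 + y * (- a)
          formula = trans (form-⊞ A i (x ⊡ simple i) (y ⊡ simple j))
            (cong₂ _+_ (trans (form-⊡ A i x (simple i)) (cong (x *_) (trans (form-simple A i i) (diag i))))
                       (trans (form-⊡ A i y (simple j)) (cong (y *_) (trans (form-simple A i j) Aij))))
          lem : ∀ a x y u v → x * u + y * v - (x * + 2 + y * (- a)) * u ≡ (a * y - x) * u + y * v
          lem = ℤS.solve-∀

        infinite-alt : ∀ k → Σ ℤ λ x → Σ ℤ λ y → 0ℤ ≤ x × 0ℤ ≤ y ×
          (actᵈ (alternating false k) (simple i) ≈ x ⊡ simple i ⊞ y ⊡ simple j) × Slope (not (parity k false)) x y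
        infinite-alt zero = 1ℤ , 0ℤ , ℤ.+≤+ ℕ.z≤n , ℤ.+≤+ ℕ.z≤n , ptwise (λ z → lem (simple i z) (simple j z)) ,
          subst (_≤ + 2 * 1ℤ) (sym (ℤP.*-zeroʳ a)) (ℤ.+≤+ ℕ.z≤n)
          where
          lem : ∀ x y → x ≡ 1ℤ * x + 0ℤ * y
          lem = ℤS.solve-∀
        infinite-alt (suc k) with infinite-alt k
        ... | x , y , p , q , e , sl with infinite-step (not (parity k false)) {alternating false k} p q e sl
        ... | x′ , y′ , p′ , q′ , e′ , sl′ =
          x′ , y′ , p′ , q′ , subst (λ c → actᵈ (c ∷ alternating false k) (simple i) ≈ _) (not-not (parity k false)) e′ , sl′
          where
          not-not : ∀ c → not (not c) ≡ c
          not-not true  = refl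
          not-not false = refl

        infinite : ∀ d → Nonneg d ⊎ Shortᵈ d
        infinite = nonneg-or-short (λ k → let (x , y , p , q , e , _) = infinite-alt k in inj₁ (x , y , p , q , e))

-- Every root is positive or negative

nonpos-is-neg : ∀ x → x ≤ 0ℤ → Σ ℕ λ a → x ≡ - (+ a)
nonpos-is-neg (+ zero)  _ = 0 , refl
nonpos-is-neg -[1+ n ]  _ = suc n , refl
nonpos-is-neg (+ suc n) (ℤ.+≤+ ())

-- A decision procedure, so that in `rank2` the finitely many coefficients of each finite type are
-- checked by evaluation.
images-nonneg? : ∀ a b m → Dec (∀ {k} → k ℕ.< m →
  0ℤ ≤ Dihedral.imageᵢ a b (Dihedral.quad a b (alternating false k)) × 0ℤ ≤ Dihedral.imageⱼ a b (Dihedral.quad a b (alternating false k)))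
images-nonneg? a b m = ℕP.allUpTo? (λ k → (0ℤ ℤP.≤? _) ×-dec (0ℤ ℤP.≤? _)) m

module Roots {N : ℕ} (A : Matrix N) (cartan : IsCartan A) where
  open Signs A cartan public
  open IsCartan cartan

  rank2 : ∀ i j (i≢j : i ≢ j) d → Nonneg i j i≢j d ⊎ Shortᵈ i j i≢j d
  rank2 i j i≢j d with nonpos-is-neg (A i j) (offdiag i j i≢j) | nonpos-is-neg (A j i) (offdiag j i (λ e → i≢j (sym e)))
  ... | a , p | b , q = cases a b p q d
    where
    fin : ∀ a b m {_ : True (images-nonneg? (+ a) (+ b) (suc m))} → A i j ≡ - (+ a) → A j i ≡ - (+ b) →
          Dihedral.quad (+ a) (+ b) (alternating false (suc m)) ≡ Dihedral.quad (+ a) (+ b) (alternating true (suc m)) →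
          ∀ d → Nonneg i j i≢j d ⊎ Shortᵈ i j i≢j d
    fin a b m {t} p q braid = finite i j i≢j (+ a) (+ b) p q m braid (toWitness t)
    inf : ∀ a b → 4 ℕ.≤ a ℕ.* b → A i j ≡ - (+ a) → A j i ≡ - (+ b) → ∀ d → Nonneg i j i≢j d ⊎ Shortᵈ i j i≢j d
    inf a b l p q = infinite i j i≢j (+ a) (+ b) p q (ℤ.+≤+ ℕ.z≤n) (ℤ.+≤+ ℕ.z≤n) (subst (+ 4 ≤_) (ℤP.pos-* a b) (ℤ.+≤+ l))
    nope : ∀ {b} {R : Set} → A i j ≡ 0ℤ → A j i ≡ - (+ suc b) → R
    nope p q with trans (sym (zeroSym i j p)) q
    ... | ()
    -- The products ab = 0, 1, 2, 3 belong to the orders 2, 3, 4, 6, and the third argument of `fin`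
    -- is the order minus one. All other pairs have ab ≥ 4.
    cases : ∀ a b → A i j ≡ - (+ a) → A j i ≡ - (+ b) → ∀ d → Nonneg i j i≢j d ⊎ Shortᵈ i j i≢j d
    cases 0 0 p q = fin 0 0 1 p q refl
    cases 0 (suc b) p q = nope p q
    cases (suc a) 0 p q with trans (sym (zeroSym j i q)) p
    ... | ()
    cases 1 1 p q = fin 1 1 2 p q refl
    cases 1 2 p q = fin 1 2 3 p q refl
    cases 1 3 p q = fin 1 3 5 p q refl
    cases 1 (suc (suc (suc (suc b)))) p q = inf 1 (4 ℕ.+ b) (ℕ.s≤s (ℕ.s≤s (ℕ.s≤s (ℕ.s≤s ℕ.z≤n)))) p q
    cases 2 1 p q = fin 2 1 3 p q refl
    cases 3 1 p q = fin 3 1 5 p q refl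
    cases (suc (suc (suc (suc a)))) (suc b) p q = inf (4 ℕ.+ a) (suc b) (ℕP.*-mono-≤ {4} {4 ℕ.+ a} {1} {suc b} (ℕP.m≤m+n 4 a) (ℕ.s≤s ℕ.z≤n)) p q
    cases (suc (suc a)) (suc (suc b)) p q = inf (2 ℕ.+ a) (2 ℕ.+ b) (ℕP.*-mono-≤ {2} {2 ℕ.+ a} {2} {2 ℕ.+ b} (ℕP.m≤m+n 2 a) (ℕP.m≤m+n 2 b)) p q

  -- Deodhar's argument: split w = v u with u in the dihedral subgroup ⟨sᵢ , sⱼ⟩ and v as short as possible.
  module _ (n : ℕ) (ih : ∀ v i → length v ℕ.≤ n → Pos (root v i) ⊎ Short v i) (w : List (Fin N)) (l : length w ℕ.≤ suc n)
           (i j : Fin N) (i≢j : i ≢ j) where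

    -- The dihedral factor `c ∷ d` is nonempty, so `v` is strictly shorter than `w` and `ih` applies
    -- to it. The number `k` bounds how often `v` can still get shorter.
    split-off : ∀ k v d → length v ℕ.≤ k → length v ℕ.+ suc (length d) ℕ.≤ length w → ∀ c →
                (∀ x → act w x ≈ act v (actᵈ i j i≢j (c ∷ d) x)) → Pos (root w i) ⊎ Short w i
    split-off k v d lk lw c e with ih v i (v-short lw) | ih v j (v-short lw)
      where
      v-short : length v ℕ.+ suc (length d) ℕ.≤ length w → length v ℕ.≤ n
      v-short lw = ℕP.≤-pred (ℕP.≤-trans (ℕP.≤-trans (subst (suc (length v) ℕ.≤_) (sym (ℕP.+-suc (length v) (length d)))
          (ℕ.s≤s (ℕP.m≤m+n (length v) (length d)))) lw) l)
    ... | inj₁ p | inj₁ q with rank2 i j i≢j (c ∷ d)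
    ...   | inj₁ (x , y , px , py , f) = inj₁ (Pos-≈ (≈-sym (≈-trans (e (simple i)) (≈-trans (act-cong v f)
              (≈-trans (act-⊞ v (x ⊡ simple i) (y ⊡ simple j))
                 (ptwise λ z → cong₂ _+_ (at (act-⊡ v x (simple i)) z) (at (act-⊡ v y (simple j)) z))))))
              (λ z → +-nonneg (*-nonneg px (p z)) (*-nonneg py (q z))))
    ...   | inj₂ (d′ , ld , f) = inj₂ (v ++ map (letter i j i≢j) d′ ,
              ℕP.<-≤-trans (subst (ℕ._< length v ℕ.+ suc (length d)) (sym
                  (trans (ListP.length-++ v) (cong (length v ℕ.+_) (ListP.length-map (letter i j i≢j) d′))))
                (ℕP.+-monoʳ-< (length v) ld)) lw ,
              λ x → ≈-trans (≈-reflexive (act-++ v (map (letter i j i≢j) d′) x)) (≈-trans (act-cong v (f x)) (≈-sym (e (s i x)))))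
    split-off zero [] d lk lw c e | inj₂ (v′ , () , f) | _
    split-off zero [] d lk lw c e | inj₁ _ | inj₂ (v′ , () , f)
    -- Since v sᵢ is shorter than v, rewrite v u as (v sᵢ)(sᵢ u): the dihedral factor gains one
    -- letter and the total length does not grow.
    split-off (suc k) v d lk lw c e | inj₂ (v′ , lv , f) | _ =
      split-off k v′ (c ∷ d) (ℕP.≤-pred (ℕP.≤-trans lv lk))
        (ℕP.≤-trans (subst (ℕ._≤ length v ℕ.+ suc (length d)) (sym (ℕP.+-suc (length v′) (suc (length d)))) (ℕP.+-monoˡ-≤ (suc (length d)) lv)) lw)
        true (λ x → ≈-trans (e x) (≈-sym (≈-trans (f (s i (actᵈ i j i≢j (c ∷ d) x))) (act-cong v (s-invol i (actᵈ i j i≢j (c ∷ d) x))))))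
    split-off (suc k) v d lk lw c e | inj₁ _ | inj₂ (v′ , lv , f) =
      split-off k v′ (c ∷ d) (ℕP.≤-pred (ℕP.≤-trans lv lk))
        (ℕP.≤-trans (subst (ℕ._≤ length v ℕ.+ suc (length d)) (sym (ℕP.+-suc (length v′) (suc (length d)))) (ℕP.+-monoˡ-≤ (suc (length d)) lv)) lw)
        false (λ x → ≈-trans (e x) (≈-sym (≈-trans (f (s j (actᵈ i j i≢j (c ∷ d) x))) (act-cong v (s-invol j (actᵈ i j i≢j (c ∷ d) x))))))

  simple-nonneg : ∀ {N} (i : Fin N) → Pos (simple i)
  simple-nonneg i z with i Fin.≟ z
  ... | yes _ = ℤ.+≤+ ℕ.z≤n
  ... | no _  = ℤ.+≤+ ℕ.z≤n

  -- The last letter j of w supplies the second generator. For j = i the word w sᵢ cancels;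
  -- otherwise Deodhar's splitting starts from the factor sⱼ.
  pos-or-short : ∀ n w i → length w ℕ.≤ n → Pos (root w i) ⊎ Short w i
  pos-or-short n w i l with List.initLast w
  ... | [] = inj₁ (simple-nonneg i)
  pos-or-short zero .(v ++ j ∷ []) i l | v List.∷ʳ′ j = ⊥-elim (ℕP.<⇒≱ (ℕP.≤-reflexive (sym (trans (ListP.length-++ v) (ℕP.+-comm (length v) 1))))
      (ℕP.≤-trans l ℕ.z≤n))
  pos-or-short (suc n) .(v ++ j ∷ []) i l | v List.∷ʳ′ j with i Fin.≟ j
  ... | yes refl = inj₂ (v , ℕP.≤-reflexive (sym (trans (ListP.length-++ v) (ℕP.+-comm (length v) 1))) ,
          λ x → ≈-sym (≈-trans (≈-reflexive (act-++ v (i ∷ []) (s i x))) (act-cong v (s-invol i x))))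
  ... | no i≢j = split-off n (λ v i l → pos-or-short n v i l) (v ++ j ∷ []) l i j i≢j (length v) v [] ℕP.≤-refl
          (ℕP.≤-reflexive (sym (ListP.length-++ v))) false (λ x → ≈-reflexive (act-++ v (j ∷ []) x))

  root-s : ∀ w i → act w (s i (simple i)) ≈ ⊟ root w i
  root-s w i = ≈-trans (act-cong w (s-self i)) (act-⊟ w (simple i))

  -- If w sᵢ acts as a shorter word w′, then w αᵢ = - w′ αᵢ, and the sign is known for w′ by
  -- induction on the length.
  sign : ∀ w i → Pos (root w i) ⊎ Neg (root w i)
  sign w i = go (length w) w ℕP.≤-refl
    where
    go : ∀ n w → length w ℕ.≤ n → Pos (root w i) ⊎ Neg (root w i)
    go n w l with pos-or-short n w i l
    ... | inj₁ p = inj₁ p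
    go zero [] l | inj₂ (w′ , () , e)
    go (suc n) w l | inj₂ (w′ , lw , e) with go n w′ (ℕP.≤-pred (ℕP.≤-trans lw l))
    ... | inj₁ p = inj₂ (Neg-≈ (⊟-swap′ e) (Neg-⊟ p))
      where
      ⊟-swap′ : (∀ v → act w′ v ≈ act w (s i v)) → ⊟ root w′ i ≈ root w i
      ⊟-swap′ e = ≈-sym (⊟-swap (≈-trans (e (simple i)) (root-s w i)))
    ... | inj₂ p = inj₁ (Pos-≈ (≈-sym (⊟-swap (≈-trans (e (simple i)) (root-s w i)))) (Pos-⊟ p))

-- Rational functionals

ringℚ : ACR.AlmostCommutativeRing 0ℓ 0ℓ
ringℚ = ACR.fromCommutativeRing ℚP.+-*-commutativeRing (λ x → dec⇒maybe (0ℚ ℚP.≟ x))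

toℚᵘ-toℚ : ∀ a → ℚ.toℚᵘ (toℚ a) ℚᵘ.≃ ℚᵘ.mkℚᵘ a 0
toℚᵘ-toℚ a = ℚP.toℚᵘ-fromℚᵘ (ℚᵘ.mkℚᵘ a 0)

toℚ-+ : ∀ a b → toℚ (a + b) ≡ toℚ a +ℚ toℚ b
toℚ-+ a b = ℚP.toℚᵘ-injective (ℚᵘP.≃-trans (toℚᵘ-toℚ (a + b)) (ℚᵘP.≃-trans (ℚᵘ.*≡* (lem a b))
  (ℚᵘP.≃-sym (ℚᵘP.≃-trans (ℚP.toℚᵘ-homo-+ (toℚ a) (toℚ b)) (ℚᵘP.+-cong (toℚᵘ-toℚ a) (toℚᵘ-toℚ b))))))
  where
  lem : ∀ a b → (a + b) * 1ℤ ≡ (a * 1ℤ + b * 1ℤ) * 1ℤ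
  lem = ℤS.solve-∀

toℚ-* : ∀ a b → toℚ (a * b) ≡ toℚ a *ℚ toℚ b
toℚ-* a b = ℚP.toℚᵘ-injective (ℚᵘP.≃-trans (toℚᵘ-toℚ (a * b))
  (ℚᵘP.≃-sym (ℚᵘP.≃-trans (ℚP.toℚᵘ-homo-* (toℚ a) (toℚ b)) (ℚᵘP.*-cong (toℚᵘ-toℚ a) (toℚᵘ-toℚ b)))))

toℚ-injective : ∀ {a b} → toℚ a ≡ toℚ b → a ≡ b
toℚ-injective {a} {b} e with ℚᵘP.≃-trans (ℚᵘP.≃-sym (toℚᵘ-toℚ a)) (ℚᵘP.≃-trans (ℚP.toℚᵘ-cong e) (toℚᵘ-toℚ b))
... | ℚᵘ.*≡* h = trans (sym (ℤP.*-identityʳ a)) (trans h (ℤP.*-identityʳ b))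

toℚ-positive : ∀ {a} → 0ℤ < a → 0ℚ <ℚ toℚ a
toℚ-positive {+ suc a} _ = ℚP.positive⁻¹ (toℚ (+ suc a)) {{ℚP.normalize-pos (suc a) 1}}
toℚ-positive {+ zero} (ℤ.+<+ ())

toℚ-nonneg : ∀ {a} → 0ℤ ≤ a → 0ℚ ≤ℚ toℚ a
toℚ-nonneg {+ zero}  _ = ℚP.≤-refl
toℚ-nonneg {+ suc a} _ = ℚP.<⇒≤ (toℚ-positive {+ suc a} (ℤ.+<+ (ℕ.s≤s ℕ.z≤n)))

*ℚ-positive : ∀ {a b} → 0ℚ <ℚ a → 0ℚ <ℚ b → 0ℚ <ℚ a *ℚ b
*ℚ-positive {a} {b} p q = subst (_<ℚ a *ℚ b) (ℚP.*-zeroʳ a) (ℚP.*-monoʳ-<-pos a {{ℚ.positive p}} q)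

*ℚ-nonneg : ∀ {a b} → 0ℚ ≤ℚ a → 0ℚ ≤ℚ b → 0ℚ ≤ℚ a *ℚ b
*ℚ-nonneg {a} {b} p q = subst (_≤ℚ a *ℚ b) (ℚP.*-zeroʳ a) (ℚP.*-monoˡ-≤-nonNeg a {{ℚ.nonNegative p}} q)

*ℚ-zero : ∀ {a b} → a *ℚ b ≡ 0ℚ → a ≢ 0ℚ → b ≡ 0ℚ
*ℚ-zero {a} {b} e a≢0 = begin
  b                    ≡⟨ ℚP.*-identityˡ b ⟨
  1ℚ *ℚ b              ≡⟨ cong (_*ℚ b) (ℚP.*-inverseˡ a) ⟨
  ℚ.1/ a *ℚ a *ℚ b     ≡⟨ ℚP.*-assoc (ℚ.1/ a) a b ⟩
  ℚ.1/ a *ℚ (a *ℚ b)   ≡⟨ cong (ℚ.1/ a *ℚ_) e ⟩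
  ℚ.1/ a *ℚ 0ℚ         ≡⟨ ℚP.*-zeroʳ (ℚ.1/ a) ⟩
  0ℚ ∎
  where
  open ≡-Reasoning
  instance
    nz : ℚ.NonZero a
    nz = ℚ.≢-nonZero a≢0

toℚ-≢0 : ∀ {a} → a ≢ 0ℤ → toℚ a ≢ 0ℚ
toℚ-≢0 h e = h (toℚ-injective e)

positive-cancel : ∀ {a b} → 0ℚ <ℚ a → 0ℚ <ℚ a *ℚ b → 0ℚ <ℚ b
positive-cancel {a} {b} p q with ℚP.<-cmp 0ℚ b
... | tri< r _ _ = r
... | tri≈ _ refl _ = ⊥-elim (ℚP.<-irrefl (sym (ℚP.*-zeroʳ a)) q)
... | tri> _ _ r = ⊥-elim (ℚP.<-asym q (subst (a *ℚ b <ℚ_) (ℚP.*-zeroʳ a) (ℚP.*-monoʳ-<-pos a {{ℚ.positive p}} r)))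

sumℚ-cong : ∀ {N} {f g : Fin N → ℚ} → (∀ i → f i ≡ g i) → sumℚ f ≡ sumℚ g
sumℚ-cong {zero}  h = refl
sumℚ-cong {suc N} h = cong₂ _+ℚ_ (h Fin.zero) (sumℚ-cong (λ i → h (Fin.suc i)))

interchangeℚ : ∀ a b c d → (a +ℚ b) +ℚ (c +ℚ d) ≡ (a +ℚ c) +ℚ (b +ℚ d)
interchangeℚ = RS.solve-∀ ringℚ

sumℚ-+ : ∀ {N} (f g : Fin N → ℚ) → sumℚ (λ i → f i +ℚ g i) ≡ sumℚ f +ℚ sumℚ g
sumℚ-+ {zero}  f g = refl
sumℚ-+ {suc N} f g = trans (cong (f Fin.zero +ℚ g Fin.zero +ℚ_) (sumℚ-+ (λ i → f (Fin.suc i)) (λ i → g (Fin.suc i))))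
  (interchangeℚ (f Fin.zero) (g Fin.zero) (sumℚ (λ i → f (Fin.suc i))) (sumℚ (λ i → g (Fin.suc i))))

sumℚ-* : ∀ {N} c (f : Fin N → ℚ) → sumℚ (λ i → c *ℚ f i) ≡ c *ℚ sumℚ f
sumℚ-* {zero}  c f = sym (ℚP.*-zeroʳ c)
sumℚ-* {suc N} c f = trans (cong (c *ℚ f Fin.zero +ℚ_) (sumℚ-* c (λ i → f (Fin.suc i))))
  (sym (ℚP.*-distribˡ-+ c (f Fin.zero) (sumℚ (λ i → f (Fin.suc i)))))

sumℚ-zero : ∀ {N} {f : Fin N → ℚ} → (∀ i → f i ≡ 0ℚ) → sumℚ f ≡ 0ℚ
sumℚ-zero {zero}  h = refl
sumℚ-zero {suc N} h = cong₂ _+ℚ_ (h Fin.zero) (sumℚ-zero (λ i → h (Fin.suc i)))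

sumℚ-toℚ : ∀ {N} (f : Fin N → ℤ) → sumℚ (λ i → toℚ (f i)) ≡ toℚ (sumℤ f)
sumℚ-toℚ {zero}  f = refl
sumℚ-toℚ {suc N} f = trans (cong (toℚ (f Fin.zero) +ℚ_) (sumℚ-toℚ (λ i → f (Fin.suc i)))) (sym (toℚ-+ (f Fin.zero) (sumℤ (λ i → f (Fin.suc i)))))

pair-≈ : ∀ {N} (f : Fun N) {u v} → u ≈ v → pair f u ≡ pair f v
pair-≈ f e = sumℚ-cong (λ i → cong (λ x → f i *ℚ toℚ x) (at e i))

pair-⊞ : ∀ {N} (f : Fun N) u v → pair f (u ⊞ v) ≡ pair f u +ℚ pair f v
pair-⊞ f u v = trans (sumℚ-cong (λ i → trans (cong (f i *ℚ_) (toℚ-+ (u i) (v i))) (ℚP.*-distribˡ-+ (f i) (toℚ (u i)) (toℚ (v i)))))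
  (sumℚ-+ (λ i → f i *ℚ toℚ (u i)) (λ i → f i *ℚ toℚ (v i)))

pair-⊡ : ∀ {N} (f : Fun N) c v → pair f (c ⊡ v) ≡ toℚ c *ℚ pair f v
pair-⊡ f c v = trans (sumℚ-cong (λ i → trans (cong (f i *ℚ_) (toℚ-* c (v i))) (lem (f i) (toℚ c) (toℚ (v i)))))
  (sumℚ-* (toℚ c) (λ i → f i *ℚ toℚ (v i)))
  where
  lem : ∀ a b c → a *ℚ (b *ℚ c) ≡ b *ℚ (a *ℚ c)
  lem = RS.solve-∀ ringℚ

pair-⊟ : ∀ {N} (f : Fun N) v → pair f (⊟ v) ≡ -ℚ pair f v
pair-⊟ f v = trans (pair-≈ f (⊟-⊡ v)) (trans (pair-⊡ f -1ℤ v) (lem (pair f v)))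
  where
  lem : ∀ a → toℚ -1ℤ *ℚ a ≡ -ℚ a
  lem a = trans (sym (ℚP.neg-distribˡ-* 1ℚ a)) (cong -ℚ_ (ℚP.*-identityˡ a))

dotℤ : ∀ {N} → Vecℤ N → Vecℤ N → ℤ
dotℤ a v = sumℤ (λ i → v i * a i)

pair-dotℤ : ∀ {N} (a v : Vecℤ N) → pair (λ i → toℚ (a i)) v ≡ toℚ (dotℤ a v)
pair-dotℤ a v = trans (sumℚ-cong (λ i → trans (sym (toℚ-* (a i) (v i))) (cong toℚ (ℤP.*-comm (a i) (v i))))) (sumℚ-toℚ (λ i → v i * a i))

dotℤ-simple : ∀ {N} (i : Fin N) v → dotℤ (simple i) v ≡ v i
dotℤ-simple i v = sumℤ-simple v i

dotℤ-⊞ : ∀ {N} (a b v : Vecℤ N) → dotℤ (a ⊞ b) v ≡ dotℤ a v + dotℤ b v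
dotℤ-⊞ a b v = trans (sumℤ-cong (λ i → ℤP.*-distribˡ-+ (v i) (a i) (b i))) (sumℤ-+ (λ i → v i * a i) (λ i → v i * b i))

dotℤ-⊡ : ∀ {N} c (a v : Vecℤ N) → dotℤ (c ⊡ a) v ≡ c * dotℤ a v
dotℤ-⊡ c a v = trans (sumℤ-cong (λ i → lem (v i) c (a i))) (sumℤ-* c (λ i → v i * a i))
  where
  lem : ∀ a b c → a * (b * c) ≡ b * (a * c)
  lem = ℤS.solve-∀

sumℚ-nonneg : ∀ {N} {f : Fin N → ℚ} → (∀ i → 0ℚ ≤ℚ f i) → 0ℚ ≤ℚ sumℚ f
sumℚ-nonneg {zero}  h = ℚP.≤-refl
sumℚ-nonneg {suc N} h = ℚP.+-mono-≤ (h Fin.zero) (sumℚ-nonneg (λ i → h (Fin.suc i)))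

sumℚ-positive : ∀ {N} {f : Fin N → ℚ} → (∀ i → 0ℚ ≤ℚ f i) → ∀ i → 0ℚ <ℚ f i → 0ℚ <ℚ sumℚ f
sumℚ-positive {suc N} h Fin.zero    p = ℚP.+-mono-<-≤ p (sumℚ-nonneg (λ i → h (Fin.suc i)))
sumℚ-positive {suc N} h (Fin.suc i) p = ℚP.+-mono-≤-< (h Fin.zero) (sumℚ-positive (λ i → h (Fin.suc i)) i p)

nonneg≢0⇒positive : ∀ {a} → 0ℤ ≤ a → a ≢ 0ℤ → 0ℤ < a
nonneg≢0⇒positive p q = ℤP.≤∧≢⇒< p (λ e → q (sym e))

pair-InD : ∀ {N} {g : Fun N} {v} → InD g → Pos v → ∀ z → v z ≢ 0ℤ → 0ℚ <ℚ pair g v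
pair-InD {g = g} {v} d p z v≢0 = sumℚ-positive (λ i → *ℚ-nonneg (ℚP.<⇒≤ (d i)) (toℚ-nonneg (p i))) z
  (*ℚ-positive (d z) (toℚ-positive (nonneg≢0⇒positive (p z) v≢0)))

-- Planes

minor : ∀ {N} → Vecℤ N → Vecℤ N → Fin N → Fin N → ℤ
minor γ δ p q = γ p * δ q - γ q * δ p

-- Linear independence, recorded by a nonvanishing 2 × 2 minor. It is decidable, and the two indices
-- serve as pivots for Cramer's rule.
record NonPar {N} (γ δ : Vecℤ N) : Set where
  constructor nonpar
  field
    p q     : Fin N
    minor≢0 : minor γ δ p q ≢ 0ℤ

-- δ lies in the plane spanned by γ and ε.
record InPlane {N} (δ γ ε : Vecℤ N) : Set where
  constructor inPlane
  field meets : ContainsMeet δ γ ε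
open InPlane public

nonPar? : ∀ {N} (γ δ : Vecℤ N) → Dec (NonPar γ δ)
nonPar? γ δ with FinP.any? (λ p → FinP.any? (λ q → ¬? (minor γ δ p q ℤP.≟ 0ℤ)))
... | yes (p , q , m) = yes (nonpar p q m)
... | no ¬m = no λ where (nonpar p q m) → ¬m (p , q , m)

minor-zero : ∀ {N} {γ δ : Vecℤ N} → ¬ NonPar γ δ → ∀ p q → minor γ δ p q ≡ 0ℤ
minor-zero {γ = γ} {δ} h p q with minor γ δ p q ℤP.≟ 0ℤ
... | yes e = e
... | no ¬e = ⊥-elim (h (nonpar p q ¬e))

parallel : ∀ {N} {γ δ : Vecℤ N} → ¬ NonPar γ δ → ∀ p q → γ p * δ q ≡ γ q * δ p
parallel {γ = γ} {δ} h p q = ℤP.i-j≡0⇒i≡j (γ p * δ q) (γ q * δ p) (minor-zero {γ = γ} {δ} h p q)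

no-zero-divisor : ∀ {a b} → a * b ≡ 0ℤ → a ≢ 0ℤ → b ≡ 0ℤ
no-zero-divisor {a} {b} e a≢0 = [ (λ a≡0 → ⊥-elim (a≢0 a≡0)) , (λ b≡0 → b≡0) ]′ (ℤP.i*j≡0⇒i≡0∨j≡0 a {b} e)

nonPar-sym : ∀ {N} {γ δ : Vecℤ N} → NonPar γ δ → NonPar δ γ
nonPar-sym {γ = γ} {δ} (nonpar p q m) = nonpar q p λ e → m (trans (lem (γ p) (γ q) (δ p) (δ q)) e)
  where
  lem : ∀ a b c d → a * d - b * c ≡ d * a - c * b
  lem = ℤS.solve-∀

nonPar-≈ : ∀ {N} {γ γ′ δ δ′ : Vecℤ N} → γ ≈ γ′ → δ ≈ δ′ → NonPar γ δ → NonPar γ′ δ′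
nonPar-≈ e f (nonpar p q m) = nonpar p q λ h → m (trans (cong₂ _-_ (cong₂ _*_ (at e p) (at f q)) (cong₂ _*_ (at e q) (at f p))) h)

positive-minor : ∀ {N} {γ δ : Vecℤ N} → NonPar γ δ → Σ (Fin N) λ p → Σ (Fin N) λ q → 0ℤ < minor γ δ p q
positive-minor {γ = γ} {δ} (nonpar p q m) with ℤP.<-cmp 0ℤ (minor γ δ p q)
... | tri< l _ _ = p , q , l
... | tri≈ _ e _ = ⊥-elim (m (sym e))
... | tri> _ _ l = q , p , subst (0ℤ <_) (lem (γ p) (γ q) (δ p) (δ q)) (ℤP.neg-mono-< l)
  where
  lem : ∀ a b c d → - (a * d - b * c) ≡ b * c - a * d
  lem = ℤS.solve-∀

>⇒≢0 : ∀ {a} → 0ℤ < a → a ≢ 0ℤ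
>⇒≢0 l e = ℤP.<-irrefl (sym e) l

-- A linear relation with denominators cleared. As D is positive, the sign of V tells on which side
-- of γ the vector δ lies, relative to ε.
record Comb {N} (δ γ ε : Vecℤ N) : Set where
  constructor comb
  field
    {D U V} : ℤ
    0<D     : 0ℤ < D
    rel     : ∀ z → D * δ z ≡ U * γ z + V * ε z

module _ {N} {δ γ ε : Vecℤ N} (c : Comb δ γ ε) where
  open Comb c

  comb-pair : ∀ f → toℚ D *ℚ pair f δ ≡ toℚ U *ℚ pair f γ +ℚ toℚ V *ℚ pair f ε
  comb-pair f = trans (sym (pair-⊡ f D δ)) (trans (pair-≈ f {D ⊡ δ} {U ⊡ γ ⊞ V ⊡ ε} (ptwise rel))
    (trans (pair-⊞ f (U ⊡ γ) (V ⊡ ε)) (cong₂ _+ℚ_ (pair-⊡ f U γ) (pair-⊡ f V ε))))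

  comb-minor : ∀ p q → D * minor γ δ p q ≡ V * minor γ ε p q
  comb-minor p q = trans (lem₁ D (γ p) (γ q) (δ p) (δ q))
    (trans (cong₂ (λ x y → γ p * x - γ q * y) (rel q) (rel p)) (lem₂ U V (γ p) (γ q) (ε p) (ε q)))
    where
    lem₁ : ∀ D a b c d → D * (a * d - b * c) ≡ a * (D * d) - b * (D * c)
    lem₁ = ℤS.solve-∀
    lem₂ : ∀ U V a b c d → a * (U * b + V * d) - b * (U * a + V * c) ≡ V * (a * d - b * c)
    lem₂ = ℤS.solve-∀

  comb-V≢0 : NonPar γ δ → V ≢ 0ℤ
  comb-V≢0 (nonpar p q m) v = m (no-zero-divisor (trans (comb-minor p q) (cong (_* minor γ ε p q) v)) (>⇒≢0 0<D))

  comb-meet : InPlane δ γ ε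
  comb-meet = inPlane λ f a b → *ℚ-zero {toℚ D} (trans (comb-pair f) (trans (cong₂ (λ x y → toℚ U *ℚ x +ℚ toℚ V *ℚ y) a b) (lem (toℚ U) (toℚ V))))
      (toℚ-≢0 (>⇒≢0 0<D))
    where
    lem : ∀ u v → u *ℚ 0ℚ +ℚ v *ℚ 0ℚ ≡ 0ℚ
    lem = RS.solve-∀ ringℚ

  comb-exchange : V ≢ 0ℤ → ∀ f → pair f γ ≡ 0ℚ → pair f δ ≡ 0ℚ → pair f ε ≡ 0ℚ
  comb-exchange v f a b = *ℚ-zero {toℚ V} (trans (lem (toℚ U) (toℚ V *ℚ pair f ε)) (trans (cong (λ x → toℚ U *ℚ x +ℚ toℚ V *ℚ pair f ε) (sym a))
    (trans (sym (comb-pair f)) (trans (cong (toℚ D *ℚ_) b) (ℚP.*-zeroʳ (toℚ D)))))) (toℚ-≢0 v)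
    where
    lem : ∀ u x → x ≡ u *ℚ 0ℚ +ℚ x
    lem = RS.solve-∀ ringℚ

-- Cramer's rule, applied to the functional v ↦ det (γ , ε , v) on the coordinates p , q , z.
meet-comb : ∀ {N} {δ γ ε : Vecℤ N} → NonPar γ ε → InPlane δ γ ε → Comb δ γ ε
meet-comb {N} {δ} {γ} {ε} np (inPlane meet) with positive-minor np
... | p , q , 0<M = comb {U = minor δ ε p q} {V = minor γ δ p q} 0<M λ z →
    ℤP.i-j≡0⇒i≡j (minor γ ε p q * δ z) (minor δ ε p q * γ z + minor γ δ p q * ε z)
        (trans (sym (det-dot z δ)) (toℚ-injective (trans (sym (pair-dotℤ (det z) δ))
      (meet (λ i → toℚ (det z i)) (kills z γ (lemγ (γ p) (γ q) (ε p) (ε q) (γ z) (ε z))) (kills z ε (lemε (γ p) (γ q) (ε p) (ε q) (γ z) (ε z)))))))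
  where
  det : Fin N → Vecℤ N
  det z = minor γ ε p q ⊡ simple z ⊞ (γ q * ε z - γ z * ε q) ⊡ simple p ⊞ (γ z * ε p - γ p * ε z) ⊡ simple q
  term : ∀ c i v → dotℤ (c ⊡ simple i) v ≡ c * v i
  term c i v = trans (dotℤ-⊡ c (simple i) v) (cong (c *_) (dotℤ-simple i v))
  value : Fin N → Vecℤ N → ℤ
  value z v = minor γ ε p q * v z - (minor v ε p q * γ z + minor γ v p q * ε z)
  det-dot : ∀ z v → dotℤ (det z) v ≡ value z v
  det-dot z v = trans (dotℤ-⊞ (minor γ ε p q ⊡ simple z ⊞ (γ q * ε z - γ z * ε q) ⊡ simple p) ((γ z * ε p - γ p * ε z) ⊡ simple q) v)
    (trans (cong₂ _+_ (trans (dotℤ-⊞ (minor γ ε p q ⊡ simple z) ((γ q * ε z - γ z * ε q) ⊡ simple p) v)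
        (cong₂ _+_ (term (minor γ ε p q) z v) (term (γ q * ε z - γ z * ε q) p v))) (term (γ z * ε p - γ p * ε z) q v))
      (lem (γ p) (γ q) (ε p) (ε q) (γ z) (ε z) (v p) (v q) (minor γ ε p q * v z)))
    where
    lem : ∀ gp gq ep eq gz ez vp vq x → x + (gq * ez - gz * eq) * vp + (gz * ep - gp * ez) * vq
          ≡ x - ((vp * eq - vq * ep) * gz + (gp * vq - gq * vp) * ez)
    lem = ℤS.solve-∀
  kills : ∀ z v → value z v ≡ 0ℤ → pair (λ i → toℚ (det z i)) v ≡ 0ℚ
  kills z v e = trans (pair-dotℤ (det z) v) (cong toℚ (trans (det-dot z v) e))
  lemγ : ∀ gp gq ep eq gz ez → (gp * eq - gq * ep) * gz - ((gp * eq - gq * ep) * gz + (gp * gq - gq * gp) * ez) ≡ 0ℤ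
  lemγ = ℤS.solve-∀
  lemε : ∀ gp gq ep eq gz ez → (gp * eq - gq * ep) * ez - ((ep * eq - eq * ep) * gz + (gp * eq - gq * ep) * ez) ≡ 0ℤ
  lemε = ℤS.solve-∀

meet? : ∀ {N} (δ γ ε : Vecℤ N) → NonPar γ ε → Dec (InPlane δ γ ε)
meet? δ γ ε np with positive-minor np
... | p , q , 0<M with FinP.all? (λ z → minor γ ε p q * δ z ℤP.≟ minor δ ε p q * γ z + minor γ δ p q * ε z)
...   | yes h = yes (comb-meet (comb {U = minor δ ε p q} {V = minor γ δ p q} 0<M h))
...   | no ¬h = no λ meet → ¬h (cramer meet)
  where
  cramer : InPlane δ γ ε → ∀ z → minor γ ε p q * δ z ≡ minor δ ε p q * γ z + minor γ δ p q * ε z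
  cramer meet z = ℤP.*-cancelˡ-≡ D (minor γ ε p q * δ z) (minor δ ε p q * γ z + minor γ δ p q * ε z) {{ℤ.≢-nonZero (>⇒≢0 0<D)}}
    (trans (lem₁ D (minor γ ε p q) (δ z)) (trans (cong (minor γ ε p q *_) (rel z))
      (trans (lem₂ (minor γ ε p q) U V (γ z) (ε z)) (trans (cong₂ (λ x y → x * γ z + y * ε z) Ueq Veq)
          (lem₃ D (minor δ ε p q) (minor γ δ p q) (γ z) (ε z))))))
    where
    open Comb (meet-comb np meet)
    lem₁ : ∀ a b c → a * (b * c) ≡ b * (a * c)
    lem₁ = ℤS.solve-∀
    lem₂ : ∀ m u v g e → m * (u * g + v * e) ≡ (u * m) * g + (v * m) * e
    lem₂ = ℤS.solve-∀
    lem₃ : ∀ d a b g e → (d * a) * g + (d * b) * e ≡ d * (a * g + b * e)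
    lem₃ = ℤS.solve-∀
    Veq : V * minor γ ε p q ≡ D * minor γ δ p q
    Veq = sym (comb-minor (comb {U = U} {V} 0<D rel) p q)
    Ueq : U * minor γ ε p q ≡ D * minor δ ε p q
    Ueq = sym (trans (lem₄ D (δ p) (δ q) (ε p) (ε q)) (trans (cong₂ (λ x y → x * ε q - y * ε p) (rel p) (rel q)) (lem₅ U V (γ p) (γ q) (ε p) (ε q))))
      where
      lem₄ : ∀ D a b c d → D * (a * d - b * c) ≡ (D * a) * d - (D * b) * c
      lem₄ = ℤS.solve-∀
      lem₅ : ∀ U V a b c d → (U * a + V * c) * d - (U * b + V * d) * c ≡ U * (a * d - b * c)
      lem₅ = ℤS.solve-∀

meet-swap : ∀ {N} {δ γ ε : Vecℤ N} → InPlane δ γ ε → InPlane δ ε γ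
meet-swap m = inPlane λ f a b → meets m f b a

parallel-sameHyp : ∀ {N} {γ δ : Vecℤ N} → ¬ NonPar γ δ → ∀ z → γ z ≢ 0ℤ → ∀ f → pair f γ ≡ 0ℚ → pair f δ ≡ 0ℚ
parallel-sameHyp {γ = γ} {δ} h z γz f e = *ℚ-zero (trans (sym (pair-⊡ f (γ z) δ))
  (trans (pair-≈ f {γ z ⊡ δ} {δ z ⊡ γ} (ptwise λ p → trans (parallel {γ = γ} {δ} h z p) (ℤP.*-comm (γ p) (δ z))))
    (trans (pair-⊡ f (δ z) γ) (trans (cong (toℚ (δ z) *ℚ_) e) (ℚP.*-zeroʳ (toℚ (δ z))))))) (toℚ-≢0 γz)

-- The functional v ↦ `minor γ v p q` vanishes at γ by antisymmetry and is positive at δ when p and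
-- q are ordered suitably.
nonPar-functional : ∀ {N} {γ δ : Vecℤ N} → NonPar γ δ → Σ (Fun N) λ f → pair f γ ≡ 0ℚ × 0ℚ <ℚ pair f δ
nonPar-functional {N} {γ} {δ} np with positive-minor np
... | p , q , 0<M = (λ i → toℚ (a i)) , trans (value γ) (cong toℚ (lem (γ p) (γ q))) , subst (0ℚ <ℚ_) (sym (value δ)) (toℚ-positive 0<M)
  where
  a : Vecℤ N
  a = γ p ⊡ simple q ⊞ (- γ q) ⊡ simple p
  lem : ∀ x y → x * y - y * x ≡ 0ℤ
  lem = ℤS.solve-∀
  lem′ : ∀ x y u v → x * v + (- y) * u ≡ x * v - y * u
  lem′ = ℤS.solve-∀
  value : ∀ v → pair (λ i → toℚ (a i)) v ≡ toℚ (minor γ v p q)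
  value v = trans (pair-dotℤ a v) (cong toℚ (trans (dotℤ-⊞ (γ p ⊡ simple q) ((- γ q) ⊡ simple p) v)
    (trans (cong₂ _+_ (trans (dotℤ-⊡ (γ p) (simple q) v) (cong (γ p *_) (dotℤ-simple q v)))
        (trans (dotℤ-⊡ (- γ q) (simple p) v) (cong ((- γ q) *_) (dotℤ-simple p v))))
      (lem′ (γ p) (γ q) (v p) (v q)))))

nonPar-¬sameHyp : ∀ {N} {γ δ : Vecℤ N} → NonPar γ δ → ¬ SameHyp γ δ
nonPar-¬sameHyp {γ = γ} {δ} np h = separates (nonPar-functional np)
  where
  separates : (Σ (Fun _) λ f → pair f γ ≡ 0ℚ × 0ℚ <ℚ pair f δ) → ⊥
  separates (f , a , b) = ℚP.<⇒≢ b (sym (proj₁ (h f) a))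

same-fracture : ∀ {N} {η β δ : Vecℤ N} → NonPar η β → NonPar η δ → InPlane δ η β → SameFracture η β δ
same-fracture {η = η} {β} {δ} np np′ m f a = (λ b → meets m f a b) , λ d → comb-exchange c (comb-V≢0 c np′) f a d
  where
  c : Comb δ η β
  c = meet-comb np m

-- Inversions

any-split? : ∀ {A : Set} (P : List A → A → Set) → (∀ p k → Dec (P p k)) → ∀ w →
             Dec (Σ (List A) λ p → Σ A λ k → Σ (List A) λ r → w ≡ p ++ k ∷ r × P p k)
any-split? P P? [] = no λ where
  ([] , k , r , () , _)
  (_ ∷ _ , k , r , () , _)
any-split? P P? (k ∷ w) with P? [] k | any-split? (λ p → P (k ∷ p)) (λ p → P? (k ∷ p)) w
... | yes x | _ = yes ([] , k , w , refl , x)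
... | no _  | yes (p , k′ , r , e , x) = yes (k ∷ p , k′ , r , cong (k ∷_) e , x)
... | no ¬x | no ¬y = no λ where
  ([] , _ , _ , refl , x) → ¬x x
  (_ ∷ p , k′ , r , refl , x) → ¬y (p , k′ , r , refl , x)

Pos? : ∀ {N} (v : Vecℤ N) → Dec (Pos v)
Pos? v = FinP.all? λ z → 0ℤ ℤP.≤? v z

Neg? : ∀ {N} (v : Vecℤ N) → Dec (Neg v)
Neg? v = FinP.all? λ z → v z ℤP.≤? 0ℤ

⊞-cong : ∀ {N} {u u′ v v′ : Vecℤ N} → u ≈ u′ → v ≈ v′ → u ⊞ v ≈ u′ ⊞ v′
⊞-cong e f = ptwise λ z → cong₂ _+_ (at e z) (at f z)

shift-cong : ∀ {N} (δ : Vecℤ N) c {u v} → u ≈ v → δ ⊞ c ⊡ u ≈ δ ⊞ c ⊡ v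
shift-cong δ c e = ptwise λ z → cong (λ x → δ z + c * x) (at e z)

module Inversions {N : ℕ} (A : Matrix N) (cartan : IsCartan A) where
  open Roots A cartan public
  open IsCartan cartan

  Root : Vecℤ N → Set
  Root γ = Σ (List (Fin N)) λ w → Σ (Fin N) λ i → root w i ≈ γ

  reach-word : ∀ {ℓ β} → Reach A ℓ β → Σ (List (Fin N)) λ w → Σ (Fin N) λ i → length w ≡ ℓ × root w i ≡ β
  reach-word (base y) = [] , y , refl , refl
  reach-word (step k r) with reach-word r
  ... | w , i , l , e = k ∷ w , i , cong suc l , cong (s k) e

  word-reach : ∀ w i → Reach A (length w) (root w i)
  word-reach []      i = base i
  word-reach (k ∷ w) i = step k (word-reach w i)

  rootAt-word : ∀ {ℓ γ} → RootAt A ℓ γ → Σ (List (Fin N)) λ w → Σ (Fin N) λ i → length w ≡ ℓ × root w i ≈ γ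
  rootAt-word (β , r , e) with reach-word r
  ... | w , i , l , f = w , i , l , ≈-trans (≈-reflexive f) (ptwise e)

  isRoot⇒ : ∀ {γ} → IsRoot A γ → Root γ
  isRoot⇒ (ℓ , r) with rootAt-word r
  ... | w , i , _ , e = w , i , e

  ⇒isRoot : ∀ {γ} → Root γ → IsRoot A γ
  ⇒isRoot (w , i , e) = length w , root w i , word-reach w i , at e

  root-≈ : ∀ {γ δ} → γ ≈ δ → Root γ → Root δ
  root-≈ f (w , i , e) = w , i , ≈-trans e f

  root-sᵣ : ∀ k {γ} → Root γ → Root (s k γ)
  root-sᵣ k (w , i , e) = k ∷ w , i , s-cong k e

  root-neg : ∀ {γ} → Root γ → Root (⊟ γ)
  root-neg (w , i , e) = w ++ i ∷ [] , i , ≈-trans (≈-reflexive (act-++ w (i ∷ []) (simple i))) (≈-trans (root-s w i) (⊟-cong e))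

  root-sign : ∀ {γ} → Root γ → Pos γ ⊎ Neg γ
  root-sign (w , i , e) = [ (λ p → inj₁ (Pos-≈ e p)) , (λ p → inj₂ (Neg-≈ e p)) ]′ (sign w i)

  act-zero : ∀ w {v} → (∀ z → v z ≡ 0ℤ) → ∀ z → act w v z ≡ 0ℤ
  act-zero w {v} h z = trans (at (act-cong w {v} {0ℤ ⊡ v} (ptwise h)) z) (at (act-⊡ w 0ℤ v) z)

  root-nonzero : ∀ {γ} → Root γ → Σ (Fin N) λ z → γ z ≢ 0ℤ
  root-nonzero {γ} (w , i , e) with FinP.any? (λ z → ¬? (γ z ℤP.≟ 0ℤ))
  ... | yes h = h
  ... | no ¬h = ⊥-elim (contra (trans (sym (simple-self i)) (trans (sym (at (act-reverseˡ w (simple i)) i))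
                  (act-zero (reverse w) (λ z → trans (at e z) (all-zero z)) i))))
    where
    contra : ¬ (1ℤ ≡ 0ℤ)
    contra ()
    all-zero : ∀ z → γ z ≡ 0ℤ
    all-zero z with γ z ℤP.≟ 0ℤ
    ... | yes p = p
    ... | no ¬p = ⊥-elim (¬h (z , ¬p))

  -- Only the k-th coordinate changes, so γ is a multiple of the k-th simple root, and roots are primitive vectors.
  only-simple : ∀ k {γ} → Root γ → Pos γ → Neg (s k γ) → γ ≈ simple k
  only-simple k {γ} (w , i , e) p n = ptwise λ z → trans (at multiple z) (trans (cong (_* simple k z) γk≡1) (ℤP.*-identityˡ (simple k z)))
    where
    multiple : γ ≈ γ k ⊡ simple k
    multiple = ptwise λ z → by-cases z (k Fin.≟ z)
      where
      by-cases : ∀ z → Dec (k ≡ z) → γ z ≡ γ k * simple k z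
      by-cases z (yes refl) = sym (trans (cong (γ k *_) (simple-self k)) (ℤP.*-identityʳ (γ k)))
      by-cases z (no k≢z)   = trans (ℤP.≤-antisym (subst (_≤ 0ℤ) (s-off k≢z γ) (n z)) (p z))
          (sym (trans (cong (γ k *_) (simple-other k≢z)) (ℤP.*-zeroʳ (γ k))))
    -- Applying the inverse of w to γ = γ_k α_k gives αᵢ = γ_k w⁻¹α_k; the i-th coordinate exhibits
    -- γ_k as a divisor of 1.
    unit : γ k * act (reverse w) (simple k) i ≡ 1ℤ
    unit = trans (sym (trans (at (act-cong (reverse w) (≈-trans e multiple)) i) (at (act-⊡ (reverse w) (γ k) (simple k)) i)))
                 (trans (at (act-reverseˡ w (simple i)) i) (simple-self i))
    nonneg-unit : ∀ {a b} → 0ℤ ≤ a → a * b ≡ 1ℤ → a ≡ 1ℤ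
    nonneg-unit {+ a} {b} _ e = cong +_ (ℕP.m*n≡1⇒m≡1 a ℤ.∣ b ∣ (trans (sym (ℤP.abs-* (+ a) b)) (cong ℤ.∣_∣ e)))
    γk≡1 : γ k ≡ 1ℤ
    γk≡1 = nonneg-unit (p k) unit

  -- The conjugate w sᵢ w⁻¹, that is, the reflection in `root w i`.
  t : List (Fin N) → Fin N → Vecℤ N → Vecℤ N
  t []      i v = s i v
  t (k ∷ w) i v = s k (t w i (s k v))

  -- The coroot functional of `root w i`, namely v ↦ (αᵢ , w⁻¹v).
  μ : List (Fin N) → Fin N → Vecℤ N → ℤ
  μ []      i v = form A i v
  μ (k ∷ w) i v = μ w i (s k v)

  t-cong : ∀ w i {u v} → u ≈ v → t w i u ≈ t w i v
  t-cong []      i e = s-cong i e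
  t-cong (k ∷ w) i e = s-cong k (t-cong w i (s-cong k e))

  t-root : ∀ w i {δ} → Root δ → Root (t w i δ)
  t-root []      i r = root-sᵣ i r
  t-root (k ∷ w) i r = root-sᵣ k (t-root w i (root-sᵣ k r))

  t-formula : ∀ w i v → t w i v ≈ v ⊞ (- μ w i v) ⊡ root w i
  t-formula []      i v = s-expand i v
  t-formula (k ∷ w) i v = ≈-trans (s-cong k (t-formula w i (s k v)))
    (≈-trans (s-⊞ k (s k v) ((- μ w i (s k v)) ⊡ root w i)) (⊞-cong (s-invol k v) (s-⊡ k (- μ w i (s k v)) (root w i))))

  μ-cong : ∀ w i {u v} → u ≈ v → μ w i u ≡ μ w i v
  μ-cong []      i e = form-cong A i e
  μ-cong (k ∷ w) i e = μ-cong w i (s-cong k e)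

  μ-⊞ : ∀ w i u v → μ w i (u ⊞ v) ≡ μ w i u + μ w i v
  μ-⊞ []      i u v = form-⊞ A i u v
  μ-⊞ (k ∷ w) i u v = trans (μ-cong w i (s-⊞ k u v)) (μ-⊞ w i (s k u) (s k v))

  μ-⊡ : ∀ w i c v → μ w i (c ⊡ v) ≡ c * μ w i v
  μ-⊡ []      i c v = form-⊡ A i c v
  μ-⊡ (k ∷ w) i c v = trans (μ-cong w i (s-⊡ k c v)) (μ-⊡ w i c (s k v))

  μ-self : ∀ w i → μ w i (root w i) ≡ + 2
  μ-self []      i = trans (form-simple A i i) (diag i)
  μ-self (k ∷ w) i = trans (μ-cong w i (s-invol k (root w i))) (μ-self w i)

  -- Let the letters of w sᵢ w⁻¹ act on δ one at a time and look at the first change of sign. By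
  -- `only-simple` the vector at that moment is a simple root. A change before the middle makes δ a
  -- prefix root, a change at the middle makes δ the root of the mirror, and a change after the
  -- middle makes - t δ a prefix root.
  inversion : ∀ w i {δ} → Root δ → Pos δ → Neg (t w i δ) →
    δ ≈ root w i ⊎ Σ (List (Fin N)) λ p → Σ (Fin N) λ k → Σ (List (Fin N)) λ r → w ≡ p ++ k ∷ r × (root p k ≈ δ ⊎ root p k ≈ ⊟ t w i δ)
  inversion [] i r p n = inj₁ (only-simple i r p n)
  inversion (k ∷ w) i {δ} r p n with root-sign (root-sᵣ k r)
  ... | inj₂ n₁ = inj₂ ([] , k , w , refl , inj₁ (≈-sym (only-simple k r p n₁)))
  ... | inj₁ p₁ with root-sign (t-root w i (root-sᵣ k r))
  ...   | inj₁ p₂ = inj₂ ([] , k , w , refl , inj₂ (⊟-swap (≈-trans (s-cong k (only-simple k (t-root w i (root-sᵣ k r)) p₂ n)) (s-self k))))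
  ...   | inj₂ n₂ with inversion w i (root-sᵣ k r) p₁ n₂
  ...     | inj₁ e = inj₁ (≈-trans (≈-sym (s-invol k δ)) (s-cong k e))
  ...     | inj₂ (p′ , k′ , r′ , e , inj₁ f) = inj₂ (k ∷ p′ , k′ , r′ , cong (k ∷_) e , inj₁ (≈-trans (s-cong k f) (s-invol k δ)))
  ...     | inj₂ (p′ , k′ , r′ , e , inj₂ f) = inj₂ (k ∷ p′ , k′ , r′ , cong (k ∷_) e , inj₂ (≈-trans (s-cong k f) (act-⊟ (k ∷ []) (t w i (s k δ)))))

  -- The properties of a reflection that the argument about walls uses, without a word for γ. They
  -- pass from γ to -γ, so the positive one of the two can always be taken.
  record Mirror (γ : Vecℤ N) : Set where
    field
      coroot  : Vecℤ N → ℤ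
      c-cong  : ∀ {u v} → u ≈ v → coroot u ≡ coroot v
      c-⊞     : ∀ u v → coroot (u ⊞ v) ≡ coroot u + coroot v
      c-⊡     : ∀ c v → coroot (c ⊡ v) ≡ c * coroot v
      c-self  : coroot γ ≡ + 2
    refl′ : Vecℤ N → Vecℤ N
    refl′ v = v ⊞ (- coroot v) ⊡ γ
    field
      r-root  : ∀ {δ} → Root δ → Root (refl′ δ)

    c-refl′ : ∀ v → coroot (refl′ v) ≡ - coroot v
    c-refl′ v = trans (c-⊞ v ((- coroot v) ⊡ γ)) (trans (cong (_+_ (coroot v)) (trans (c-⊡ (- coroot v) γ) (cong ((- coroot v) *_) c-self)))
        (lem (coroot v)))
      where
      lem : ∀ a → a + (- a) * + 2 ≡ - a
      lem = ℤS.solve-∀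

  mirror : ∀ w i {γ} → root w i ≈ γ → Mirror γ
  mirror w i e = record
    { coroot = μ w i ; c-cong = μ-cong w i ; c-⊞ = μ-⊞ w i ; c-⊡ = μ-⊡ w i
    ; c-self = trans (μ-cong w i (≈-sym e)) (μ-self w i)
    ; r-root = λ {δ} r → root-≈ (≈-trans (t-formula w i δ) (shift-cong δ (- μ w i δ) e)) (t-root w i r) }

  mirror-neg : ∀ {γ} → Mirror γ → Mirror (⊟ γ)
  mirror-neg {γ} M = record
    { coroot = λ v → - coroot v ; c-cong = λ e → cong -_ (c-cong e)
    ; c-⊞ = λ u v → trans (cong -_ (c-⊞ u v)) (ℤP.neg-distrib-+ (coroot u) (coroot v))
    ; c-⊡ = λ c v → trans (cong -_ (c-⊡ c v)) (ℤP.neg-distribʳ-* c (coroot v))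
    ; c-self = trans (cong -_ (trans (c-cong (⊟-⊡ γ)) (trans (c-⊡ -1ℤ γ) (cong (-1ℤ *_) c-self)))) refl
    ; r-root = λ {δ} r → root-≈ (ptwise λ z → lem (δ z) (coroot δ) (γ z)) (r-root r) }
    where
    open Mirror M
    lem : ∀ d c g → d + (- c) * g ≡ d + (- (- c)) * (- g)
    lem = ℤS.solve-∀

-- Rank two subarrangements and fractures

nonPar-⊟ : ∀ {N} {γ δ : Vecℤ N} → NonPar γ δ → NonPar γ (⊟ δ)
nonPar-⊟ {γ = γ} {δ} (nonpar p q m) = nonpar p q λ e → m (trans (lem (γ p) (γ q) (δ p) (δ q)) (cong -_ e))
  where
  lem : ∀ a b c d → a * d - b * c ≡ - (a * (- d) - b * (- c))
  lem = ℤS.solve-∀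

nonPar-shift : ∀ {N} {γ δ : Vecℤ N} c → NonPar γ δ → NonPar γ (δ ⊞ c ⊡ γ)
nonPar-shift {γ = γ} {δ} c (nonpar p q m) = nonpar p q λ e → m (trans (lem c (γ p) (γ q) (δ p) (δ q)) e)
  where
  lem : ∀ k a b c d → a * d - b * c ≡ a * (d + k * b) - b * (c + k * a)
  lem = ℤS.solve-∀

meet-⊟ : ∀ {N} {δ γ ε : Vecℤ N} → InPlane δ γ ε → InPlane (⊟ δ) γ ε
meet-⊟ {δ = δ} m = inPlane λ f a b → trans (pair-⊟ f δ) (cong -ℚ_ (meets m f a b))

meet-≈ : ∀ {N} {δ δ′ γ ε : Vecℤ N} → δ ≈ δ′ → InPlane δ γ ε → InPlane δ′ γ ε
meet-≈ e m = inPlane λ f a b → trans (pair-≈ f (≈-sym e)) (meets m f a b)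

meet-shift : ∀ {N} {δ γ ε₁ ε₂ : Vecℤ N} c → InPlane δ ε₁ ε₂ → InPlane γ ε₁ ε₂ → InPlane (δ ⊞ c ⊡ γ) ε₁ ε₂
meet-shift {δ = δ} {γ} c m n = inPlane λ f a b → trans (pair-⊞ f δ (c ⊡ γ))
  (trans (cong₂ _+ℚ_ (meets m f a b) (trans (pair-⊡ f c γ) (trans (cong (toℚ c *ℚ_) (meets n f a b)) (ℚP.*-zeroʳ (toℚ c))))) (ℚP.+-identityʳ 0ℚ))

meetˡ : ∀ {N} {γ ε : Vecℤ N} → InPlane γ γ ε
meetˡ = inPlane λ f a b → a

meetʳ : ∀ {N} {γ ε : Vecℤ N} → InPlane ε γ ε
meetʳ = inPlane λ f a b → b

self-parallel : ∀ {N} (γ : Vecℤ N) → ¬ NonPar γ γ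
self-parallel γ (nonpar p q m) = m (ℤP.i≡j⇒i-j≡0 {γ p * γ q} {γ q * γ p} (ℤP.*-comm (γ p) (γ q)))

module Fractures {N : ℕ} (A : Matrix N) (cartan : IsCartan A) where
  open Inversions A cartan public

  -- The criterion for canonical generators of a rank two reflection subgroup: the reflection
  -- inverts no positive root of the plane apart from those parallel to γ.
  NoInv : ∀ {γ} → Mirror γ → Vecℤ N → Vecℤ N → Set
  NoInv {γ} M β₁ β₂ = ∀ δ → Root δ → Pos δ → InPlane δ β₁ β₂ → NonPar γ δ → Pos (Mirror.refl′ M δ)

  noInv-neg : ∀ {γ} (M : Mirror γ) {β₁ β₂} → NoInv M β₁ β₂ → NoInv (mirror-neg M) β₁ β₂
  noInv-neg {γ} M h δ r p m np = Pos-≈ (ptwise λ z → lem (δ z) (Mirror.coroot M δ) (γ z))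
      (h δ r p m (nonPar-sym (nonPar-≈ ≈-refl (⊟-invol γ) (nonPar-⊟ (nonPar-sym np)))))
    where
    lem : ∀ d c g → d + (- c) * g ≡ d + (- (- c)) * (- g)
    lem = ℤS.solve-∀

  Inverted : List (Fin N) → Fin N → Vecℤ N → Set
  Inverted w i δ = Pos δ × Neg (t w i δ) × NonPar (root w i) δ

  Crossing : List (Fin N) → Fin N → (Vecℤ N → Set) → Set
  Crossing w i P = Σ (List (Fin N)) λ p → Σ (Fin N) λ k → Σ (List (Fin N)) λ r → w ≡ p ++ k ∷ r × P (root p k) × Inverted w i (root p k)

  -- An inverted root δ and its partner - t δ span the same plane with the root of the mirror.
  inverted-crossing : ∀ w i (P : Vecℤ N → Set) → (∀ {u v} → u ≈ v → P u → P v) → (∀ {v} → P v → P (⊟ t w i v)) →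
                      ∀ δ → Root δ → Inverted w i δ → P δ → Crossing w i P
  inverted-crossing w i P P-≈ P-t δ r (p , n , np) Pδ with inversion w i r p n
  ... | inj₁ e = ⊥-elim (self-parallel (root w i) (nonPar-≈ ≈-refl e np))
  ... | inj₂ (q , k , r′ , e , inj₁ f) = q , k , r′ , e , P-≈ (≈-sym f) Pδ , Pos-≈ (≈-sym f) p , Neg-≈ (t-cong w i (≈-sym f)) n , nonPar-≈ ≈-refl
      (≈-sym f) np
  ... | inj₂ (q , k , r′ , e , inj₂ f) = q , k , r′ , e , P-≈ (≈-sym f) (P-t Pδ) , Pos-≈ (≈-sym f) (Pos-⊟ n) ,
      Neg-≈ (≈-sym (≈-trans (t-cong w i f) t-neg)) (Neg-⊟ p) ,
      nonPar-≈ ≈-refl (≈-sym (≈-trans f (⊟-cong (t-formula w i δ)))) (nonPar-⊟ (nonPar-shift (- μ w i δ) np))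
    where
    M : Mirror (root w i)
    M = mirror w i ≈-refl
    t-neg : t w i (⊟ t w i δ) ≈ ⊟ δ
    t-neg = ≈-trans (t-formula w i (⊟ t w i δ)) (ptwise λ z → trans (cong₂ (λ x c → (- x) + (- c) * root w i z) (at (t-formula w i δ) z) value)
        (lem (δ z) (μ w i δ) (root w i z)))
      where
      lem : ∀ d c g → - (d + (- c) * g) + (- c) * g ≡ - d
      lem = ℤS.solve-∀
      value : μ w i (⊟ t w i δ) ≡ μ w i δ
      value = trans (μ-cong w i (≈-trans (⊟-cong (t-formula w i δ)) (⊟-⊡ (Mirror.refl′ M δ))))
          (trans (μ-⊡ w i -1ℤ (Mirror.refl′ M δ)) (trans (cong (-1ℤ *_) (Mirror.c-refl′ M δ)) (lem′ (μ w i δ))))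
        where
        lem′ : ∀ a → -1ℤ * (- a) ≡ a
        lem′ = ℤS.solve-∀

  meet-t : ∀ w i {β₁ β₂} → InPlane (root w i) β₁ β₂ → ∀ {v} → InPlane v β₁ β₂ → InPlane (⊟ t w i v) β₁ β₂
  meet-t w i {β₁} {β₂} m {v} n = meet-≈ (⊟-cong (≈-sym (t-formula w i v))) (meet-⊟ (meet-shift (- μ w i v) n m))

  -- By `inverted-crossing`, any inverted root of the plane yields an inverted prefix root in the
  -- same plane. Testing the prefixes of w therefore decides a condition on all roots.
  search : ∀ w i {β₁ β₂} → NonPar β₁ β₂ → InPlane (root w i) β₁ β₂ →
           Crossing w i (λ δ → InPlane δ β₁ β₂) ⊎ NoInv (mirror w i ≈-refl) β₁ β₂
  search w i {β₁} {β₂} np m with any-split? (λ p k → InPlane (root p k) β₁ β₂ × Inverted w i (root p k))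
      (λ p k → meet? (root p k) β₁ β₂ np ×-dec (Pos? (root p k) ×-dec (Neg? (t w i (root p k)) ×-dec nonPar? (root w i) (root p k)))) w
  ... | yes c = inj₁ c
  ... | no ¬c = inj₂ λ δ r p mδ npδ → [ Pos-≈ (t-formula w i δ) , (λ n → ⊥-elim (¬c
        (inverted-crossing w i (λ δ → InPlane δ β₁ β₂) meet-≈ (meet-t w i m) δ r (p , n , npδ) mδ))) ]′ (root-sign (t-root w i r))

  record Extremal (β₁ β₂ : Vecℤ N) : Set where
    field
      γ      : Vecℤ N
      γ-root : Root γ
      γ-pos  : Pos γ
      γ-meet : InPlane γ β₁ β₂
      M      : Mirror γ
      no-inv : NoInv M β₁ β₂

  -- A failure of `NoInv` is witnessed by a prefix root of w in the plane. Its word is a proper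
  -- prefix of w, so the search can be repeated with it and must stop.
  descend : ∀ n w i {β₁ β₂} → length w ℕ.≤ n → NonPar β₁ β₂ → InPlane (root w i) β₁ β₂ → Extremal β₁ β₂
  descend n w i l np m with search w i np m
  ... | inj₂ h = [ (λ p → record { γ = root w i ; γ-root = w , i , ≈-refl ; γ-pos = p ; γ-meet = m ; M = mirror w i ≈-refl ; no-inv = h })
                 , (λ p → record { γ = ⊟ root w i ; γ-root = root-neg (w , i , ≈-refl) ; γ-pos = Pos-⊟ p ; γ-meet = meet-⊟ m ; M = mirror-neg
                     (mirror w i ≈-refl)
                                 ; no-inv = noInv-neg (mirror w i ≈-refl) h }) ]′ (sign w i)
  descend zero .(p ++ k ∷ r) i l np m | inj₁ (p , k , r , refl , mδ , _) = ⊥-elim (impossible p l)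
    where
    impossible : ∀ p → ¬ (length (p ++ k ∷ r) ℕ.≤ 0)
    impossible [] ()
    impossible (_ ∷ _) ()
  descend (suc n) .(p ++ k ∷ r) i l np m | inj₁ (p , k , r , refl , mδ , _) = descend n p k
    (ℕP.≤-pred (ℕP.≤-trans (subst (suc (length p) ℕ.≤_) (sym (trans (ListP.length-++ p) (ℕP.+-suc (length p) (length r))))
        (ℕ.s≤s (ℕP.m≤m+n (length p) (length r)))) l)) np mδ

  ¬sameHyp⇒nonPar : ∀ {γ δ} → Root γ → Root δ → ¬ SameHyp δ γ → NonPar γ δ
  ¬sameHyp⇒nonPar {γ} {δ} r r′ ns with nonPar? γ δ
  ... | yes h = h
  ... | no ¬h = ⊥-elim (ns (λ f → let (z , dz) = root-nonzero r′ ; (y , gy) = root-nonzero r in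
          parallel-sameHyp {γ = δ} {γ} (λ k → ¬h (nonPar-sym k)) z dz f , parallel-sameHyp {γ = γ} {δ} ¬h y gy f))

  module _ {γ ε β₁ β₂ : Vecℤ N} (M : Mirror γ) (γ-root : Root γ) (γ-pos : Pos γ) (γ-meet : InPlane γ β₁ β₂) (no-inv : NoInv M β₁ β₂)
           (ε-root : Root ε) (ε-pos : Pos ε) (ε-meet : InPlane ε β₁ β₂) (np : NonPar γ ε)
           (combs : ∀ δ → InPlane δ β₁ β₂ → Comb δ γ ε) where
    open Mirror M

    -- δ or its mirror image, whichever has nonpositive pairing with the coroot.
    low : ∀ δ → Root δ → Pos δ → InPlane δ β₁ β₂ → NonPar γ δ →
          Σ ℤ λ a → Pos (δ ⊞ (- a) ⊡ γ) × Root (δ ⊞ (- a) ⊡ γ) × 0ℤ ≤ + 2 * a - coroot δ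
    low δ r p m np′ with ℤP.≤-total 0ℤ (coroot δ)
    ... | inj₁ 0≤c = coroot δ , no-inv δ r p m np′ , r-root r , subst (0ℤ ≤_) (lem (coroot δ)) 0≤c
      where
      lem : ∀ c → c ≡ + 2 * c - c
      lem = ℤS.solve-∀
    ... | inj₂ c≤0 = 0ℤ , Pos-≈ e p , root-≈ e r , subst (0ℤ ≤_) (lem (coroot δ)) (ℤP.neg-mono-≤ c≤0)
      where
      e : δ ≈ δ ⊞ (- 0ℤ) ⊡ γ
      e = ptwise λ z → lem′ (δ z) (γ z)
        where
        lem′ : ∀ d g → d ≡ d + (- 0ℤ) * g
        lem′ = ℤS.solve-∀
      lem : ∀ c → - c ≡ + 2 * 0ℤ - c
      lem = ℤS.solve-∀

    -- Roots δ and ε on opposite sides of γ would, after passing to their lower images, have a positive combination equal to a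
    -- nonpositive multiple of γ.
    same-side : ∀ δ → Root δ → Pos δ → InPlane δ β₁ β₂ → NonPar γ δ → (c : Comb δ γ ε) → 0ℤ < Comb.V c
    same-side δ r p m np′ c with ℤP.<-cmp 0ℤ (Comb.V c)
    ... | tri< l _ _ = l
    ... | tri≈ _ e _ = ⊥-elim (comb-V≢0 c np′ (sym e))
    ... | tri> _ _ l with low δ r p m np′ | low ε ε-root ε-pos ε-meet np
    ...   | a , pδ , rδ , la | b , pε , rε , lb = ⊥-elim (ℤP.<-irrefl refl (ℤP.<-≤-trans U>0 U≤0))
      where
      open Comb c
      -- With the lower images δ - aγ and ε - bγ one has D(δ - aγ) + V′(ε - bγ) = U′γ. Positivity of
      -- the roots forces U′ > 0, the coroot forces U′ ≤ 0.
      U′ V′ : ℤ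
      V′ = - V
      U′ = U - D * a - V′ * b
      0<V′ : 0ℤ < V′
      0<V′ = ℤP.neg-mono-< l
      coroots : D * coroot δ + V′ * coroot ε ≡ U * + 2
      coroots = trans (lem₁ (D * coroot δ) (V * coroot ε) V (coroot ε) refl)
          (trans (cong (_- V * coroot ε) (trans (sym (c-⊡ D δ)) (trans (c-cong {D ⊡ δ} {U ⊡ γ ⊞ V ⊡ ε} (ptwise rel))
          (trans (c-⊞ (U ⊡ γ) (V ⊡ ε)) (cong₂ _+_ (trans (c-⊡ U γ) (cong (U *_) c-self)) (c-⊡ V ε)))))) (lem₂ (U * + 2) (V * coroot ε)))
        where
        lem₁ : ∀ x y v e → y ≡ v * e → x + (- v) * e ≡ x - y
        lem₁ x y v e refl = cong (_+_ x) (sym (ℤP.neg-distribˡ-* v e))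
        lem₂ : ∀ x y → x + y - y ≡ x
        lem₂ = ℤS.solve-∀
      U≤0 : U′ ≤ 0ℤ
      U≤0 = subst (_≤ 0ℤ) (ℤP.neg-involutive U′) (ℤP.neg-mono-≤
          (halve (subst (0ℤ ≤_) (sym twice) (+-nonneg (*-nonneg (ℤP.<⇒≤ 0<D) la) (*-nonneg (ℤP.<⇒≤ 0<V′) lb)))))
        where
        lem₃ : ∀ U D V a b → + 2 * (- (U - D * a - V * b)) ≡ + 2 * (D * a) + + 2 * (V * b) - U * + 2
        lem₃ = ℤS.solve-∀
        lem₄ : ∀ D V a b x y → + 2 * (D * a) + + 2 * (V * b) - (D * x + V * y) ≡ D * (+ 2 * a - x) + V * (+ 2 * b - y)
        lem₄ = ℤS.solve-∀
        twice : + 2 * (- U′) ≡ D * (+ 2 * a - coroot δ) + V′ * (+ 2 * b - coroot ε)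
        twice = trans (lem₃ U D V′ a b) (trans (cong (λ x → + 2 * (D * a) + + 2 * (V′ * b) - x) (sym coroots)) (lem₄ D V′ a b (coroot δ) (coroot ε)))
      U>0 : 0ℤ < U′
      U>0 with root-nonzero rδ
      ... | z , h = positive-factor (γ-pos z) (subst (0ℤ <_) total (ℤP.+-mono-<-≤ (positive-* 0<D (nonneg≢0⇒positive (pδ z) h))
          (*-nonneg (ℤP.<⇒≤ 0<V′) (pε z))))
        where
        positive-* : ∀ {x y} → 0ℤ < x → 0ℤ < y → 0ℤ < x * y
        positive-* {+ suc x} {+ suc y} _ _ = ℤ.+<+ (ℕ.s≤s ℕ.z≤n)
        positive-* {+ suc x} {+ zero} _ (ℤ.+<+ ())
        positive-* {+ zero} (ℤ.+<+ ())
        positive-factor : ∀ {x y} → 0ℤ ≤ y → 0ℤ < x * y → 0ℤ < x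
        positive-factor {+ zero} {y} _ q = q
        positive-factor {+ suc x} {y} _ q = ℤ.+<+ (ℕ.s≤s ℕ.z≤n)
        positive-factor { -[1+ x ]} {+ zero} _ q = ⊥-elim (ℤP.<-irrefl (sym (ℤP.*-zeroʳ -[1+ x ])) q)
        positive-factor { -[1+ x ]} {+ suc y} _ ()
        positive-factor { -[1+ x ]} { -[1+ y ]} () q
        lem : ∀ D V a b d e g → D * (d + (- a) * g) + V * (e + (- b) * g) ≡ (D * d + V * e) - (D * a) * g - (V * b) * g
        lem = ℤS.solve-∀
        lem′ : ∀ D d V e U g x y → D * d ≡ U * g + V * e → (D * d + (- V) * e) - x * g - y * g ≡ (U - x - y) * g
        lem′ D d V e U g x y h = trans (cong (λ k → (k + (- V) * e) - x * g - y * g) h) (lem″ V e U g x y)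
          where
          lem″ : ∀ V e U g x y → (U * g + V * e + (- V) * e) - x * g - y * g ≡ (U - x - y) * g
          lem″ = ℤS.solve-∀
        total : D * (δ z + (- a) * γ z) + V′ * (ε z + (- b) * γ z) ≡ U′ * γ z
        total = trans (lem D V′ a b (δ z) (ε z) (γ z)) (lem′ D (δ z) V (ε z) U (γ z) (D * a) (V′ * b) (rel z))

    -- The point of the wall is a functional that vanishes at γ and is positive at ε. By `same-side`
    -- every other positive root of the plane lies on the side of ε, so the functional is positive
    -- there too, as is every functional in D.
    noInv⇒basic : Basic A β₁ β₂ γ
    noInv⇒basic = (⇒isRoot γ-root , meets γ-meet) , f , fγ , sides
      where
      f : Fun N
      f = proj₁ (nonPar-functional np)
      fγ : pair f γ ≡ 0ℚ
      fγ = proj₁ (proj₂ (nonPar-functional np))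
      fε : 0ℚ <ℚ pair f ε
      fε = proj₂ (proj₂ (nonPar-functional np))
      positive-side : ∀ δ → Root δ → Pos δ → InPlane δ β₁ β₂ → NonPar γ δ → ∀ g → InD g → 0ℚ <ℚ pair f δ *ℚ pair g δ
      positive-side δ r p m np′ g gD = *ℚ-positive
        (positive-cancel (toℚ-positive (Comb.0<D c)) (subst (0ℚ <ℚ_) (sym value) (*ℚ-positive (toℚ-positive (same-side δ r p m np′ c)) fε)))
        (let (z , h) = root-nonzero r in pair-InD {v = δ} gD p z h)
        where
        c : Comb δ γ ε
        c = combs δ m
        lem : ∀ u x → u *ℚ 0ℚ +ℚ x ≡ x
        lem = RS.solve-∀ ringℚ
        value : toℚ (Comb.D c) *ℚ pair f δ ≡ toℚ (Comb.V c) *ℚ pair f ε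
        value = trans (comb-pair c f) (trans (cong (λ x → toℚ (Comb.U c) *ℚ x +ℚ toℚ (Comb.V c) *ℚ pair f ε) fγ)
            (lem (toℚ (Comb.U c)) (toℚ (Comb.V c) *ℚ pair f ε)))
      sides : ∀ δ → InRank2 A β₁ β₂ δ → ¬ SameHyp δ γ → ∀ g → InD g → 0ℚ <ℚ pair f δ *ℚ pair g δ
      sides δ (r , m′) ns g gD with root-sign (isRoot⇒ r) | inPlane {δ = δ} {β₁} {β₂} m′
      ... | inj₁ p | m = positive-side δ (isRoot⇒ r) p m (¬sameHyp⇒nonPar γ-root (isRoot⇒ r) ns) g gD
      ... | inj₂ n | m = subst (0ℚ <ℚ_) (trans (cong₂ _*ℚ_ (pair-⊟ f δ) (pair-⊟ g δ)) (lem (pair f δ) (pair g δ)))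
              (positive-side (⊟ δ) (root-neg (isRoot⇒ r)) (Pos-⊟ n) (meet-⊟ m) (nonPar-⊟ (¬sameHyp⇒nonPar γ-root (isRoot⇒ r) ns)) g gD)
        where
        lem : ∀ a b → (-ℚ a) *ℚ (-ℚ b) ≡ a *ℚ b
        lem = RS.solve-∀ ringℚ

  -- β + β′ = m η with β, β′ positive: a functional vanishing on η cannot be positive on both.
  inverted⇒¬basic : ∀ {η β β′ β₁ β₂} m → Root β → Root β′ → Pos β → Pos β′ → InPlane β β₁ β₂ → InPlane β′ β₁ β₂ →
                    NonPar η β → NonPar η β′ → β ⊞ β′ ≈ m ⊡ η → ¬ Basic A β₁ β₂ η
  inverted⇒¬basic {η} {β} {β′} {β₁} {β₂} m r r′ p p′ c c′ np np′ e (_ , f , fη , sides) = ℚP.<-irrefl (sym total)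
      (ℚP.+-mono-< (side β r p c np) (side β′ r′ p′ c′ np′))
    where
    one : Fun N
    one _ = 1ℚ
    one-D : InD one
    one-D _ = toℚ-positive {1ℤ} (ℤ.+<+ (ℕ.s≤s ℕ.z≤n))
    side : ∀ δ → Root δ → Pos δ → InPlane δ β₁ β₂ → NonPar η δ → 0ℚ <ℚ pair f δ
    side δ r p c np = positive-cancel (let (z , h) = root-nonzero r in pair-InD {v = δ} one-D p z h)
      (subst (0ℚ <ℚ_) (ℚP.*-comm (pair f δ) (pair one δ)) (sides δ (⇒isRoot r , meets c) (λ h → nonPar-¬sameHyp (nonPar-sym np) h) one one-D))
    total : pair f β +ℚ pair f β′ ≡ 0ℚ +ℚ 0ℚ
    total = trans (sym (pair-⊞ f β β′)) (trans (pair-≈ f e) (trans (pair-⊡ f m η) (trans (cong (toℚ m *ℚ_) fη) (ℚP.*-zeroʳ (toℚ m)))))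

-- Fractures as inversions of a reflection

module Cutting {N : ℕ} (A : Matrix N) (cartan : IsCartan A) where
  open Fractures A cartan public

  module _ (w : List (Fin N)) (i : Fin N) {η : Vecℤ N} (e : root w i ≈ η) (η-pos : Pos η) where

    private
      η-root : Root η
      η-root = w , i , e

    partner : Vecℤ N → Vecℤ N
    partner β = ⊟ t w i β

    partner-formula : ∀ β → partner β ≈ ⊟ (β ⊞ (- μ w i β) ⊡ η)
    partner-formula β = ⊟-cong (≈-trans (t-formula w i β) (shift-cong β (- μ w i β) e))

    partner-sum : ∀ β → β ⊞ partner β ≈ μ w i β ⊡ η
    partner-sum β = ptwise λ z → trans (cong (_+_ (β z)) (at (partner-formula β) z)) (lem (β z) (μ w i β) (η z))
      where
      lem : ∀ b m g → b + - (b + (- m) * g) ≡ m * g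
      lem = ℤS.solve-∀

    partner-nonPar : ∀ {β} → NonPar η β → NonPar η (partner β)
    partner-nonPar {β} np = nonPar-≈ ≈-refl (≈-sym (partner-formula β)) (nonPar-⊟ (nonPar-shift (- μ w i β) np))

    partner-meet : ∀ {β β₁ β₂} → InPlane η β₁ β₂ → InPlane β β₁ β₂ → InPlane (partner β) β₁ β₂
    partner-meet {β} m n = meet-≈ (≈-sym (partner-formula β)) (meet-⊟ (meet-shift (- μ w i β) n m))

    partner-sameFracture : ∀ {β} → NonPar η β → SameFracture η β (partner β)
    partner-sameFracture np = same-fracture np (partner-nonPar np) (partner-meet meetˡ meetʳ)

    module _ {β : Vecℤ N} (β-root : Root β) (β-pos : Pos β) (β-neg : Neg (t w i β)) (np : NonPar η β) where

      private
        η-meet : InPlane (root w i) η β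
        η-meet = meet-≈ (≈-sym e) meetˡ

        E : Extremal η β
        E = descend (length w) w i ℕP.≤-refl np η-meet
      open Extremal E
      open Mirror M

      private
        m : ℤ
        m = μ w i β

        β′ : Vecℤ N
        β′ = partner β

        β′-root : Root β′
        β′-root = root-neg (t-root w i β-root)

        β′-pos : Pos β′
        β′-pos = Pos-⊟ β-neg

        m≢0 : m ≢ 0ℤ
        m≢0 m≡0 with root-nonzero β-root
        ... | z , βz≢0 = βz≢0 (ℤP.≤-antisym (subst (_≤ 0ℤ) (trans (ℤP.neg-involutive (t w i β z)) (sym (at unchanged z))) (ℤP.neg-mono-≤ (β′-pos z)))
            (β-pos z))
          where
          unchanged : β ≈ t w i β
          unchanged = ptwise λ z → sym (trans (at (t-formula w i β) z) (trans (cong (λ c → β z + (- c) * root w i z) m≡0) (lem (β z) (root w i z))))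
            where
            lem : ∀ b g → b + (- 0ℤ) * g ≡ b
            lem = ℤS.solve-∀

      -- If γ were parallel to η, its reflection would negate η. By `no-inv` it keeps β and its
      -- partner β′ positive. Then both β + β′ = mη and its negative would be nonnegative, although
      -- m ≠ 0.
      extremal-nonPar : NonPar η γ
      extremal-nonPar with nonPar? η γ
      ... | yes h = h
      ... | no ¬h with root-nonzero η-root
      ...   | z , ηz≢0 = ⊥-elim (mη≢0 (ℤP.≤-antisym mη≤0 mη≥0))
        where
        scaled : ∀ y → η z * γ y ≡ γ z * η y
        scaled y = trans (parallel {γ = η} {γ} ¬h z y) (ℤP.*-comm (η y) (γ z))
        γz≢0 : γ z ≢ 0ℤ
        γz≢0 γz≡0 = let (y , γy≢0) = root-nonzero γ-root in γy≢0 (no-zero-divisor (trans (scaled y) (cong (_* η y) γz≡0)) ηz≢0)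
        transfer : ∀ {δ} → NonPar η δ → NonPar γ δ
        transfer {δ} (nonpar p q mi) = nonpar p q λ h → mi (no-zero-divisor (trans (lem₁ (γ z) (η p) (η q) (δ p) (δ q))
            (trans (cong₂ (λ x y → x * δ q - y * δ p) (sym (scaled p)) (sym (scaled q)))
                (trans (lem₂ (η z) (γ p) (γ q) (δ p) (δ q)) (trans (cong (η z *_) h) (ℤP.*-zeroʳ (η z)))))) γz≢0)
          where
          lem₁ : ∀ k a b c d → k * (a * d - b * c) ≡ (k * a) * d - (k * b) * c
          lem₁ = ℤS.solve-∀
          lem₂ : ∀ k a b c d → (k * a) * d - (k * b) * c ≡ k * (a * d - b * c)
          lem₂ = ℤS.solve-∀
        mη≢0 : m * η z ≢ 0ℤ
        mη≢0 h = ηz≢0 (no-zero-divisor h m≢0)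
        mη≥0 : 0ℤ ≤ m * η z
        mη≥0 = subst (0ℤ ≤_) (at (partner-sum β) z) (+-nonneg (β-pos z) (β′-pos z))
        coroot-η : coroot η * γ z ≡ + 2 * η z
        coroot-η = trans (ℤP.*-comm (coroot η) (γ z)) (trans (sym (c-⊡ (γ z) η)) (trans (c-cong {γ z ⊡ η} {η z ⊡ γ} (ptwise λ y → sym (scaled y)))
          (trans (c-⊡ (η z) γ) (trans (cong (η z *_) c-self) (ℤP.*-comm (η z) (+ 2))))))
        coroot-sum : coroot β + coroot β′ ≡ m * coroot η
        coroot-sum = trans (sym (c-⊞ β β′)) (trans (c-cong (partner-sum β)) (c-⊡ m η))
        mη≤0 : m * η z ≤ 0ℤ
        mη≤0 = subst (_≤ 0ℤ) (ℤP.neg-involutive (m * η z)) (ℤP.neg-mono-≤ (subst (0ℤ ≤_) value (+-nonneg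
                  (no-inv β β-root β-pos meetʳ (transfer np) z) (no-inv β′ β′-root β′-pos (partner-meet meetˡ meetʳ)
                      (transfer (partner-nonPar np)) z))))
          where
          lem₁ : ∀ b c b′ c′ g → (b + (- c) * g) + (b′ + (- c′) * g) ≡ (b + b′) - (c + c′) * g
          lem₁ = ℤS.solve-∀
          lem₂ : ∀ m e c g → m * e - (m * c) * g ≡ m * e - m * (c * g)
          lem₂ = ℤS.solve-∀
          lem₃ : ∀ m e → m * e - m * (+ 2 * e) ≡ - (m * e)
          lem₃ = ℤS.solve-∀
          value : (β z + (- coroot β) * γ z) + (β′ z + (- coroot β′) * γ z) ≡ - (m * η z)
          value = trans (lem₁ (β z) (coroot β) (β′ z) (coroot β′) (γ z)) (trans (cong₂ (λ x y → x - y * γ z) (at (partner-sum β) z) coroot-sum)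
            (trans (lem₂ m (η z) (coroot η) (γ z)) (trans (cong (λ x → m * η z - m * x) coroot-η) (lem₃ m (η z)))))

      -- The root γ is basic because its reflection inverts nothing else in the plane. The root η is
      -- not, because the positive roots β and β′ of the plane add up to a multiple of it.
      extremal-cuts : Cuts A γ η
      extremal-cuts = ⇒isRoot γ-root , nonPar-¬sameHyp (nonPar-sym extremal-nonPar) , basic , ¬basic
        where
        basic : Basic A γ η γ
        basic = noInv⇒basic M γ-root γ-pos meetˡ
          (λ δ r p n npδ → no-inv δ r p (inPlane λ f a b → meets n f (meets γ-meet f a b) a) npδ)
          η-root η-pos meetʳ (nonPar-sym extremal-nonPar) (λ δ n → meet-comb (nonPar-sym extremal-nonPar) n)
        c : Comb γ η β
        c = meet-comb np γ-meet
        β-meet : InPlane β γ η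
        β-meet = inPlane λ f a b → comb-exchange c (comb-V≢0 c extremal-nonPar) f b a
        ¬basic : ¬ Basic A γ η η
        ¬basic = inverted⇒¬basic m β-root β′-root β-pos β′-pos β-meet (partner-meet meetʳ β-meet) np (partner-nonPar np) (partner-sum β)

      cut-in-plane : Σ (Vecℤ N) λ γ → Cuts A γ η × SameFracture η β γ
      cut-in-plane = γ , extremal-cuts , same-fracture np extremal-nonPar γ-meet

    -- If no prefix root in the plane of η and β were inverted, the reflection in η would satisfy
    -- `NoInv` there and η would be basic, which a cut excludes.
    cut⇒crossing : ∀ {β} → Cuts A β η → Crossing w i (λ δ → SameFracture η β δ)
    cut⇒crossing {β} (r , ¬same , _ , ¬basic) with search w i np (meet-≈ (≈-sym e) meetˡ)
      where
      np : NonPar η β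
      np = ¬sameHyp⇒nonPar η-root (isRoot⇒ r) ¬same
    ... | inj₁ (p , k , r′ , eq , n , pos , neg , npδ) = p , k , r′ , eq , same-fracture np (nonPar-≈ e ≈-refl npδ) n , pos , neg , npδ
      where
      np : NonPar η β
      np = ¬sameHyp⇒nonPar η-root (isRoot⇒ r) ¬same
    ... | inj₂ h = ⊥-elim (¬basic basic)
      where
      np : NonPar η β
      np = ¬sameHyp⇒nonPar η-root (isRoot⇒ r) ¬same
      no-inv : NoInv (mirror w i e) β η
      no-inv δ rδ pδ n npδ = Pos-≈ (shift-cong δ (- μ w i δ) e) (h δ rδ pδ (meet-swap n) (nonPar-≈ (≈-sym e) ≈-refl npδ))
      oriented : ∀ ε → Root ε → Pos ε → InPlane ε β η → (∀ f → pair f ε ≡ 0ℚ → pair f β ≡ 0ℚ) → NonPar η ε → Basic A β η η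
      oriented ε rε pε n back npε = noInv⇒basic (mirror w i e) η-root η-pos meetʳ no-inv rε pε n npε
        (λ δ mδ → meet-comb npε (inPlane λ f a b → meets mδ f (back f b) a))
      basic : Basic A β η η
      basic with root-sign (isRoot⇒ r)
      ... | inj₁ p = oriented β (isRoot⇒ r) p meetˡ (λ f z → z) np
      ... | inj₂ n = oriented (⊟ β) (root-neg (isRoot⇒ r)) (Pos-⊟ n) (meet-⊟ meetˡ)
              (λ f z → trans (lem (pair f β)) (cong -ℚ_ (trans (sym (pair-⊟ f β)) z))) (nonPar-⊟ np)
        where
        lem : ∀ x → x ≡ -ℚ (-ℚ x)
        lem = RS.solve-∀ ringℚ

-- Stretched Cartan matrices

sumℤ-split : ∀ m {n} (f : Fin (m ℕ.+ n) → ℤ) → sumℤ f ≡ sumℤ (λ z → f (z Fin.↑ˡ n)) + sumℤ (λ i → f (m Fin.↑ʳ i))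
sumℤ-split zero    f = sym (ℤP.+-identityˡ (sumℤ f))
sumℤ-split (suc m) f = trans (cong (_+_ (f Fin.zero)) (sumℤ-split m (λ z → f (Fin.suc z)))) (sym (ℤP.+-assoc (f Fin.zero) _ _))

sumℤ-last : ∀ n (h : ℕ → ℤ) → (∀ i → i ℕ.< n → h i ≡ 0ℤ) → sumℤ {suc n} (λ i → h (toℕ i)) ≡ h n
sumℤ-last zero    h z = ℤP.+-identityʳ (h 0)
sumℤ-last (suc n) h z = trans (cong₂ _+_ (z 0 (ℕ.s≤s ℕ.z≤n)) (sumℤ-last n (λ i → h (suc i)) (λ i l → z (suc i) (ℕ.s≤s l))))
    (ℤP.+-identityˡ (h (suc n)))

sumℤ-ends : ∀ n (h : ℕ → ℤ) → (∀ i → 1 ℕ.≤ i → i ℕ.≤ n → h i ≡ 0ℤ) → sumℤ {2 ℕ.+ n} (λ i → h (toℕ i)) ≡ h 0 + h (suc n)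
sumℤ-ends n h z = cong (_+_ (h 0)) (sumℤ-last n (λ i → h (suc i)) (λ i l → z (suc i) (ℕ.s≤s ℕ.z≤n) l))

pathEntry-diag : ∀ i → pathEntry i i ≡ + 2
pathEntry-diag i with i ℕ.≟ i
... | yes _ = refl
... | no ¬e = ⊥-elim (¬e refl)

pathEntry-up : ∀ i → pathEntry i (suc i) ≡ -1ℤ
pathEntry-up i with i ℕ.≟ suc i | suc i ℕ.≟ suc i
... | yes e | _     = ⊥-elim (ℕP.1+n≢n (sym e))
... | no _  | yes _ = refl
... | no _  | no ¬e = ⊥-elim (¬e refl)

pathEntry-down : ∀ i → pathEntry (suc i) i ≡ -1ℤ
pathEntry-down i with suc i ℕ.≟ i | suc (suc i) ℕ.≟ i | suc i ℕ.≟ suc i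
... | yes e | _     | _     = ⊥-elim (ℕP.1+n≢n e)
... | no _  | yes e | _     = ⊥-elim (ℕP.<-irrefl (sym e) (ℕP.m≤n⇒m≤1+n ℕP.≤-refl))
... | no _  | no _  | yes _ = refl
... | no _  | no _  | no ¬e = ⊥-elim (¬e refl)

pathEntry-above : ∀ {i j} → suc i ℕ.< j → pathEntry i j ≡ 0ℤ
pathEntry-above {i} {j} l with i ℕ.≟ j | suc i ℕ.≟ j | i ℕ.≟ suc j
... | yes refl | _ | _ = ⊥-elim (ℕP.<⇒≱ l (ℕP.n≤1+n i))
... | no _ | yes refl | _ = ⊥-elim (ℕP.<-irrefl refl l)
... | no _ | no _ | yes refl = ⊥-elim (ℕP.<⇒≱ l (ℕP.≤-trans (ℕP.n≤1+n j) (ℕP.n≤1+n (suc j))))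
... | no _ | no _ | no _ = refl

pathEntry-below : ∀ {i j} → suc j ℕ.< i → pathEntry i j ≡ 0ℤ
pathEntry-below {i} {j} l with i ℕ.≟ j | suc i ℕ.≟ j | i ℕ.≟ suc j
... | yes refl | _ | _ = ⊥-elim (ℕP.<⇒≱ l (ℕP.n≤1+n i))
... | no _ | yes refl | _ = ⊥-elim (ℕP.<⇒≱ l (ℕP.≤-trans (ℕP.n≤1+n i) (ℕP.n≤1+n (suc i))))
... | no _ | no _ | yes refl = ⊥-elim (ℕP.<-irrefl refl l)
... | no _ | no _ | no _ = refl

pathEntry-nonpos : ∀ i j → i ≢ j → pathEntry i j ≤ 0ℤ
pathEntry-nonpos i j ¬e with i ℕ.≟ j | suc i ℕ.≟ j | i ℕ.≟ suc j
... | yes e | _ | _ = ⊥-elim (¬e e)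
... | no _ | yes _ | _ = ℤ.-≤+
... | no _ | no _ | yes _ = ℤ.-≤+
... | no _ | no _ | no _ = ℤ.+≤+ ℕ.z≤n

pathEntry-sym : ∀ i j → pathEntry i j ≡ pathEntry j i
pathEntry-sym i j with ℕP.<-cmp i j
... | tri≈ _ refl _ = refl
... | tri< l _ _ with ℕP.m≤n⇒m<n∨m≡n l
...   | inj₁ l′ = trans (pathEntry-above l′) (sym (pathEntry-below l′))
...   | inj₂ refl = trans (pathEntry-up i) (sym (pathEntry-down i))
pathEntry-sym i j | tri> _ _ l with ℕP.m≤n⇒m<n∨m≡n l
...   | inj₁ l′ = trans (pathEntry-below l′) (sym (pathEntry-above l′))
...   | inj₂ refl = trans (pathEntry-down j) (sym (pathEntry-up j))

module Stretch {m : ℕ} (A : Matrix m) (cartan : IsCartan A) (E : Elastic m) (n′ : ℕ) where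
  open IsCartan cartan
  open Elastic E

  -- At least one vertex is added, so the ends x₀ and x_n, which carry the left and the right
  -- neighbours, are distinct.
  n : ℕ
  n = suc n′

  V : Set
  V = Fin (m ℕ.+ n)

  B : Matrix (m ℕ.+ n)
  B = stA A E n

  St : Vecℤ m → Vecℤ (m ℕ.+ n)
  St = stVec E n

  pl : V → Place m
  pl = place {n = n} E

  base-vertex : Fin m → V
  base-vertex y = y Fin.↑ˡ n

  path : ℕ → V
  path zero    = base-vertex x
  path (suc k) with k ℕP.<? n
  ... | yes k<n = m Fin.↑ʳ Fin.fromℕ< k<n
  -- A default value; `path k` stands for x_k only when k ≤ n.
  ... | no _    = base-vertex x

  pl-base : ∀ {y} → y ≢ x → pl (base-vertex y) ≡ off y
  pl-base {y} y≢x rewrite FinP.splitAt-↑ˡ m y n with y Fin.≟ x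
  ... | yes e = ⊥-elim (y≢x e)
  ... | no _  = refl

  pl-x : pl (base-vertex x) ≡ on 0
  pl-x rewrite FinP.splitAt-↑ˡ m x n with x Fin.≟ x
  ... | yes _ = refl
  ... | no ¬e = ⊥-elim (¬e refl)

  pl-new : ∀ i → pl (m Fin.↑ʳ i) ≡ on (suc (toℕ i))
  pl-new i rewrite FinP.splitAt-↑ʳ m n i = refl

  pl-path : ∀ {k} → k ℕ.≤ n → pl (path k) ≡ on k
  pl-path {zero}  _ = pl-x
  pl-path {suc k} l with k ℕP.<? n
  ... | yes k<n = trans (pl-new (Fin.fromℕ< k<n)) (cong (λ j → on (suc j)) (FinP.toℕ-fromℕ< k<n))
  ... | no ¬l   = ⊥-elim (¬l l)

  data Vertex : V → Set where
    baseᵥ : ∀ y → y ≢ x → Vertex (base-vertex y)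
    pathᵥ : ∀ k → k ℕ.≤ n → Vertex (path k)

  vertex : ∀ v → Vertex v
  vertex v with Fin.splitAt m v in eq
  ... | inj₁ y = subst Vertex (FinP.splitAt⁻¹-↑ˡ {m} {n} {v} eq) (original y)
    where
    original : ∀ y → Vertex (base-vertex y)
    original y with y Fin.≟ x
    ... | yes refl = pathᵥ 0 ℕ.z≤n
    ... | no y≢x   = baseᵥ y y≢x
  ... | inj₂ i = subst Vertex (trans (path-new (FinP.toℕ<n i)) (FinP.splitAt⁻¹-↑ʳ {m} {n} {v} eq)) (pathᵥ (suc (toℕ i)) (FinP.toℕ<n i))
    where
    path-new : toℕ i ℕ.< n → path (suc (toℕ i)) ≡ m Fin.↑ʳ i
    path-new l with toℕ i ℕP.<? n
    ... | yes k<n = cong (m Fin.↑ʳ_) (FinP.fromℕ<-toℕ i k<n)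
    ... | no ¬l   = ⊥-elim (¬l l)

  off-injective : ∀ {y z : Fin m} → off y ≡ off z → y ≡ z
  off-injective refl = refl

  on-injective : ∀ {i j} → on {m} i ≡ on j → i ≡ j
  on-injective refl = refl

  pl-injective : ∀ {u v} → pl u ≡ pl v → u ≡ v
  pl-injective {u} {v} e = by-view (vertex u) (vertex v) e
    where
    by-view : ∀ {u v} → Vertex u → Vertex v → pl u ≡ pl v → u ≡ v
    by-view (baseᵥ y p) (baseᵥ z q) e = cong base-vertex (off-injective (trans (sym (pl-base p)) (trans e (pl-base q))))
    by-view (pathᵥ k p) (pathᵥ l q) e = cong path (on-injective (trans (sym (pl-path p)) (trans e (pl-path q))))
    by-view (baseᵥ y p) (pathᵥ l q) e with trans (sym (pl-base p)) (trans e (pl-path q))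
    ... | ()
    by-view (pathᵥ k p) (baseᵥ z q) e with trans (sym (pl-path p)) (trans e (pl-base q))
    ... | ()

  pl-off-≢x : ∀ u {y} → pl u ≡ off y → y ≢ x
  pl-off-≢x u e = by-view (vertex u) e
    where
    by-view : ∀ {u y} → Vertex u → pl u ≡ off y → y ≢ x
    by-view (baseᵥ z z≢x) e refl = z≢x (off-injective (trans (sym (pl-base z≢x)) e))
    by-view (pathᵥ k p) e with trans (sym (pl-path p)) e
    ... | ()

  if-nonpos : ∀ b {c : ℤ} → c ≤ 0ℤ → (if b then c else 0ℤ) ≤ 0ℤ
  if-nonpos true  e = e
  if-nonpos false e = ℤ.+≤+ ℕ.z≤n

  if-zeroSym : ∀ b {c d : ℤ} → (c ≡ 0ℤ → d ≡ 0ℤ) → (if b then c else 0ℤ) ≡ 0ℤ → (if b then d else 0ℤ) ≡ 0ℤ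
  if-zeroSym true  h e = h e
  if-zeroSym false h e = refl

  st-cartan : IsCartan B
  st-cartan = record { diag = λ u → st-diag (pl u) ; offdiag = λ u v u≢v → st-offdiag u v (pl u) (pl v) refl refl u≢v ; zeroSym = λ u v → st-zeroSym
      (pl u) (pl v) }
    where
    st-diag : ∀ P → stEntry A E n P P ≡ + 2
    st-diag (off y) = diag y
    st-diag (on i)  = pathEntry-diag i
    st-offdiag : ∀ u v P Q → pl u ≡ P → pl v ≡ Q → u ≢ v → stEntry A E n P Q ≤ 0ℤ
    st-offdiag u v (off y) (off z) p q u≢v = offdiag y z (λ e → u≢v (pl-injective (trans p (trans (cong off e) (sym q)))))
    st-offdiag u v (on i)  (on j)  p q u≢v = pathEntry-nonpos i j (λ e → u≢v (pl-injective (trans p (trans (cong on e) (sym q)))))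
    st-offdiag u v (on i)  (off z) p q u≢v = if-nonpos (joined E n i z) (offdiag x z (λ e → pl-off-≢x v q (sym e)))
    st-offdiag u v (off y) (on j)  p q u≢v = if-nonpos (joined E n j y) (offdiag y x (pl-off-≢x u p))
    st-zeroSym : ∀ P Q → stEntry A E n P Q ≡ 0ℤ → stEntry A E n Q P ≡ 0ℤ
    st-zeroSym (off y) (off z) e = zeroSym y z e
    st-zeroSym (on i)  (on j)  e = trans (pathEntry-sym j i) e
    st-zeroSym (on i)  (off z) e = if-zeroSym (joined E n i z) (zeroSym x z) e
    st-zeroSym (off y) (on j)  e = if-zeroSym (joined E n j y) (zeroSym y x) e

  joined-last : ∀ y → joined E n n y ≡ not (onLeft y)
  joined-last y with suc n′ ℕ.≟ suc n′
  ... | yes _ = refl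
  ... | no ¬e = ⊥-elim (¬e refl)

  joined-inner : ∀ i y → 1 ℕ.≤ i → i ℕ.≤ n′ → joined E n i y ≡ false
  joined-inner (suc i) y _ l with suc i ℕ.≟ suc n′
  ... | yes refl = ⊥-elim (ℕP.<-irrefl refl l)
  ... | no _     = refl

  -- The vertex x₀ is stored among the original vertices. Its term is moved to the sum along the
  -- path, which is why `H` has to vanish at x.
  sum-place : ∀ (G : Place m → ℤ) (H : Fin m → ℤ) → (∀ z → z ≢ x → G (off z) ≡ H z) → H x ≡ 0ℤ →
              sumℤ (λ v → G (pl v)) ≡ sumℤ H + sumℤ {suc n} (λ i → G (on (toℕ i)))
  sum-place G H GH Hx = trans (sumℤ-split m (λ v → G (pl v))) (trans (cong₂ _+_
      (trans (sumℤ-cong (λ z → first z (z Fin.≟ x))) (trans (sumℤ-+ H (λ z → G (on 0) * simple x z))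
          (cong (_+_ (sumℤ H)) (sumℤ-simple (λ _ → G (on 0)) x))))
      (sumℤ-cong (λ i → cong G (pl-new i))))
    (ℤP.+-assoc (sumℤ H) (G (on 0)) (sumℤ {n} (λ i → G (on (suc (toℕ i)))))))
    where
    lem₁ : ∀ a b → b ≡ 0ℤ → a ≡ b + a * 1ℤ
    lem₁ a .0ℤ refl = trans (sym (ℤP.*-identityʳ a)) (sym (ℤP.+-identityˡ (a * 1ℤ)))
    lem₂ : ∀ a b → b ≡ b + a * 0ℤ
    lem₂ = ℤS.solve-∀
    first : ∀ z → Dec (z ≡ x) → G (pl (base-vertex z)) ≡ H z + G (on 0) * simple x z
    first z (yes refl) = trans (cong G pl-x) (trans (lem₁ (G (on 0)) (H x) Hx) (cong (λ k → H x + G (on 0) * k) (sym (simple-self x))))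
    first z (no z≢x)   = trans (cong G (pl-base z≢x)) (trans (GH z z≢x)
        (trans (lem₂ (G (on 0)) (H z)) (cong (λ k → H z + G (on 0) * k) (sym (simple-other (λ e → z≢x (sym e)))))))

module Blocks {m : ℕ} (A : Matrix m) (cartan : IsCartan A) (E : Elastic m) (n′ : ℕ) where
  open Stretch A cartan E n′ public
  open IsCartan cartan
  open Elastic E
  module 𝔸 = Cutting A cartan
  module 𝔹 = Cutting B st-cartan

  stVal : Vecℤ m → Place m → ℤ
  stVal b (off y) = b y
  stVal b (on i)  = b x

  St-at : ∀ b v → St b v ≡ stVal b (pl v)
  St-at b v with place {n = n} E v
  ... | off y = refl
  ... | on i  = refl

  St-cong : ∀ {b c} → b ≈ c → St b ≈ St c
  St-cong {b} {c} e = ptwise λ v → trans (St-at b v) (trans (val (pl v)) (sym (St-at c v)))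
    where
    val : ∀ P → stVal b P ≡ stVal c P
    val (off y) = at e y
    val (on i)  = at e x

  St-⊞ : ∀ b c → St (b ⊞ c) ≈ St b ⊞ St c
  St-⊞ b c = ptwise λ v → trans (St-at (b ⊞ c) v) (trans (val (pl v)) (sym (cong₂ _+_ (St-at b v) (St-at c v))))
    where
    val : ∀ P → stVal (b ⊞ c) P ≡ stVal b P + stVal c P
    val (off y) = refl
    val (on i)  = refl

  St-⊡ : ∀ k b → St (k ⊡ b) ≈ k ⊡ St b
  St-⊡ k b = ptwise λ v → trans (St-at (k ⊡ b) v) (trans (val (pl v)) (sym (cong (k *_) (St-at b v))))
    where
    val : ∀ P → stVal (k ⊡ b) P ≡ k * stVal b P
    val (off y) = refl
    val (on i)  = refl

  -- A stretched vector is constant along the path, so only the sum of the row along the path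
  -- matters. This serves both the rows of base vertices and the coroot of X.
  row-sum : ∀ (C : Place m → ℤ) (c : Fin m → ℤ) → (∀ z → C (off z) ≡ c z) → sumℤ {suc n} (λ i → C (on (toℕ i))) ≡ c x →
            ∀ b → sumℤ (λ v → C (pl v) * St b v) ≡ sumℤ (λ z → c z * b z)
  row-sum C c Cc ends b = begin
    sumℤ (λ v → C (pl v) * St b v)              ≡⟨ sumℤ-cong (λ v → cong (C (pl v) *_) (St-at b v)) ⟩
    sumℤ (λ v → C (pl v) * stVal b (pl v))      ≡⟨ sum-place (λ P → C P * stVal b P) (λ z → c z * b₀ z) outside inside ⟩
    sumℤ (λ z → c z * b₀ z) + sumℤ {suc n} (λ i → C (on (toℕ i)) * b x) ≡⟨ cong₂ _+_ minus-x path-part ⟩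
    (sumℤ (λ z → c z * b z) + (- b x) * c x) + b x * c x ≡⟨ lem (sumℤ (λ z → c z * b z)) (b x) (c x) ⟩
    sumℤ (λ z → c z * b z) ∎
    where
    open ≡-Reasoning
    b₀ : Vecℤ m
    b₀ = b ⊞ (- b x) ⊡ simple x
    lem : ∀ s b c → (s + (- b) * c) + b * c ≡ s
    lem = ℤS.solve-∀
    outside : ∀ z → z ≢ x → C (off z) * b z ≡ c z * b₀ z
    outside z z≢x = cong₂ _*_ (Cc z) (trans (lem₁ (b z) (b x)) (cong (λ k → b z + (- b x) * k) (sym (simple-other (λ e → z≢x (sym e))))))
      where
      lem₁ : ∀ u v → u ≡ u + (- v) * 0ℤ
      lem₁ = ℤS.solve-∀
    inside : c x * b₀ x ≡ 0ℤ
    inside = trans (cong (λ k → c x * (b x + (- b x) * k)) (simple-self x)) (lem₁ (c x) (b x))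
      where
      lem₁ : ∀ c u → c * (u + (- u) * 1ℤ) ≡ 0ℤ
      lem₁ = ℤS.solve-∀
    minus-x : sumℤ (λ z → c z * b₀ z) ≡ sumℤ (λ z → c z * b z) + (- b x) * c x
    minus-x = trans (sumℤ-cong (λ z → lem₁ (c z) (b z) (- b x) (simple x z))) (trans (sumℤ-+ (λ z → c z * b z) (λ z → (- b x) * (c z * simple x z)))
      (cong (_+_ (sumℤ (λ z → c z * b z))) (trans (sumℤ-* (- b x) (λ z → c z * simple x z)) (cong ((- b x) *_) (sumℤ-simple c x)))))
      where
      lem₁ : ∀ c u k s → c * (u + k * s) ≡ c * u + k * (c * s)
      lem₁ = ℤS.solve-∀
    path-part : sumℤ {suc n} (λ i → C (on (toℕ i)) * b x) ≡ b x * c x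
    path-part = trans (sumℤ-cong {suc n} (λ i → ℤP.*-comm (C (on (toℕ i))) (b x)))
        (trans (sumℤ-* {suc n} (b x) (λ i → C (on (toℕ i)))) (cong (b x *_) ends))

  if-split : ∀ c (a : ℤ) → (if c then a else 0ℤ) + (if not c then a else 0ℤ) ≡ a
  if-split true  a = ℤP.+-identityʳ a
  if-split false a = ℤP.+-identityˡ a

  form-base-St : ∀ {y} → y ≢ x → ∀ b → form B (base-vertex y) (St b) ≡ form A y b
  form-base-St {y} y≢x b = trans (sumℤ-cong (λ v → cong (λ P → stEntry A E n P (pl v) * St b v) (pl-base y≢x)))
    (row-sum (stEntry A E n (off y)) (A y) (λ z → refl) ends b)
    where
    h : ℕ → ℤ
    h i = if joined E n i y then A y x else 0ℤ
    ends : sumℤ {suc n} (λ i → h (toℕ i)) ≡ A y x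
    ends = trans (sumℤ-ends n′ h (λ i p q → cong (λ c → if c then A y x else 0ℤ) (joined-inner i y p q)))
      (trans (cong (λ c → h 0 + (if c then A y x else 0ℤ)) (joined-last y)) (if-split (onLeft y) (A y x)))

  -- The coroot functional of x₀ + ⋯ + x_{k-1}.
  Λ : ℕ → Vecℤ (m ℕ.+ n) → ℤ
  Λ zero    v = 0ℤ
  Λ (suc k) v = Λ k v + form B (path k) v

  -- The coefficients of `Λ k`. In the sum of all rows of the path, the interior entries cancel as
  -- -1 + 2 - 1, and each end keeps a 1; together the ends give A x x = 2.
  column : ℕ → Place m → ℤ
  column zero    P = 0ℤ
  column (suc k) P = column k P + stEntry A E n (on k) P

  Λ-column : ∀ k → k ℕ.≤ suc n → ∀ v → Λ k v ≡ sumℤ (λ u → column k (pl u) * v u)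
  Λ-column zero    l v = sym (sumℤ-zero {f = λ u → 0ℤ * v u} (λ u → ℤP.*-zeroˡ (v u)))
  Λ-column (suc k) l v = trans (cong₂ _+_ (Λ-column k (ℕP.≤-trans (ℕP.n≤1+n k) l) v)
      (sumℤ-cong (λ u → cong (λ P → stEntry A E n P (pl u) * v u) (pl-path (ℕP.≤-pred l)))))
    (trans (sym (sumℤ-+ (λ u → column k (pl u) * v u) (λ u → stEntry A E n (on k) (pl u) * v u)))
      (sumℤ-cong (λ u → sym (ℤP.*-distribʳ-+ (v u) (column k (pl u)) (stEntry A E n (on k) (pl u))))))

  column-off : ∀ z k → suc k ℕ.≤ n → column (suc k) (off z) ≡ (if onLeft z then A x z else 0ℤ)
  column-off z zero    l = ℤP.+-identityˡ (if onLeft z then A x z else 0ℤ)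
  column-off z (suc k) l = trans (cong₂ _+_ (column-off z k (ℕP.≤-trans (ℕP.n≤1+n (suc k)) l))
    (cong (λ c → if c then A x z else 0ℤ) (joined-inner (suc k) z (ℕ.s≤s ℕ.z≤n) (ℕP.≤-pred l)))) (ℤP.+-identityʳ (if onLeft z then A x z else 0ℤ))

  column-off-full : ∀ z → column (suc n) (off z) ≡ A x z
  column-off-full z = trans (cong₂ _+_ (column-off z n′ ℕP.≤-refl) (cong (λ c → if c then A x z else 0ℤ) (joined-last z)))
      (if-split (onLeft z) (A x z))

  column-low : ∀ k {j} → k ℕ.< j → column k (on j) ≡ 0ℤ
  column-low zero    l = refl
  column-low (suc k) l = cong₂ _+_ (column-low k (ℕP.<-trans (ℕP.n<1+n k) l)) (pathEntry-above l)

  column-eq : ∀ j → column (suc j) (on (suc j)) ≡ -1ℤ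
  column-eq j = cong₂ _+_ (column-low j (ℕP.n<1+n j)) (pathEntry-up j)

  column-next : ∀ j → column (2 ℕ.+ j) (on (suc j)) ≡ 1ℤ
  column-next j = cong₂ _+_ (column-eq j) (pathEntry-diag (suc j))

  column-high : ∀ r j → column (3 ℕ.+ (r ℕ.+ j)) (on (suc j)) ≡ 0ℤ
  column-high zero    j = cong₂ _+_ (column-next j) (pathEntry-down (suc j))
  column-high (suc r) j = cong₂ _+_ (column-high r j) (pathEntry-below (ℕ.s≤s (ℕ.s≤s (ℕ.s≤s (ℕP.m≤n+m j r)))))

  column-zero : ∀ r → column (2 ℕ.+ r) (on 0) ≡ 1ℤ
  column-zero zero    = refl
  column-zero (suc r) = cong₂ _+_ (column-zero r) (pathEntry-below (ℕ.s≤s (ℕ.s≤s (ℕ.z≤n {r}))))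

  column-inner : ∀ i → 1 ℕ.≤ i → i ℕ.≤ n′ → column (suc n) (on i) ≡ 0ℤ
  column-inner (suc j) _ l = subst (λ k → column k (on (suc j)) ≡ 0ℤ) (cong (2 ℕ.+_) (trans (sym (ℕP.+-suc (n′ ℕ.∸ suc j) j)) (ℕP.m∸n+n≡m l)))
      (column-high (n′ ℕ.∸ suc j) j)

  Λ-St : ∀ b → Λ (suc n) (St b) ≡ form A x b
  Λ-St b = trans (Λ-column (suc n) ℕP.≤-refl (St b)) (row-sum (column (suc n)) (A x) column-off-full
    (trans (sumℤ-ends n′ (λ i → column (suc n) (on i)) column-inner) (trans (cong₂ _+_ (column-zero n′) (column-next n′)) (sym (diag x)))) b)

  eps : ℕ → Vecℤ (m ℕ.+ n)
  eps zero    v = 0ℤ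
  eps (suc k) = eps k ⊞ simple (path k)

  form-zero : ∀ u → form B u (eps 0) ≡ 0ℤ
  form-zero u = sumℤ-zero {f = λ v → B u v * 0ℤ} (λ v → ℤP.*-zeroʳ (B u v))

  form-eps-suc : ∀ u k → form B u (eps (suc k)) ≡ form B u (eps k) + B u (path k)
  form-eps-suc u k = trans (form-⊞ B u (eps k) (simple (path k))) (cong (_+_ (form B u (eps k))) (form-simple B u (path k)))

  form-path-eps : ∀ i {k} → i ℕ.< k → k ℕ.≤ n → form B (path k) (eps i) ≡ 0ℤ
  form-path-eps zero    {k} l k≤n = form-zero (path k)
  form-path-eps (suc i) {k} l k≤n = trans (form-eps-suc (path k) i) (cong₂ _+_ (form-path-eps i (ℕP.<-trans (ℕP.n<1+n i) l) k≤n)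
    (trans (cong₂ (stEntry A E n) (pl-path k≤n) (pl-path (ℕP.≤-trans (ℕP.≤-trans (ℕP.n≤1+n i) (ℕP.<⇒≤ l)) k≤n))) (pathEntry-below l)))

  form-path-eps-self : ∀ k → suc k ℕ.≤ n → form B (path (suc k)) (eps (suc k)) ≡ -1ℤ
  form-path-eps-self k l = trans (form-eps-suc (path (suc k)) k) (cong₂ _+_ (form-path-eps k (ℕP.n<1+n k) l)
    (trans (cong₂ (stEntry A E n) (pl-path l) (pl-path (ℕP.≤-trans (ℕP.n≤1+n k) l))) (pathEntry-down k)))

  form-base-eps : ∀ {y} → y ≢ x → ∀ j → suc j ℕ.≤ n → form B (base-vertex y) (eps (suc j)) ≡ (if onLeft y then A y x else 0ℤ)
  form-base-eps {y} y≢x zero l = trans (form-eps-suc (base-vertex y) 0) (trans (cong₂ _+_ (form-zero (base-vertex y))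
    (cong₂ (stEntry A E n) (pl-base y≢x) (pl-path ℕ.z≤n))) (ℤP.+-identityˡ (if onLeft y then A y x else 0ℤ)))
  form-base-eps {y} y≢x (suc j) l = trans (form-eps-suc (base-vertex y) (suc j))
      (trans (cong₂ _+_ (form-base-eps y≢x j (ℕP.≤-trans (ℕP.n≤1+n (suc j)) l))
    (trans (cong₂ (stEntry A E n) (pl-base y≢x) (pl-path (ℕP.≤-trans (ℕP.n≤1+n (suc j)) l)))
        (cong (λ c → if c then A y x else 0ℤ) (joined-inner (suc j) y (ℕ.s≤s ℕ.z≤n) (ℕP.≤-pred l)))))
    (ℤP.+-identityʳ (if onLeft y then A y x else 0ℤ)))

  Λ-cong : ∀ k {u v} → u ≈ v → Λ k u ≡ Λ k v
  Λ-cong zero    e = refl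
  Λ-cong (suc k) e = cong₂ _+_ (Λ-cong k e) (form-cong B (path k) e)

  Λ-⊞ : ∀ k u v → Λ k (u ⊞ v) ≡ Λ k u + Λ k v
  Λ-⊞ zero    u v = refl
  Λ-⊞ (suc k) u v = trans (cong₂ _+_ (Λ-⊞ k u v) (form-⊞ B (path k) u v)) (interchange (Λ k u) (Λ k v) (form B (path k) u) (form B (path k) v))

  Λ-⊡ : ∀ k c v → Λ k (c ⊡ v) ≡ c * Λ k v
  Λ-⊡ zero    c v = sym (ℤP.*-zeroʳ c)
  Λ-⊡ (suc k) c v = trans (cong₂ _+_ (Λ-⊡ k c v) (form-⊡ B (path k) c v)) (sym (ℤP.*-distribˡ-+ c (Λ k v) (form B (path k) v)))

  Λ-simple : ∀ k j → k ℕ.≤ suc n → j ℕ.≤ n → Λ k (simple (path j)) ≡ column k (on j)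
  Λ-simple k j l l′ = trans (Λ-column k l (simple (path j))) (trans (sumℤ-simple (λ u → column k (pl u)) (path j)) (cong (column k) (pl-path l′)))

  Λ-eps : ∀ j → suc j ℕ.≤ n → Λ (suc n) (eps (suc j)) ≡ 1ℤ
  Λ-eps zero l = trans (Λ-⊞ (suc n) (eps 0) (simple (path 0))) (cong₂ _+_
      (trans (Λ-cong (suc n) {eps 0} {0ℤ ⊡ eps 0} (ptwise λ v → refl)) (trans (Λ-⊡ (suc n) 0ℤ (eps 0)) refl))
    (trans (Λ-simple (suc n) 0 ℕP.≤-refl ℕ.z≤n) (column-zero n′)))
  Λ-eps (suc j) l = trans (Λ-⊞ (suc n) (eps (suc j)) (simple (path (suc j)))) (cong₂ _+_ (Λ-eps j (ℕP.≤-trans (ℕP.n≤1+n (suc j)) l))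
    (trans (Λ-simple (suc n) (suc j) ℕP.≤-refl (ℕP.≤-trans (ℕP.n≤1+n (suc j)) l)) (column-inner (suc j) (ℕ.s≤s ℕ.z≤n) (ℕP.≤-pred l))))

  path≢base : ∀ {k y} → k ℕ.≤ n → y ≢ x → path k ≢ base-vertex y
  path≢base l y≢x e with trans (sym (pl-path l)) (trans (cong pl e) (pl-base y≢x))
  ... | ()

  path-injective : ∀ {k l} → k ℕ.≤ n → l ℕ.≤ n → path k ≡ path l → k ≡ l
  path-injective p q e = on-injective (trans (sym (pl-path p)) (trans (cong pl e) (pl-path q)))

  eps-base : ∀ k {y} → k ℕ.≤ suc n → y ≢ x → eps k (base-vertex y) ≡ 0ℤ
  eps-base zero    l y≢x = refl
  eps-base (suc k) l y≢x = cong₂ _+_ (eps-base k (ℕP.≤-trans (ℕP.n≤1+n k) l) y≢x) (simple-other (path≢base (ℕP.≤-pred l) y≢x))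

  eps-above : ∀ k {l} → k ℕ.≤ l → l ℕ.≤ n → eps k (path l) ≡ 0ℤ
  eps-above zero    p q = refl
  eps-above (suc k) p q = cong₂ _+_ (eps-above k (ℕP.<⇒≤ p) q) (simple-other (λ e → ℕP.<⇒≢ p (path-injective (ℕP.≤-trans (ℕP.<⇒≤ p) q) q e)))

  eps-below : ∀ k {l} → l ℕ.< k → k ℕ.≤ suc n → eps k (path l) ≡ 1ℤ
  eps-below (suc k) {l} p q with ℕP.m≤n⇒m<n∨m≡n (ℕP.≤-pred p)
  ... | inj₁ l<k = cong₂ _+_ (eps-below k l<k (ℕP.≤-trans (ℕP.n≤1+n k) q))
      (simple-other (λ e → ℕP.<⇒≢ l<k (sym (path-injective (ℕP.≤-pred q) (ℕP.≤-trans (ℕP.<⇒≤ l<k) (ℕP.≤-pred q)) e))))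
  ... | inj₂ refl = cong₂ _+_ (eps-above k ℕP.≤-refl (ℕP.≤-pred q)) (simple-self (path k))

  St-base : ∀ b {y} → y ≢ x → St b (base-vertex y) ≡ b y
  St-base b y≢x = trans (St-at b (base-vertex _)) (cong (stVal b) (pl-base y≢x))

  St-path : ∀ b {k} → k ℕ.≤ n → St b (path k) ≡ b x
  St-path b {k} l = trans (St-at b (path k)) (cong (stVal b) (pl-path l))

  vertex-ind : ∀ {u v} → (∀ y → y ≢ x → u (base-vertex y) ≡ v (base-vertex y)) → (∀ k → k ℕ.≤ n → u (path k) ≡ v (path k)) → u ≈ v
  vertex-ind {u} {v} f g = ptwise λ z → by-view (vertex z)
    where
    by-view : ∀ {z} → Vertex z → u z ≡ v z
    by-view (baseᵥ y p) = f y p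
    by-view (pathᵥ k p) = g k p

  eps-St : eps (suc n) ≈ St (simple x)
  eps-St = vertex-ind (λ y p → trans (eps-base (suc n) ℕP.≤-refl p) (sym (trans (St-base (simple x) p) (simple-other (λ e → p (sym e))))))
    (λ k l → trans (eps-below (suc n) (ℕ.s≤s l) ℕP.≤-refl) (sym (trans (St-path (simple x) l) (simple-self x))))

  simple-St : ∀ {y} → y ≢ x → simple (base-vertex y) ≈ St (simple y)
  simple-St {y} y≢x = vertex-ind (λ z p → trans (by-cases z (y Fin.≟ z)) (sym (St-base (simple y) p)))
    (λ k l → trans (simple-other (λ e → path≢base l y≢x (sym e))) (sym (trans (St-path (simple y) l) (simple-other y≢x))))
    where
    by-cases : ∀ z → Dec (y ≡ z) → simple (base-vertex y) (base-vertex z) ≡ simple y z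
    by-cases z (yes refl) = trans (simple-self (base-vertex y)) (sym (simple-self y))
    by-cases z (no y≢z)   = trans (simple-other (λ e → y≢z (FinP.↑ˡ-injective n y z e))) (sym (simple-other y≢z))

-- Inversions of stretched roots

any-filter : ∀ {X : Set} {P Q : X → Set} (P? : ∀ x → Dec (P x)) → (∀ {x} → Q x → P x) → ∀ {xs} → Any Q xs → Any Q (List.filter P? xs)
any-filter P? h {x ∷ xs} (here q) with P? x
... | yes p = here q
... | no ¬p = ⊥-elim (¬p (h q))
any-filter P? h {x ∷ xs} (there q) with P? x
... | yes p = there (any-filter P? h q)
... | no ¬p = any-filter P? h q

sameFracture-trans : ∀ {N} (η β γ δ : Vecℤ N) → SameFracture η β γ → SameFracture η γ δ → SameFracture η β δ
sameFracture-trans η β γ δ p q f a = (λ b → proj₁ (q f a) (proj₁ (p f a) b)) , λ b → proj₂ (p f a) (proj₂ (q f a) b)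

sameFracture-sym : ∀ {N} (η β γ : Vecℤ N) → SameFracture η β γ → SameFracture η γ β
sameFracture-sym η β γ p f a = proj₂ (p f a) , proj₁ (p f a)

≈⇒sameFracture : ∀ {N} (η : Vecℤ N) {β γ} → β ≈ γ → SameFracture η β γ
≈⇒sameFracture η e f a = (λ b → trans (pair-≈ f (≈-sym e)) b) , λ b → trans (pair-≈ f e) b

⊟-sameFracture : ∀ {N} (η β : Vecℤ N) → SameFracture η (⊟ β) β
⊟-sameFracture η β f a = (λ b → trans (lem (pair f β)) (cong -ℚ_ (trans (sym (pair-⊟ f β)) b))) , λ b → trans (pair-⊟ f β) (cong -ℚ_ b)
  where
  lem : ∀ x → x ≡ -ℚ (-ℚ x)
  lem = RS.solve-∀ ringℚ

module Shapes {m : ℕ} (A : Matrix m) (cartan : IsCartan A) (E : Elastic m) where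
  open Elastic E
  open Cutting A cartan

  zeroᵥ : Vecℤ m
  zeroᵥ z = 0ℤ

  -- The pairing of e_j with the coroot of the block of k. For k ≠ x only x₀ can contribute, since j
  -- ≤ n keeps x_n out of e_j and the inner vertices have no neighbours off the path; so neither j
  -- nor n appears.
  κ′ : ∀ k → Dec (k ≡ x) → ℤ
  κ′ k (yes _) = 1ℤ
  κ′ k (no _)  = if onLeft k then A k x else 0ℤ

  -- The block of k sends e_j + st(g) to e_j + st(aff k g), for e_j = x₀ + ⋯ + x_{j-1} with 1 ≤ j ≤ n.
  aff : Fin m → Vecℤ m → Vecℤ m
  aff k g = s k g ⊞ (- κ′ k (k Fin.≟ x)) ⊡ simple k

  affT : List (Fin m) → Fin m → Vecℤ m → Vecℤ m
  affT []      i g = aff i g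
  affT (k ∷ w) i g = aff k (affT w i (aff k g))

  -- The shift `zeroᵥ` yields e_j, and `⊟ simple x` yields e_j - X, the negative of the root X -
  -- e_j.
  letterShifts : ∀ i → Dec (i ≡ x) → List (Vecℤ m)
  letterShifts i (yes _) = zeroᵥ ∷ (⊟ simple x) ∷ []
  letterShifts i (no _)  = []

  -- The candidates that each block contributes, carried along by the blocks to its left and not yet
  -- tested for being inverted.
  bases shifts : List (Fin m) → Fin m → List (Vecℤ m)
  bases []      i = simple i ∷ []
  bases (k ∷ w) i = simple k ∷ map (s k) (bases w i)
  shifts []      i = letterShifts i (i Fin.≟ x)
  shifts (k ∷ w) i = letterShifts k (k Fin.≟ x) ++ map (aff k) (shifts w i)

  module _ (w : List (Fin m)) (i : Fin m) (α : Vecℤ m) where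

    -- Along the path e_j + st(g) takes both values 1 + g(x) and g(x). Hence it is positive when g
    -- is, and negative when g + αₓ is, whatever j may be. The second alternative of `InvShift`
    -- treats the case in which the negative of e_j + st(g) is the inverted root.
    InvBase InvShift : Vecℤ m → Set
    InvBase  b = Pos b × Neg (t w i b) × NonPar α b
    InvShift g = (Pos g × Neg (affT w i g ⊞ simple x)) ⊎ (Neg (g ⊞ simple x) × Pos (affT w i g))

    invBase? : ∀ b → Dec (InvBase b)
    invBase? b = Pos? b ×-dec (Neg? (t w i b) ×-dec nonPar? α b)

    invShift? : ∀ g → Dec (InvShift g)
    invShift? g = (Pos? g ×-dec Neg? (affT w i g ⊞ simple x)) ⊎-dec (Neg? (g ⊞ simple x) ×-dec Pos? (affT w i g))

    invBases invShifts : List (Vecℤ m)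
    invBases  = List.filter invBase? (bases w i)
    invShifts = List.filter invShift? (shifts w i)

module StInversions {m : ℕ} (A : Matrix m) (cartan : IsCartan A) (E : Elastic m) (n′ : ℕ) where
  open Blocks A cartan E n′ public
  open Shapes A cartan E public
  open IsCartan cartan
  open Elastic E

  ν′ : ∀ k → Dec (k ≡ x) → Vecℤ (m ℕ.+ n) → ℤ
  ν′ k (yes _) v = Λ (suc n) v
  ν′ k (no _)  v = form B (base-vertex k) v

  ν : Fin m → Vecℤ (m ℕ.+ n) → ℤ
  ν k = ν′ k (k Fin.≟ x)

  ν-cong : ∀ k {u v} → u ≈ v → ν k u ≡ ν k v
  ν-cong k e with k Fin.≟ x
  ... | yes _ = Λ-cong (suc n) e
  ... | no _  = form-cong B (base-vertex k) e

  ν-⊞ : ∀ k u v → ν k (u ⊞ v) ≡ ν k u + ν k v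
  ν-⊞ k u v with k Fin.≟ x
  ... | yes _ = Λ-⊞ (suc n) u v
  ... | no _  = form-⊞ B (base-vertex k) u v

  ν-⊡ : ∀ k c v → ν k (c ⊡ v) ≡ c * ν k v
  ν-⊡ k c v with k Fin.≟ x
  ... | yes _ = Λ-⊡ (suc n) c v
  ... | no _  = form-⊡ B (base-vertex k) c v

  ν-St : ∀ k b → ν k (St b) ≡ form A k b
  ν-St k b with k Fin.≟ x
  ... | yes refl = Λ-St b
  ... | no k≢x   = form-base-St k≢x b

  ν-eps : ∀ k j → suc j ℕ.≤ n → ν k (eps (suc j)) ≡ κ′ k (k Fin.≟ x)
  ν-eps k j l with k Fin.≟ x
  ... | yes refl = Λ-eps j l
  ... | no k≢x   = form-base-eps k≢x j l

  block : Fin m → Vecℤ (m ℕ.+ n) → Vecℤ (m ℕ.+ n)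
  block k v = v ⊞ (- ν k v) ⊡ St (simple k)

  block-cong : ∀ k {u v} → u ≈ v → block k u ≈ block k v
  block-cong k e = ptwise λ z → cong₂ (λ a c → a + (- c) * St (simple k) z) (at e z) (ν-cong k e)

  block-⊞ : ∀ k u v → block k (u ⊞ v) ≈ block k u ⊞ block k v
  block-⊞ k u v = ptwise λ z → trans (cong (λ c → u z + v z + (- c) * St (simple k) z) (ν-⊞ k u v))
      (lem (u z) (v z) (ν k u) (ν k v) (St (simple k) z))
    where
    lem : ∀ a b c d s → a + b + (- (c + d)) * s ≡ (a + (- c) * s) + (b + (- d) * s)
    lem = ℤS.solve-∀

  block-⊟ : ∀ k v → block k (⊟ v) ≈ ⊟ block k v
  block-⊟ k v = ptwise λ z → trans (cong (λ c → - v z + (- c) * St (simple k) z) (trans (ν-cong k (⊟-⊡ v)) (ν-⊡ k -1ℤ v)))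
      (lem (v z) (ν k v) (St (simple k) z))
    where
    lem : ∀ a c s → - a + (- (-1ℤ * c)) * s ≡ - (a + (- c) * s)
    lem = ℤS.solve-∀

  block-St : ∀ k b → block k (St b) ≈ St (𝔸.s k b)
  block-St k b = ≈-sym (≈-trans (St-cong (𝔸.s-expand k b)) (≈-trans (St-⊞ b ((- form A k b) ⊡ simple k))
    (ptwise λ z → cong (_+_ (St b z)) (trans (at (St-⊡ (- form A k b) (simple k)) z) (cong (λ c → (- c) * St (simple k) z) (sym (ν-St k b)))))))

  -- Indices start from zero: `Shifted j g` is e_{j+1} + st(g), and the condition `suc j ≤ n` says
  -- that its prefix of the path is a proper one.
  Shifted : ℕ → Vecℤ m → Vecℤ (m ℕ.+ n)
  Shifted j g = eps (suc j) ⊞ St g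

  block-Shifted : ∀ k j g → suc j ℕ.≤ n → block k (Shifted j g) ≈ Shifted j (aff k g)
  block-Shifted k j g l = ≈-trans (block-⊞ k (eps (suc j)) (St g)) (ptwise λ z → trans
    (cong₂ (λ c a → eps (suc j) z + (- c) * St (simple k) z + a) (ν-eps k j l) (at (block-St k g) z))
    (trans (lem (eps (suc j) z) (κ′ k (k Fin.≟ x)) (St (simple k) z) (St (𝔸.s k g) z))
      (cong (_+_ (eps (suc j) z)) (sym (trans (at (St-⊞ (𝔸.s k g) ((- κ′ k (k Fin.≟ x)) ⊡ simple k)) z)
        (cong (_+_ (St (𝔸.s k g) z)) (at (St-⊡ (- κ′ k (k Fin.≟ x)) (simple k)) z)))))))
    where
    lem : ∀ e c s a → e + (- c) * s + a ≡ e + (a + (- c) * s)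
    lem = ℤS.solve-∀

  block-invol : ∀ k v → block k (block k v) ≈ v
  block-invol k v = ptwise λ z → trans (cong (λ c → v z + (- ν k v) * St (simple k) z + (- c) * St (simple k) z) value)
      (lem (v z) (ν k v) (St (simple k) z))
    where
    lem : ∀ a c s → a + (- c) * s + (- (- c)) * s ≡ a
    lem = ℤS.solve-∀
    value : ν k (block k v) ≡ - ν k v
    value = trans (ν-⊞ k v ((- ν k v) ⊡ St (simple k))) (trans (cong (_+_ (ν k v)) (trans (ν-⊡ k (- ν k v) (St (simple k)))
      (cong ((- ν k v) *_) (trans (ν-St k (simple k)) (trans (form-simple A k k) (diag k)))))) (lem′ (ν k v)))
      where
      lem′ : ∀ c → c + (- c) * + 2 ≡ - c
      lem′ = ℤS.solve-∀

  -- s_{x_k} ⋯ s_{x_1}(x₀) = x₀ + ⋯ + x_k.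
  W : ℕ → List V
  W zero    = []
  W (suc k) = path (suc k) ∷ W k

  root-W : ∀ k → k ℕ.≤ n → 𝔹.root (W k) (path 0) ≈ eps (suc k)
  root-W zero    l = ptwise λ z → sym (ℤP.+-identityˡ (simple (path 0) z))
  root-W (suc k) l = ≈-trans (𝔹.s-cong (path (suc k)) (root-W k (ℕP.≤-trans (ℕP.n≤1+n k) l)))
    (ptwise λ z → trans (𝔹.s-by (path (suc k)) (eps (suc k)) (form-path-eps-self k l) z) (lem (eps (suc k) z) (simple (path (suc k)) z)))
    where
    lem : ∀ e a → e - -1ℤ * a ≡ e + a
    lem = ℤS.solve-∀

  μ-W : ∀ k → k ℕ.≤ n → ∀ v → 𝔹.μ (W k) (path 0) v ≡ Λ (suc k) v
  μ-W zero    l v = sym (ℤP.+-identityˡ (form B (path 0) v))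
  μ-W (suc k) l v = trans (μ-W k l′ (𝔹.s (path (suc k)) v)) (trans (Λ-cong (suc k) (𝔹.s-expand (path (suc k)) v))
    (trans (Λ-⊞ (suc k) v ((- form B (path (suc k)) v) ⊡ simple (path (suc k))))
        (cong (_+_ (Λ (suc k) v)) (trans (Λ-⊡ (suc k) (- form B (path (suc k)) v) (simple (path (suc k))))
      (trans (cong ((- form B (path (suc k)) v) *_) (trans (Λ-simple (suc k) (suc k) (ℕP.≤-trans l (ℕP.n≤1+n n)) l) (column-eq k)))
          (lem (form B (path (suc k)) v)))))))
    where
    l′ : k ℕ.≤ n
    l′ = ℕP.≤-trans (ℕP.n≤1+n k) l
    lem : ∀ f → (- f) * -1ℤ ≡ f
    lem = ℤS.solve-∀

  prefix-W : ∀ k → k ℕ.≤ n → ∀ {p v r} → W k ≡ p ++ v ∷ r → Σ ℕ λ j → suc j ℕ.≤ k × (𝔹.root p v ≈ eps (suc k) ⊞ ⊟ eps (suc j))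
  prefix-W zero    l {[]} ()
  prefix-W zero    l {_ ∷ _} ()
  prefix-W (suc k) l {[]} refl = k , ℕP.≤-refl , ptwise λ z → lem (eps (suc k) z) (simple (path (suc k)) z)
    where
    lem : ∀ e a → a ≡ e + a + - e
    lem = ℤS.solve-∀
  prefix-W (suc k) l {a ∷ p} {v} eq with ListP.∷-injective eq
  ... | refl , eq′ with prefix-W k (ℕP.≤-trans (ℕP.n≤1+n k) l) {p} eq′
  ...   | j , lj , e = j , ℕP.≤-trans lj (ℕP.n≤1+n k) , ≈-trans (𝔹.s-cong (path (suc k)) e)
      (ptwise λ z → trans (𝔹.s-by (path (suc k)) (eps (suc k) ⊞ ⊟ eps (suc j)) value z)
          (lem (eps (suc k) z) (eps (suc j) z) (simple (path (suc k)) z)))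
    where
    lem : ∀ e d a → e + - d - -1ℤ * a ≡ e + a + - d
    lem = ℤS.solve-∀
    value : form B (path (suc k)) (eps (suc k) ⊞ ⊟ eps (suc j)) ≡ -1ℤ
    value = trans (form-⊞ B (path (suc k)) (eps (suc k)) (⊟ eps (suc j))) (cong₂ _+_ (form-path-eps-self k l)
      (trans (form-cong B (path (suc k)) (⊟-⊡ (eps (suc j)))) (trans (form-⊡ B (path (suc k)) -1ℤ (eps (suc j)))
          (cong (-1ℤ *_) (form-path-eps (suc j) (ℕ.s≤s lj) l)))))

  t-W : ∀ v → 𝔹.t (W n) (path 0) v ≈ v ⊞ (- Λ (suc n) v) ⊡ St (simple x)
  t-W v = ≈-trans (𝔹.t-formula (W n) (path 0) v) (ptwise λ z → cong₂ (λ c a → v z + (- c) * a) (μ-W n ℕP.≤-refl v)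
      (trans (at (root-W n ℕP.≤-refl) z) (at eps-St z)))

  t-act : ∀ w i v → 𝔹.t w i v ≡ 𝔹.act w (𝔹.s i (𝔹.act (reverse w) v))
  t-act []      i v = refl
  t-act (k ∷ w) i v = cong (𝔹.s k) (trans (t-act w i (𝔹.s k v)) (cong (λ u → 𝔹.act w (𝔹.s i u)) (sym (𝔹.act-reverse-∷ k w v))))

  word′ : ∀ k → Dec (k ≡ x) → List V
  word′ k (yes _) = W n ++ path 0 ∷ reverse (W n)
  word′ k (no _)  = base-vertex k ∷ []

  word : Fin m → List V
  word k = word′ k (k Fin.≟ x)

  act-word : ∀ k v → 𝔹.act (word k) v ≈ block k v
  act-word k v with k Fin.≟ x
  ... | yes refl = ≈-trans (≈-reflexive (trans (𝔹.act-++ (W n) (path 0 ∷ reverse (W n)) v) (sym (t-act (W n) (path 0) v)))) (t-W v)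
  ... | no k≢x   = ≈-trans (𝔹.s-expand (base-vertex k) v) (shift-cong v (- form B (base-vertex k) v) (simple-St k≢x))

  act-reverse-word : ∀ k v → 𝔹.act (reverse (word k)) v ≈ block k v
  act-reverse-word k v = ≈-trans (𝔹.act-cong (reverse (word k)) (≈-sym (≈-trans (act-word k (block k v)) (block-invol k v))))
      (𝔹.act-reverseˡ (word k) (block k v))

  block-root : ∀ k {v} → 𝔹.Root v → 𝔹.Root (block k v)
  block-root k (w , i , e) = word k ++ w , i , ≈-trans (≈-reflexive (𝔹.act-++ (word k) w (simple i))) (≈-trans (𝔹.act-cong (word k) e) (act-word k _))

  lastWord′ : ∀ i → Dec (i ≡ x) → List V
  lastWord′ i (yes _) = W n
  lastWord′ i (no _)  = []

  lastLetter : ∀ i → Dec (i ≡ x) → V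
  lastLetter i (yes _) = path 0
  lastLetter i (no _)  = base-vertex i

  -- Each letter becomes its block. The final index x becomes `W n` together with the letter x₀,
  -- since `W n` carries x₀ to X.
  expand : List (Fin m) → Fin m → List V
  expand []      i = lastWord′ i (i Fin.≟ x)
  expand (k ∷ w) i = word k ++ expand w i

  letter : Fin m → V
  letter i = lastLetter i (i Fin.≟ x)

  root-expand : ∀ w i → 𝔹.root (expand w i) (letter i) ≈ St (𝔸.root w i)
  root-expand [] i with i Fin.≟ x
  ... | yes refl = ≈-trans (root-W n ℕP.≤-refl) eps-St
  ... | no i≢x   = simple-St i≢x
  root-expand (k ∷ w) i = ≈-trans (≈-reflexive (𝔹.act-++ (word k) (expand w i) (simple (letter i)))) (≈-trans (𝔹.act-cong (word k) (root-expand w i))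
    (≈-trans (act-word k (St (𝔸.root w i))) (block-St k (𝔸.root w i))))

  T : List (Fin m) → Fin m → Vecℤ (m ℕ.+ n) → Vecℤ (m ℕ.+ n)
  T []      i v = block i v
  T (k ∷ w) i v = block k (T w i (block k v))

  t-++ : ∀ u w i v → 𝔹.t (u ++ w) i v ≡ 𝔹.act u (𝔹.t w i (𝔹.act (reverse u) v))
  t-++ []      w i v = refl
  t-++ (k ∷ u) w i v = cong (𝔹.s k) (trans (t-++ u w i (𝔹.s k v)) (cong (λ a → 𝔹.act u (𝔹.t w i a)) (sym (𝔹.act-reverse-∷ k u v))))

  t-expand : ∀ w i v → 𝔹.t (expand w i) (letter i) v ≈ T w i v
  t-expand [] i v with i Fin.≟ x
  ... | yes refl = t-W v
  ... | no i≢x   = ≈-trans (𝔹.s-expand (base-vertex i) v) (shift-cong v (- form B (base-vertex i) v) (simple-St i≢x))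
  t-expand (k ∷ w) i v = ≈-trans (≈-reflexive (t-++ (word k) (expand w i) (letter i) v))
      (≈-trans (act-word k (𝔹.t (expand w i) (letter i) (𝔹.act (reverse (word k)) v)))
    (block-cong k (≈-trans (𝔹.t-cong (expand w i) (letter i) (act-reverse-word k v)) (t-expand w i (block k v)))))

  T-cong : ∀ w i {u v} → u ≈ v → T w i u ≈ T w i v
  T-cong []      i e = block-cong i e
  T-cong (k ∷ w) i e = block-cong k (T-cong w i (block-cong k e))

  T-St : ∀ w i b → T w i (St b) ≈ St (𝔸.t w i b)
  T-St []      i b = block-St i b
  T-St (k ∷ w) i b = ≈-trans (block-cong k (≈-trans (T-cong w i (block-St k b)) (T-St w i (𝔸.s k b)))) (block-St k (𝔸.t w i (𝔸.s k b)))

module StShapes {m : ℕ} (A : Matrix m) (cartan : IsCartan A) (E : Elastic m) (n′ : ℕ) where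
  open StInversions A cartan E n′ public
  open Elastic E

  ShiftShape : List (Vecℤ m) → Vecℤ (m ℕ.+ n) → Set
  ShiftShape gs δ = Σ ℕ λ j → suc j ℕ.≤ n × Any (λ g → δ ≈ Shifted j g ⊎ δ ≈ ⊟ Shifted j g) gs

  Shape : List (Vecℤ m) → List (Vecℤ m) → Vecℤ (m ℕ.+ n) → Set
  Shape bs gs δ = Any (λ b → δ ≈ St b) bs ⊎ ShiftShape gs δ

  Shape-≈ : ∀ {bs gs δ δ′} → δ ≈ δ′ → Shape bs gs δ → Shape bs gs δ′
  Shape-≈ e (inj₁ a) = inj₁ (Any.map (≈-trans (≈-sym e)) a)
  Shape-≈ e (inj₂ (j , l , a)) = inj₂ (j , l , Any.map [ (λ f → inj₁ (≈-trans (≈-sym e) f)) , (λ f → inj₂ (≈-trans (≈-sym e) f)) ]′ a)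

  Letter : Fin m → Vecℤ (m ℕ.+ n) → Set
  Letter k = Shape (simple k ∷ []) (letterShifts k (k Fin.≟ x))

  Shifted-cong : ∀ j {g h} → g ≈ h → Shifted j g ≈ Shifted j h
  Shifted-cong j e = ptwise λ z → cong (_+_ (eps (suc j) z)) (at (St-cong e) z)

  block-Shifted-⊟ : ∀ k j g {h} → suc j ℕ.≤ n → aff k g ≈ h → ∀ {δ} → δ ≈ Shifted j g ⊎ δ ≈ ⊟ Shifted j g →
      block k δ ≈ Shifted j h ⊎ block k δ ≈ ⊟ Shifted j h
  block-Shifted-⊟ k j g l e (inj₁ f) = inj₁ (≈-trans (block-cong k f) (≈-trans (block-Shifted k j g l) (Shifted-cong j e)))
  block-Shifted-⊟ k j g l e (inj₂ f) = inj₂ (≈-trans (block-cong k f)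
      (≈-trans (block-⊟ k (Shifted j g)) (⊟-cong (≈-trans (block-Shifted k j g l) (Shifted-cong j e)))))

  ⊟-either : ∀ {N} {δ v : Vecℤ N} → δ ≈ v ⊎ δ ≈ ⊟ v → ⊟ δ ≈ v ⊎ ⊟ δ ≈ ⊟ v
  ⊟-either (inj₁ e) = inj₂ (⊟-cong e)
  ⊟-either {v = v} (inj₂ e) = inj₁ (≈-trans (⊟-cong e) (⊟-invol v))

  aff-zero : aff x zeroᵥ ≈ ⊟ simple x
  aff-zero with x Fin.≟ x
  ... | no ¬e = ⊥-elim (¬e refl)
  ... | yes _ = ptwise λ z → trans (cong (λ c → 0ℤ - c * simple x z + (- 1ℤ) * simple x z)
      (sumℤ-zero {f = λ j → A x j * 0ℤ} (λ j → ℤP.*-zeroʳ (A x j)))) (lem (simple x z))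
    where
    lem : ∀ s → 0ℤ - 0ℤ * s + (- 1ℤ) * s ≡ - s
    lem = ℤS.solve-∀

  aff-simple : aff x (⊟ simple x) ≈ zeroᵥ
  aff-simple with x Fin.≟ x
  ... | no ¬e = ⊥-elim (¬e refl)
  ... | yes _ = ptwise λ z → trans (cong (_+ (- 1ℤ) * simple x z) (trans (at (𝔸.act-⊟ (x ∷ []) (simple x)) z) (cong -_ (at (𝔸.s-self x) z))))
      (lem (simple x z))
    where
    lem : ∀ s → - (- s) + (- 1ℤ) * s ≡ 0ℤ
    lem = ℤS.solve-∀

  block-x : ∀ v → 𝔹.t (W n) (path 0) v ≈ block x v
  block-x v = ≈-trans (t-W v) (by-cases (x Fin.≟ x))
    where
    by-cases : (d : Dec (x ≡ x)) → v ⊞ (- Λ (suc n) v) ⊡ St (simple x) ≈ v ⊞ (- ν′ x d v) ⊡ St (simple x)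
    by-cases (yes _) = ≈-refl
    by-cases (no ¬e) = ⊥-elim (¬e refl)

  complement : ∀ j → eps (suc n) ⊞ ⊟ eps (suc j) ≈ ⊟ Shifted j (⊟ simple x)
  complement j = ptwise λ z → trans (cong (_+ - eps (suc j) z) (at eps-St z)) (trans (lem (St (simple x) z) (eps (suc j) z))
    (cong (λ a → - (eps (suc j) z + a)) (sym (trans (at (St-cong (⊟-⊡ (simple x))) z) (at (St-⊡ -1ℤ (simple x)) z)))))
    where
    lem : ∀ a e → a + - e ≡ - (e + -1ℤ * a)
    lem = ℤS.solve-∀

  -- The prefix roots of `W n` are the X - e_{j+1}. Either δ is one of them, or its partner is, and
  -- then applying the block of x once more shows δ = e_{j+1}.
  letter-x : ∀ {δ} → 𝔹.Root δ → Pos δ → Neg (block x δ) → Any (λ b → δ ≈ St b) (simple x ∷ []) ⊎ ShiftShape (zeroᵥ ∷ (⊟ simple x) ∷ []) δ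
  letter-x {δ} r p q = by-side (𝔹.inversion (W n) (path 0) r p (Neg-≈ (≈-sym (block-x δ)) q))
    where
    by-root : ∀ {j v} → suc j ℕ.≤ n → v ≈ ⊟ Shifted j (⊟ simple x) → v ≈ δ ⊎ v ≈ ⊟ 𝔹.t (W n) (path 0) δ →
              Any (λ g → δ ≈ Shifted j g ⊎ δ ≈ ⊟ Shifted j g) (zeroᵥ ∷ (⊟ simple x) ∷ [])
    by-root l f (inj₁ e) = there (here (inj₂ (≈-trans (≈-sym e) f)))
    by-root {j} l f (inj₂ e) = here (inj₁ (≈-trans (≈-sym (block-invol x δ))
        (≈-trans (block-cong x image) (≈-trans (block-Shifted x j (⊟ simple x) l) (Shifted-cong j aff-simple)))))
      where
      negated : ⊟ block x δ ≈ ⊟ Shifted j (⊟ simple x)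
      negated = ≈-trans (⊟-cong (≈-sym (block-x δ))) (≈-trans (≈-sym e) f)
      image : block x δ ≈ Shifted j (⊟ simple x)
      image = ≈-trans (≈-sym (⊟-invol (block x δ))) (≈-trans (⊟-cong negated) (⊟-invol (Shifted j (⊟ simple x))))
    by-side : δ ≈ 𝔹.root (W n) (path 0) ⊎ (Σ (List V) λ u → Σ V λ k → Σ (List V) λ r → W n ≡ u ++ k ∷ r ×
        (𝔹.root u k ≈ δ ⊎ 𝔹.root u k ≈ ⊟ 𝔹.t (W n) (path 0) δ)) →
              Any (λ b → δ ≈ St b) (simple x ∷ []) ⊎ ShiftShape (zeroᵥ ∷ (⊟ simple x) ∷ []) δ
    by-side (inj₁ e) = inj₁ (here (≈-trans e (≈-trans (root-W n ℕP.≤-refl) eps-St)))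
    by-side (inj₂ (u , k , r , eq , e)) = let (j , l , f) = prefix-W n ℕP.≤-refl {u} {k} {r} eq in inj₂ (j , l , by-root l (≈-trans f (complement j)) e)

  letter-inversion : ∀ k {δ} → 𝔹.Root δ → Pos δ → Neg (block k δ) → Letter k δ
  letter-inversion k {δ} r p q = by-cases (k Fin.≟ x)
    where
    by-cases : (d : Dec (k ≡ x)) → Shape (simple k ∷ []) (letterShifts k d) δ
    by-cases (yes refl) = letter-x r p q
    by-cases (no k≢x)   = inj₁ (here (≈-trans (𝔹.only-simple (base-vertex k) r p (Neg-≈ (≈-sym plain) q)) (simple-St k≢x)))
      where
      plain : 𝔹.s (base-vertex k) δ ≈ block k δ
      plain with k Fin.≟ x
      ... | yes e = ⊥-elim (k≢x e)
      ... | no _  = ≈-trans (𝔹.s-expand (base-vertex k) δ) (shift-cong δ (- form B (base-vertex k) δ) (simple-St k≢x))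

  letter-partner : ∀ k {δ} → Letter k δ → Letter k (⊟ block k δ)
  letter-partner k (inj₁ (here e)) = inj₁ (here (≈-trans (⊟-cong (≈-trans (block-cong k e) (block-St k (simple k))))
    (≈-trans (⊟-cong (St-cong (𝔸.s-self k))) (≈-trans (⊟-cong
        (≈-trans (St-cong (⊟-⊡ (simple k))) (≈-trans (St-⊡ -1ℤ (simple k)) (≈-sym (⊟-⊡ (St (simple k))))))) (⊟-invol (St (simple k)))))))
  letter-partner k {δ} (inj₂ (j , l , a)) = inj₂ (j , l , by-cases (k Fin.≟ x) a)
    where
    by-cases : (d : Dec (k ≡ x)) → Any (λ g → δ ≈ Shifted j g ⊎ δ ≈ ⊟ Shifted j g) (letterShifts k d) → Any
        (λ g → ⊟ block k δ ≈ Shifted j g ⊎ ⊟ block k δ ≈ ⊟ Shifted j g) (letterShifts k d)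
    by-cases (yes refl) (here e)         = there (here (⊟-either (block-Shifted-⊟ x j zeroᵥ l aff-zero e)))
    by-cases (yes refl) (there (here e)) = here (⊟-either (block-Shifted-⊟ x j (⊟ simple x) l aff-simple e))

  Shape-∷ : ∀ k {bs gs δ} → Shape bs gs (block k δ) → Shape (simple k ∷ map (𝔸.s k) bs) (letterShifts k (k Fin.≟ x) ++ map (aff k) gs) δ
  Shape-∷ k {δ = δ} (inj₁ a) = inj₁ (there (AnyP.map⁺ (Any.map
      (λ {b} e → ≈-trans (≈-sym (block-invol k δ)) (≈-trans (block-cong k e) (block-St k b))) a)))
  Shape-∷ k {δ = δ} (inj₂ (j , l , a)) = inj₂ (j , l , AnyP.++⁺ʳ (letterShifts k (k Fin.≟ x)) (AnyP.map⁺ (Any.map (λ {g} e →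
    [ (λ f → inj₁ (≈-trans (≈-sym (block-invol k δ)) f)) , (λ f → inj₂ (≈-trans (≈-sym (block-invol k δ)) f)) ]′
        (block-Shifted-⊟ k j g l ≈-refl e)) a)))

  Letter-∷ : ∀ k {bs gs δ} → Letter k δ → Shape (simple k ∷ map (𝔸.s k) bs) (letterShifts k (k Fin.≟ x) ++ map (aff k) gs) δ
  Letter-∷ k (inj₁ (here e)) = inj₁ (here e)
  Letter-∷ k (inj₂ (j , l , a)) = inj₂ (j , l , AnyP.++⁺ˡ a)

  T-root : ∀ w i {δ} → 𝔹.Root δ → 𝔹.Root (T w i δ)
  T-root []      i r = block-root i r
  T-root (k ∷ w) i r = block-root k (T-root w i (block-root k r))

  -- The argument of `inversion` with blocks in place of letters. The sign changes within one block,
  -- where `letter-inversion` lists the possible roots.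
  shape : ∀ w i {δ} → 𝔹.Root δ → Pos δ → Neg (T w i δ) → Shape (bases w i) (shifts w i) δ ⊎ Shape (bases w i) (shifts w i) (⊟ T w i δ)
  shape [] i r p q = inj₁ (letter-inversion i r p q)
  shape (k ∷ w) i {δ} r p q with 𝔹.root-sign (block-root k r)
  ... | inj₂ n₁ = inj₁ (Letter-∷ k (letter-inversion k r p n₁))
  ... | inj₁ p₁ with 𝔹.root-sign (T-root w i (block-root k r))
  ...   | inj₁ p₂ = inj₂ (Letter-∷ k (letter-partner k (letter-inversion k (T-root w i (block-root k r)) p₂ q)))
  ...   | inj₂ n₂ with shape w i (block-root k r) p₁ n₂
  ...     | inj₁ h = inj₁ (Shape-∷ k h)
  ...     | inj₂ h = inj₂ (Shape-∷ k (Shape-≈ (≈-sym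
      (≈-trans (block-⊟ k (block k (T w i (block k δ)))) (⊟-cong (block-invol k (T w i (block k δ)))))) h))

  simple-root : ∀ k → 𝔹.Root (St (simple k))
  simple-root k = by-cases (k Fin.≟ x)
    where
    by-cases : Dec (k ≡ x) → 𝔹.Root (St (simple k))
    by-cases (yes refl) = W n , path 0 , ≈-trans (root-W n ℕP.≤-refl) eps-St
    by-cases (no k≢x)   = [] , base-vertex k , simple-St k≢x

  bases-root : ∀ w i → All (λ b → 𝔹.Root (St b)) (bases w i)
  bases-root []      i = simple-root i ∷ []
  bases-root (k ∷ w) i = simple-root k ∷ AllP.map⁺ (All.map (λ {b} r → 𝔹.root-≈ (block-St k b) (block-root k r)) (bases-root w i))

  T-⊟ : ∀ w i v → T w i (⊟ v) ≈ ⊟ T w i v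
  T-⊟ []      i v = block-⊟ i v
  T-⊟ (k ∷ w) i v = ≈-trans (block-cong k (≈-trans (T-cong w i (block-⊟ k v)) (T-⊟ w i (block k v)))) (block-⊟ k (T w i (block k v)))

  T-invol : ∀ w i v → T w i (⊟ T w i v) ≈ ⊟ v
  T-invol []      i v = ≈-trans (block-⊟ i (block i v)) (⊟-cong (block-invol i v))
  T-invol (k ∷ w) i v = ≈-trans (block-cong k (≈-trans
      (T-cong w i (≈-trans (block-⊟ k (block k (T w i (block k v)))) (⊟-cong (block-invol k (T w i (block k v)))))) (T-invol w i (block k v))))
    (≈-trans (block-⊟ k (block k v)) (⊟-cong (block-invol k v)))

-- Fractures of a stretched root

module StFractures {m : ℕ} (A : Matrix m) (cartan : IsCartan A) (E : Elastic m) (n′ : ℕ) where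
  open StShapes A cartan E n′ public
  open Elastic E

  module _ (j : ℕ) (l : suc j ℕ.≤ n) where

    letterShifts-root : ∀ k d → All (λ g → 𝔹.Root (Shifted j g)) (letterShifts k d)
    letterShifts-root k (no _)  = []
    letterShifts-root k (yes _) = first ∷ 𝔹.root-≈ (≈-trans (block-Shifted x j zeroᵥ l) (Shifted-cong j aff-zero)) (block-root x first) ∷ []
      where
      first : 𝔹.Root (Shifted j zeroᵥ)
      first = W j , path 0 , ≈-trans (root-W j (ℕP.≤-trans (ℕP.n≤1+n j) l)) (ptwise λ z → trans (sym (ℤP.+-identityʳ (eps (suc j) z)))
        (cong (_+_ (eps (suc j) z)) (sym (trans (at (St-cong {zeroᵥ} {0ℤ ⊡ zeroᵥ} (ptwise λ _ → refl)) z) (at (St-⊡ 0ℤ zeroᵥ) z)))))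

    shifts-root : ∀ w i → All (λ g → 𝔹.Root (Shifted j g)) (shifts w i)
    shifts-root []      i = letterShifts-root i (i Fin.≟ x)
    shifts-root (k ∷ w) i = AllP.++⁺ (letterShifts-root k (k Fin.≟ x)) (AllP.map⁺
        (All.map (λ {g} r → 𝔹.root-≈ (block-Shifted k j g l) (block-root k r)) (shifts-root w i)))

    T-Shifted : ∀ w i g → T w i (Shifted j g) ≈ Shifted j (affT w i g)
    T-Shifted []      i g = block-Shifted i j g l
    T-Shifted (k ∷ w) i g = ≈-trans (block-cong k (≈-trans (T-cong w i (block-Shifted k j g l)) (T-Shifted w i (aff k g))))
        (block-Shifted k j (affT w i (aff k g)) l)

    at-base : ∀ g {y} → y ≢ x → Shifted j g (base-vertex y) ≡ g y
    at-base g {y} y≢x = trans (cong₂ _+_ (eps-base (suc j) (ℕP.≤-trans l (ℕP.n≤1+n n)) y≢x) (St-base g y≢x)) (ℤP.+-identityˡ (g y))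

    at-below : ∀ g {k} → k ℕ.< suc j → k ℕ.≤ n → Shifted j g (path k) ≡ 1ℤ + g x
    at-below g k<j k≤n = cong₂ _+_ (eps-below (suc j) k<j (ℕP.≤-trans l (ℕP.n≤1+n n))) (St-path g k≤n)

    at-above : ∀ g {k} → suc j ℕ.≤ k → k ℕ.≤ n → Shifted j g (path k) ≡ g x
    at-above g j<k k≤n = trans (cong₂ _+_ (eps-above (suc j) j<k k≤n) (St-path g k≤n)) (ℤP.+-identityˡ (g x))

    vertex-all : ∀ {P : ℤ → Set} g → (∀ y → y ≢ x → P (g y)) → P (1ℤ + g x) → P (g x) → ∀ v → P (Shifted j g v)
    vertex-all {P} g f a b v = by-view (vertex v)
      where
      by-view : ∀ {v} → Vertex v → P (Shifted j g v)
      by-view (baseᵥ y y≢x) = subst P (sym (at-base g y≢x)) (f y y≢x)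
      by-view (pathᵥ k k≤n) with k ℕP.<? suc j
      ... | yes k<j = subst P (sym (at-below g k<j k≤n)) a
      ... | no k≮j  = subst P (sym (at-above g (ℕP.≮⇒≥ k≮j) k≤n)) b

    -- Both path values are attained: 1 + g(x) at x₀ and g(x) at x_n, because e_{j+1} contains x₀
    -- but not x_n.
    vertex-all⁻ : ∀ {P : ℤ → Set} g → (∀ v → P (Shifted j g v)) → (∀ y → y ≢ x → P (g y)) × P (1ℤ + g x) × P (g x)
    vertex-all⁻ {P} g h = (λ y y≢x → subst P (at-base g y≢x) (h (base-vertex y))) , subst P (at-below g (ℕ.s≤s ℕ.z≤n) ℕ.z≤n) (h (path 0)) , subst P
        (at-above g l ℕP.≤-refl) (h (path n))

    Shifted-Pos : ∀ g → Pos g → Pos (Shifted j g)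
    Shifted-Pos g p = vertex-all {0ℤ ≤_} g (λ y _ → p y) (+-nonneg (ℤ.+≤+ ℕ.z≤n) (p x)) (p x)

    Shifted-Pos⁻ : ∀ g → Pos (Shifted j g) → Pos g
    Shifted-Pos⁻ g p y with y Fin.≟ x | vertex-all⁻ {0ℤ ≤_} g p
    ... | yes refl | _ , _ , b = b
    ... | no y≢x   | f , _ , _ = f y y≢x

    Shifted-Neg : ∀ g → Neg (g ⊞ simple x) → Neg (Shifted j g)
    Shifted-Neg g q = vertex-all {_≤ 0ℤ} g
      (λ y y≢x → subst (_≤ 0ℤ) (trans (cong (_+_ (g y)) (simple-other (λ e → y≢x (sym e)))) (ℤP.+-identityʳ (g y))) (q y)) top
      (ℤP.≤-trans (≤-by 1ℤ (ℤ.+≤+ ℕ.z≤n) (ℤP.+-comm 1ℤ (g x))) top)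
      where
      top : 1ℤ + g x ≤ 0ℤ
      top = subst (_≤ 0ℤ) (trans (cong (_+_ (g x)) (simple-self x)) (ℤP.+-comm (g x) 1ℤ)) (q x)

    Shifted-Neg⁻ : ∀ g → Neg (Shifted j g) → Neg (g ⊞ simple x)
    Shifted-Neg⁻ g q y = by-cases (y Fin.≟ x) (vertex-all⁻ {_≤ 0ℤ} g q)
      where
      by-cases : Dec (y ≡ x) → (∀ y → y ≢ x → g y ≤ 0ℤ) × 1ℤ + g x ≤ 0ℤ × g x ≤ 0ℤ → g y + simple x y ≤ 0ℤ
      by-cases (yes refl) (_ , a , _) = subst (_≤ 0ℤ) (sym (trans (cong (_+_ (g x)) (simple-self x)) (ℤP.+-comm (g x) 1ℤ))) a
      by-cases (no y≢x) (f , _ , _) = subst (_≤ 0ℤ) (sym (trans (cong (_+_ (g y)) (simple-other (λ e → y≢x (sym e)))) (ℤP.+-identityʳ (g y))))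
          (f y y≢x)

    -- The values of e_j + st(g) at x₀ and x_n differ by 1, those of st(α) agree.
    Shifted-nonPar : ∀ {α} g → (Σ (Fin m) λ y → α y ≢ 0ℤ) → NonPar (St α) (Shifted j g)
    Shifted-nonPar {α} g (y , αy≢0) = by-minor (minor (St α) (Shifted j g) u (path n) ℤP.≟ 0ℤ)
      where
      u : V
      u = base-vertex y
      Stu : St α u ≡ α y
      Stu = by-cases (y Fin.≟ x)
        where
        by-cases : Dec (y ≡ x) → St α u ≡ α y
        by-cases (yes refl) = St-path α ℕ.z≤n
        by-cases (no y≢x)   = St-base α y≢x
      lem : ∀ a c g d → a * (1ℤ + g) - c * d ≡ a + (a * g - c * d)
      lem = ℤS.solve-∀
      first : minor (St α) (Shifted j g) u (path 0) ≡ α y + (α y * g x - α x * Shifted j g u)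
      first = trans (cong₂ _-_ (cong₂ _*_ Stu (at-below g (ℕ.s≤s ℕ.z≤n) ℕ.z≤n)) (cong (_* Shifted j g u) (St-path α ℕ.z≤n)))
          (lem (α y) (α x) (g x) (Shifted j g u))
      last : minor (St α) (Shifted j g) u (path n) ≡ α y * g x - α x * Shifted j g u
      last = cong₂ _-_ (cong₂ _*_ Stu (at-above g l ℕP.≤-refl)) (cong (_* Shifted j g u) (St-path α ℕP.≤-refl))
      by-minor : Dec (minor (St α) (Shifted j g) u (path n) ≡ 0ℤ) → NonPar (St α) (Shifted j g)
      by-minor (no h)  = nonpar u (path n) h
      by-minor (yes h) = nonpar u (path 0) λ e → αy≢0 (trans (sym (ℤP.+-identityʳ (α y)))
          (trans (cong (_+_ (α y)) (trans (sym h) last)) (trans (sym first) e)))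

  St-at-base : ∀ b y → St b (base-vertex y) ≡ b y
  St-at-base b y = by-cases (y Fin.≟ x)
    where
    by-cases : Dec (y ≡ x) → St b (base-vertex y) ≡ b y
    by-cases (yes refl) = St-path b ℕ.z≤n
    by-cases (no y≢x)   = St-base b y≢x

  proj : Place m → Fin m
  proj (off y) = y
  proj (on _)  = x

  St-proj : ∀ b v → St b v ≡ b (proj (pl v))
  St-proj b v = trans (St-at b v) (val (pl v))
    where
    val : ∀ P → stVal b P ≡ b (proj P)
    val (off y) = refl
    val (on i)  = refl

  St-all : ∀ {P : ℤ → Set} b → (∀ y → P (b y)) → ∀ v → P (St b v)
  St-all {P} b h v = subst P (sym (St-proj b v)) (h (proj (pl v)))

  St-all⁻ : ∀ {P : ℤ → Set} b → (∀ v → P (St b v)) → ∀ y → P (b y)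
  St-all⁻ {P} b h y = subst P (St-at-base b y) (h (base-vertex y))

  St-nonPar : ∀ α b → NonPar α b → NonPar (St α) (St b)
  St-nonPar α b (nonpar p q h) = nonpar (base-vertex p) (base-vertex q) λ e → h
      (trans (sym (cong₂ _-_ (cong₂ _*_ (St-at-base α p) (St-at-base b q)) (cong₂ _*_ (St-at-base α q) (St-at-base b p)))) e)

  St-nonPar⁻ : ∀ α b → NonPar (St α) (St b) → NonPar α b
  St-nonPar⁻ α b (nonpar p q h) = nonpar (proj (pl p)) (proj (pl q)) λ e → h
      (trans (cong₂ _-_ (cong₂ _*_ (St-proj α p) (St-proj b q)) (cong₂ _*_ (St-proj α q) (St-proj b p))) e)

  module _ (w : List (Fin m)) (i : Fin m) {α : Vecℤ m} (e : 𝔸.root w i ≈ α) (α-pos : Pos α) where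

    η-eq : 𝔹.root (expand w i) (letter i) ≈ St α
    η-eq = ≈-trans (root-expand w i) (St-cong e)

    η-pos : Pos (St α)
    η-pos = St-all {0ℤ ≤_} α α-pos

    cut : ∀ {β} → 𝔹.Root β → Pos β → Neg (T w i β) → NonPar (St α) β → Σ (Vecℤ (m ℕ.+ n)) λ γ → Cuts B γ (St α) × SameFracture (St α) β γ
    cut {β} r p q np = 𝔹.cut-in-plane (expand w i) (letter i) η-eq η-pos r p (Neg-≈ (≈-sym (t-expand w i β)) q) np

    base-cut : ∀ b → 𝔹.Root (St b) → InvBase w i α b → Σ (Vecℤ (m ℕ.+ n)) λ γ → Cuts B γ (St α) × SameFracture (St α) (St b) γ
    base-cut b r (p , q , np) = cut r (St-all {0ℤ ≤_} b p) (Neg-≈ (≈-sym (T-St w i b)) (St-all {_≤ 0ℤ} (𝔸.t w i b) q)) (St-nonPar α b np)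

    base-cuts : All (λ b → Σ (Vecℤ (m ℕ.+ n)) λ γ → Cuts B γ (St α) × SameFracture (St α) (St b) γ) (invBases w i α)
    base-cuts = All.zipWith (λ {b} (r , h) → base-cut b r h) (AllP.filter⁺ (invBase? w i α) (bases-root w i) , AllP.all-filter (invBase? w i α)
        (bases w i))

    shift-cut : ∀ j → suc j ℕ.≤ n → ∀ g → 𝔹.Root (Shifted j g) → InvShift w i α g → Σ (Vecℤ (m ℕ.+ n)) λ γ → Cuts B γ (St α) × SameFracture (St α)
        (Shifted j g) γ
    shift-cut j l g r (inj₁ (p , q)) = cut r (Shifted-Pos j l g p) (Neg-≈ (≈-sym (T-Shifted j l w i g)) (Shifted-Neg j l (affT w i g) q))
        (Shifted-nonPar j l g (𝔸.root-nonzero (w , i , e)))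
    shift-cut j l g r (inj₂ (q , p)) = let (γ , c , f) = negated in γ , c ,
      sameFracture-trans (St α) (Shifted j g) (⊟ Shifted j g) γ (sameFracture-sym (St α) (⊟ Shifted j g) (Shifted j g)
          (⊟-sameFracture (St α) (Shifted j g))) f
      where
      image : T w i (⊟ Shifted j g) ≈ ⊟ Shifted j (affT w i g)
      image = ≈-trans (T-⊟ w i (Shifted j g)) (⊟-cong (T-Shifted j l w i g))
      negated : Σ (Vecℤ (m ℕ.+ n)) λ γ → Cuts B γ (St α) × SameFracture (St α) (⊟ Shifted j g) γ
      negated = cut (𝔹.root-neg r) (Pos-⊟ (Shifted-Neg j l g q)) (Neg-≈ (≈-sym image) (Neg-⊟ (Shifted-Pos j l (affT w i g) p)))
          (nonPar-⊟ (Shifted-nonPar j l g (𝔸.root-nonzero (w , i , e))))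

    shift-cuts : ∀ j → suc j ℕ.≤ n → All (λ g → Σ (Vecℤ (m ℕ.+ n)) λ γ → Cuts B γ (St α) × SameFracture (St α) (Shifted j g) γ) (invShifts w i α)
    shift-cuts j l = All.zipWith (λ {g} (r , h) → shift-cut j l g r h) (AllP.filter⁺ (invShift? w i α) (shifts-root j l w i) , AllP.all-filter
        (invShift? w i α) (shifts w i))

    Listed : Vecℤ (m ℕ.+ n) → Set
    Listed β = Any (λ b → SameFracture (St α) β (St b)) (invBases w i α) ⊎
               Σ ℕ λ j → suc j ℕ.≤ n × Any (λ g → SameFracture (St α) β (Shifted j g)) (invShifts w i α)

    shape⇒listed : ∀ {δ} → Pos δ → Neg (T w i δ) → NonPar (St α) δ → Shape (bases w i) (shifts w i) δ → Listed δ
    shape⇒listed {δ} p q np (inj₁ a) = inj₁ (Any.map (≈⇒sameFracture (St α)) (any-filter (invBase? w i α) (λ {b} f →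
      St-all⁻ {0ℤ ≤_} b (Pos-≈ f p) , St-all⁻ {_≤ 0ℤ} (𝔸.t w i b) (Neg-≈ (≈-trans (T-cong w i f) (T-St w i b)) q) , St-nonPar⁻ α b
          (nonPar-≈ ≈-refl f np)) a))
    shape⇒listed {δ} p q np (inj₂ (j , l , a)) = inj₂ (j , l , Any.map
        (λ {g} → [ ≈⇒sameFracture (St α) , (λ f → sameFracture-trans (St α) δ (⊟ Shifted j g) (Shifted j g) (≈⇒sameFracture (St α) f)
        (⊟-sameFracture (St α) (Shifted j g))) ]′)
      (any-filter (invShift? w i α) (λ {g} → inv g) a))
      where
      inv : ∀ g → δ ≈ Shifted j g ⊎ δ ≈ ⊟ Shifted j g → InvShift w i α g
      inv g (inj₁ f) = inj₁ (Shifted-Pos⁻ j l g (Pos-≈ f p) , Shifted-Neg⁻ j l (affT w i g) (Neg-≈ (≈-trans (T-cong w i f) (T-Shifted j l w i g)) q))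
      inv g (inj₂ f) = inj₂ (Shifted-Neg⁻ j l g (Neg-≈ (≈-trans (⊟-cong f) (⊟-invol (Shifted j g))) (Neg-⊟ p)) ,
        Shifted-Pos⁻ j l (affT w i g) (Pos-≈ (≈-trans (⊟-cong (≈-trans (T-cong w i f) (T-⊟ w i (Shifted j g))))
            (≈-trans (⊟-invol (T w i (Shifted j g))) (T-Shifted j l w i g))) (Pos-⊟ q)))

    Listed-mono : ∀ β γ → SameFracture (St α) β γ → Listed γ → Listed β
    Listed-mono β γ f (inj₁ a) = inj₁ (Any.map (λ {b} → sameFracture-trans (St α) β γ (St b) f) a)
    Listed-mono β γ f (inj₂ (j , l , a)) = inj₂ (j , l , Any.map (λ {g} → sameFracture-trans (St α) β γ (Shifted j g) f) a)

    private
      partnerᵉ : Vecℤ (m ℕ.+ n) → Vecℤ (m ℕ.+ n)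
      partnerᵉ = 𝔹.partner (expand w i) (letter i) η-eq η-pos

      partner-T : ∀ δ → partnerᵉ δ ≈ ⊟ T w i δ
      partner-T δ = ⊟-cong (t-expand w i δ)

    -- By `shape` either δ or its partner has a listed form. The partner is inverted as well and
    -- spans the same plane with st(α), so the fracture is listed in both cases.
    inverted-listed : ∀ {δ} → 𝔹.Root δ → Pos δ → Neg (T w i δ) → NonPar (St α) δ → Listed δ
    inverted-listed {δ} r p q np = by-shape (shape w i r p q)
      where
      np′ : NonPar (St α) (partnerᵉ δ)
      np′ = 𝔹.partner-nonPar (expand w i) (letter i) η-eq η-pos np
      by-shape : Shape (bases w i) (shifts w i) δ ⊎ Shape (bases w i) (shifts w i) (⊟ T w i δ) → Listed δ
      by-shape (inj₁ s) = shape⇒listed p q np s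
      by-shape (inj₂ s) = Listed-mono δ (partnerᵉ δ) (𝔹.partner-sameFracture (expand w i) (letter i) η-eq η-pos np)
        (shape⇒listed (Pos-≈ (≈-sym (partner-T δ)) (Pos-⊟ q)) (Neg-≈ (≈-sym (≈-trans (T-cong w i (partner-T δ)) (T-invol w i δ))) (Neg-⊟ p)) np′
            (Shape-≈ (≈-sym (partner-T δ)) s))

    cuts-listed : ∀ {β} → Cuts B β (St α) → Listed β
    cuts-listed {β} c = let (u , k , r , _ , f , p , q , np) = 𝔹.cut⇒crossing (expand w i) (letter i) η-eq η-pos c in
      Listed-mono β (𝔹.root u k) f (inverted-listed (u , k , ≈-refl) p (Neg-≈ (t-expand w i (𝔹.root u k)) q) (nonPar-≈ η-eq ≈-refl np))

-- Linear algebra over ℚ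

dot : ∀ {N} → Fun N → Fun N → ℚ
dot φ f = sumℚ (λ i → f i *ℚ φ i)

tail : ∀ {N} → Fun (suc N) → Fun N
tail f i = f (Fin.suc i)

cons : ∀ {N} → ℚ → Fun N → Fun (suc N)
cons a f Fin.zero    = a
cons a f (Fin.suc i) = f i

Ker : ∀ {N} → List (Fun N) → Fun N → Set
Ker K f = All (λ φ → dot φ f ≡ 0ℚ) K

combination : ∀ {N d} → (Fin d → ℚ) → (Fin d → Fun N) → Fun N
combination c g i = sumℚ (λ j → c j *ℚ g j i)

record Basis {N} (U : Fun N → Set) (d : ℕ) : Set where
  field
    vec   : Fin d → Fun N
    inU   : ∀ j → U (vec j)
    indep : LinIndep vec
    span  : ∀ f → U f → Σ (Fin d → ℚ) λ c → ∀ i → f i ≡ combination c vec i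

basis-⇔ : ∀ {N d} {U U′ : Fun N → Set} → (∀ f → U f → U′ f) → (∀ f → U′ f → U f) → Basis U d → Basis U′ d
basis-⇔ to from b = record { vec = vec ; inU = λ j → to (vec j) (inU j) ; indep = indep ; span = λ f u → span f (from f u) }
  where open Basis b

sumℚ-swap : ∀ {M N} (F : Fin M → Fin N → ℚ) → sumℚ (λ i → sumℚ (F i)) ≡ sumℚ (λ j → sumℚ (λ i → F i j))
sumℚ-swap {zero} {N} F = sym (sumℚ-zero {N} {λ j → 0ℚ} (λ j → refl))
sumℚ-swap {suc M} F = trans (cong (sumℚ (F Fin.zero) +ℚ_) (sumℚ-swap (λ i → F (Fin.suc i))))
    (sym (sumℚ-+ (F Fin.zero) (λ j → sumℚ (λ i → F (Fin.suc i) j))))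

dot-cong : ∀ {N} (φ : Fun N) {f g} → (∀ i → f i ≡ g i) → dot φ f ≡ dot φ g
dot-cong φ e = sumℚ-cong (λ i → cong (_*ℚ φ i) (e i))

dot-combination : ∀ {N d} (φ : Fun N) (c : Fin d → ℚ) g → dot φ (combination c g) ≡ sumℚ (λ j → c j *ℚ dot φ (g j))
dot-combination φ c g = trans (sumℚ-cong (λ i → trans (ℚP.*-comm (combination c g i) (φ i))
    (trans (sym (sumℚ-* (φ i) (λ j → c j *ℚ g j i))) (sumℚ-cong (λ j → lem (φ i) (c j) (g j i))))))
  (trans (sumℚ-swap (λ i j → c j *ℚ (g j i *ℚ φ i))) (sumℚ-cong (λ j → sumℚ-* (c j) (λ i → g j i *ℚ φ i))))
  where
  lem : ∀ p a b → p *ℚ (a *ℚ b) ≡ a *ℚ (b *ℚ p)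
  lem = RS.solve-∀ ringℚ

dot-+ : ∀ {N} (φ ψ f : Fun N) → dot (λ i → φ i +ℚ ψ i) f ≡ dot φ f +ℚ dot ψ f
dot-+ φ ψ f = trans (sumℚ-cong (λ i → ℚP.*-distribˡ-+ (f i) (φ i) (ψ i))) (sumℚ-+ (λ i → f i *ℚ φ i) (λ i → f i *ℚ ψ i))

dot-* : ∀ {N} c (φ f : Fun N) → dot (λ i → c *ℚ φ i) f ≡ c *ℚ dot φ f
dot-* c φ f = trans (sumℚ-cong (λ i → lem (f i) c (φ i))) (sumℚ-* c (λ i → f i *ℚ φ i))
  where
  lem : ∀ a c p → a *ℚ (c *ℚ p) ≡ c *ℚ (a *ℚ p)
  lem = RS.solve-∀ ringℚ

dot-zero : ∀ {N} (φ : Fun N) → dot φ (λ _ → 0ℚ) ≡ 0ℚ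
dot-zero φ = sumℚ-zero (λ i → ℚP.*-zeroˡ (φ i))

basis-free : ∀ {N d} {U : Fun N → Set} → U (λ _ → 0ℚ) → Basis U d → Basis (λ f → U (tail f)) (suc d)
basis-free {N} {d} {U} u₀ b = record { vec = vec′ ; inU = inU′ ; indep = indep′ ; span = span′ }
  where
  open Basis b
  vec′ : Fin (suc d) → Fun (suc N)
  vec′ Fin.zero    = cons 1ℚ (λ _ → 0ℚ)
  vec′ (Fin.suc j) = cons 0ℚ (vec j)
  inU′ : ∀ j → U (tail (vec′ j))
  inU′ Fin.zero    = u₀
  inU′ (Fin.suc j) = inU j
  zero-tail : ∀ (c : Fin d → ℚ) → sumℚ (λ j → c j *ℚ 0ℚ) ≡ 0ℚ
  zero-tail c = sumℚ-zero (λ j → ℚP.*-zeroʳ (c j))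
  indep′ : LinIndep vec′
  indep′ c h Fin.zero    = trans (sym (trans (cong (c Fin.zero *ℚ 1ℚ +ℚ_) (zero-tail (tail c)))
      (trans (ℚP.+-identityʳ (c Fin.zero *ℚ 1ℚ)) (ℚP.*-identityʳ (c Fin.zero))))) (h Fin.zero)
  indep′ c h (Fin.suc j) = indep (tail c) (λ i → trans (sym
      (trans (cong (_+ℚ combination (tail c) vec i) (ℚP.*-zeroʳ (c Fin.zero))) (ℚP.+-identityˡ (combination (tail c) vec i)))) (h (Fin.suc i))) j
  span′ : ∀ f → U (tail f) → Σ (Fin (suc d) → ℚ) λ c → ∀ i → f i ≡ combination c vec′ i
  span′ f u with span (tail f) u
  ... | c , e = cons (f Fin.zero) c , λ where
    Fin.zero    → sym (trans (cong (f Fin.zero *ℚ 1ℚ +ℚ_) (zero-tail c)) (trans (ℚP.+-identityʳ (f Fin.zero *ℚ 1ℚ)) (ℚP.*-identityʳ (f Fin.zero))))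
    (Fin.suc i) → trans (e i) (sym (trans (cong (_+ℚ combination c vec i) (ℚP.*-zeroʳ (f Fin.zero))) (ℚP.+-identityˡ (combination c vec i))))

basis-graph : ∀ {N d} {U : Fun N → Set} (h : Fun N) → Basis U d → Basis (λ f → f Fin.zero ≡ dot h (tail f) × U (tail f)) d
basis-graph {N} {d} {U} h b = record
  { vec   = λ j → cons (dot h (vec j)) (vec j)
  ; inU   = λ j → refl , inU j
  ; indep = λ c e → indep c (λ i → e (Fin.suc i))
  ; span  = λ f (e , u) → let (c , s) = span (tail f) u in c , λ where
      Fin.zero    → trans e (trans (dot-cong h s) (dot-combination h c vec))
      (Fin.suc i) → s i }
  where open Basis b

data Pivot {N} (K : List (Fun (suc N))) : Set where
  none  : All (λ φ → φ Fin.zero ≡ 0ℚ) K → Pivot K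
  found : ∀ pre φ post → K ≡ pre ++ φ ∷ post → φ Fin.zero ≢ 0ℚ → Pivot K

pivot : ∀ {N} (K : List (Fun (suc N))) → Pivot K
pivot [] = none []
pivot (φ ∷ K) with φ Fin.zero ℚP.≟ 0ℚ
... | no h  = found [] φ K refl h
... | yes h with pivot K
...   | none hs = none (h ∷ hs)
...   | found pre ψ post e h′ = found (φ ∷ pre) ψ post (cong (φ ∷_) e) h′

Ker-zero : ∀ {N} (K : List (Fun N)) → Ker K (λ _ → 0ℚ)
Ker-zero []      = []
Ker-zero (φ ∷ K) = dot-zero φ ∷ Ker-zero K

dot-tail : ∀ {N} (φ : Fun (suc N)) → φ Fin.zero ≡ 0ℚ → ∀ f → dot φ f ≡ dot (tail φ) (tail f)
dot-tail φ h f = trans (cong (λ a → f Fin.zero *ℚ a +ℚ dot (tail φ) (tail f)) h)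
    (trans (cong (_+ℚ dot (tail φ) (tail f)) (ℚP.*-zeroʳ (f Fin.zero))) (ℚP.+-identityˡ (dot (tail φ) (tail f))))

-- Substitutes f₀ = h(tail f) into the form ψ.
reduce : ∀ {N} → Fun N → Fun (suc N) → Fun N
reduce h ψ i = ψ (Fin.suc i) +ℚ ψ Fin.zero *ℚ h i

dot-reduce : ∀ {N} h (ψ : Fun (suc N)) f → f Fin.zero ≡ dot h (tail f) → dot ψ f ≡ dot (reduce h ψ) (tail f)
dot-reduce h ψ f e = trans (cong (λ a → a *ℚ ψ Fin.zero +ℚ dot (tail ψ) (tail f)) e)
    (trans (lem (dot h (tail f)) (ψ Fin.zero) (dot (tail ψ) (tail f)))
  (sym (trans (dot-+ (tail ψ) (λ i → ψ Fin.zero *ℚ h i) (tail f)) (cong (dot (tail ψ) (tail f) +ℚ_) (dot-* (ψ Fin.zero) h (tail f))))))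
  where
  lem : ∀ a b c → a *ℚ b +ℚ c ≡ c +ℚ b *ℚ a
  lem = RS.solve-∀ ringℚ

All-⇔ : ∀ {X Y : Set} {P : X → Set} {Q : Y → Set} (h : X → Y) (xs : List X) → (∀ x → P x → Q (h x)) → All P xs → All Q (map h xs)
All-⇔ h []       f []       = []
All-⇔ h (x ∷ xs) f (p ∷ ps) = f x p ∷ All-⇔ h xs f ps

-- Gaussian elimination on the first coordinate: it is free if no form involves it, and otherwise a
-- pivot expresses it through the remaining ones. The inequality is carried along for the exchange
-- argument in `indep-≤`.
kerBasis : ∀ N (K : List (Fun N)) → Σ ℕ λ d → Basis (Ker K) d × N ℕ.≤ d ℕ.+ length K
kerBasis zero K = 0 , record { vec = λ () ; inU = λ () ; indep = λ c h () ; span = λ f u → (λ ()) , λ () } , ℕ.z≤n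
kerBasis (suc N) K with pivot K
... | none h with kerBasis N (map tail K)
...   | d , b , l = suc d , basis-⇔ (λ f u → back K h f u) (λ f u → forth K h f u) (basis-free (Ker-zero (map tail K)) b) ,
        ℕ.s≤s (subst (λ k → N ℕ.≤ d ℕ.+ k) (ListP.length-map tail K) l)
  where
  forth : ∀ K → All (λ φ → φ Fin.zero ≡ 0ℚ) K → ∀ f → Ker K f → Ker (map tail K) (tail f)
  forth []      []       f []       = []
  forth (φ ∷ K) (h ∷ hs) f (u ∷ us) = trans (sym (dot-tail φ h f)) u ∷ forth K hs f us
  back : ∀ K → All (λ φ → φ Fin.zero ≡ 0ℚ) K → ∀ f → Ker (map tail K) (tail f) → Ker K f
  back []      []       f []       = []
  back (φ ∷ K) (h ∷ hs) f (u ∷ us) = trans (dot-tail φ h f) u ∷ back K hs f us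
kerBasis (suc N) K | found pre φ post e h≢0 with kerBasis N (map (reduce (λ i → -ℚ (ℚ.1/_ (φ Fin.zero) {{ℚ.≢-nonZero h≢0}} *ℚ φ (Fin.suc i))))
    (pre ++ post))
... | d , b , l = d , basis-⇔ back forth (basis-graph h b) , bound
  where
  instance
    nz : ℚ.NonZero (φ Fin.zero)
    nz = ℚ.≢-nonZero h≢0
  r : ℚ
  r = ℚ.1/ φ Fin.zero
  h : Fun N
  h i = -ℚ (r *ℚ φ (Fin.suc i))
  bound : suc N ℕ.≤ d ℕ.+ length K
  bound = subst (λ k → suc N ℕ.≤ d ℕ.+ k) (sym (trans (cong length e) (trans (ListP.length-++ pre) (ℕP.+-suc (length pre) (length post)))))
    (subst (suc N ℕ.≤_) (sym (ℕP.+-suc d (length pre ℕ.+ length post)))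
      (ℕ.s≤s (subst (λ k → N ℕ.≤ d ℕ.+ k) (trans (ListP.length-map (reduce h) (pre ++ post)) (ListP.length-++ pre)) l)))
  dot-h : ∀ f → dot h f ≡ -ℚ (r *ℚ dot (tail φ) f)
  dot-h f = trans (sumℚ-cong (λ i → lem (f i) r (φ (Fin.suc i)))) (trans (sumℚ-* (-ℚ r) (λ i → f i *ℚ φ (Fin.suc i)))
      (sym (ℚP.neg-distribˡ-* r (dot (tail φ) f))))
    where
    lem : ∀ a r p → a *ℚ (-ℚ (r *ℚ p)) ≡ (-ℚ r) *ℚ (a *ℚ p)
    lem = RS.solve-∀ ringℚ
  solved : ∀ f → dot φ f ≡ 0ℚ → f Fin.zero ≡ dot h (tail f)
  solved f u = trans (lem (f Fin.zero) r (φ Fin.zero) (dot (tail φ) (tail f)) (ℚP.*-inverseˡ (φ Fin.zero)))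
      (trans (cong (λ a → r *ℚ a -ℚ r *ℚ dot (tail φ) (tail f)) u)
    (trans (lem′ r (dot (tail φ) (tail f))) (sym (dot-h (tail f)))))
    where
    lem : ∀ x r p s → r *ℚ p ≡ 1ℚ → x ≡ r *ℚ (x *ℚ p +ℚ s) -ℚ r *ℚ s
    lem x r p s e = trans (sym (ℚP.*-identityʳ x)) (trans (cong (x *ℚ_) (sym e)) (go x r p s))
      where
      go : ∀ x r p s → x *ℚ (r *ℚ p) ≡ r *ℚ (x *ℚ p +ℚ s) -ℚ r *ℚ s
      go = RS.solve-∀ ringℚ
    lem′ : ∀ r s → r *ℚ 0ℚ -ℚ r *ℚ s ≡ -ℚ (r *ℚ s)
    lem′ = RS.solve-∀ ringℚ
  unsolved : ∀ f → f Fin.zero ≡ dot h (tail f) → dot φ f ≡ 0ℚ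
  unsolved f u = trans (cong (λ a → a *ℚ φ Fin.zero +ℚ dot (tail φ) (tail f)) (trans u (dot-h (tail f))))
      (lem r (φ Fin.zero) (dot (tail φ) (tail f)) (ℚP.*-inverseˡ (φ Fin.zero)))
    where
    lem : ∀ r p s → r *ℚ p ≡ 1ℚ → (-ℚ (r *ℚ s)) *ℚ p +ℚ s ≡ 0ℚ
    lem r p s e = trans (go r p s) (trans (cong (λ a → (1ℚ -ℚ a) *ℚ s) e) (trans (cong (_*ℚ s) (ℚP.+-inverseʳ 1ℚ)) (ℚP.*-zeroˡ s)))
      where
      go : ∀ r p s → (-ℚ (r *ℚ s)) *ℚ p +ℚ s ≡ (1ℚ -ℚ r *ℚ p) *ℚ s
      go = RS.solve-∀ ringℚ
  forth : ∀ f → Ker K f → f Fin.zero ≡ dot h (tail f) × Ker (map (reduce h) (pre ++ post)) (tail f)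
  forth f u with AllP.++⁻ pre (subst (λ K → Ker K f) e u)
  ... | us , v ∷ vs = solved f v , All-⇔ (reduce h) (pre ++ post) (λ ψ w → trans (sym (dot-reduce h ψ f (solved f v))) w) (AllP.++⁺ us vs)
  back : ∀ f → f Fin.zero ≡ dot h (tail f) × Ker (map (reduce h) (pre ++ post)) (tail f) → Ker K f
  back f (v , u) = subst (λ K → Ker K f) (sym e) (let (us , vs) = AllP.++⁻ pre (All.map (λ {ψ} w → trans (dot-reduce h ψ f v) w) (AllP.map⁻ u)) in AllP.++⁺ us (unsolved f v ∷ vs))

basis-nonzero : ∀ {N d} {U : Fun N → Set} (b : Basis U (suc d)) → ¬ (∀ i → Basis.vec b Fin.zero i ≡ 0ℚ)
basis-nonzero {d = d} b h = contra (trans (sym one) (Basis.indep b c vanishing Fin.zero))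
  where
  open Basis b
  c : Fin (suc d) → ℚ
  c = cons 1ℚ (λ _ → 0ℚ)
  one : c Fin.zero ≡ 1ℚ
  one = refl
  contra : ¬ (1ℚ ≡ 0ℚ)
  contra ()
  vanishing : ∀ i → combination c vec i ≡ 0ℚ
  vanishing i = cong₂ _+ℚ_ (trans (cong (1ℚ *ℚ_) (h i)) (ℚP.*-zeroʳ 1ℚ)) (sumℚ-zero (λ j → ℚP.*-zeroˡ (vec (Fin.suc j) i)))

-- Steinitz: a linear dependence among d′ > d vectors comes from a homogeneous system of d equations.
indep-≤ : ∀ {N d d′} {U : Fun N → Set} → Basis U d → (g : Fin d′ → Fun N) → (∀ j → U (g j)) → LinIndep g → d′ ℕ.≤ d
indep-≤ {N} {d} {d′} {U} b g gU ind with kerBasis d′ (List.tabulate (λ k j → proj₁ (Basis.span b (g j) (gU j)) k))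
... | zero , _ , l = subst (d′ ℕ.≤_) (ListP.length-tabulate (λ k j → proj₁ (Basis.span b (g j) (gU j)) k)) l
... | suc e , b′ , _ = ⊥-elim (basis-nonzero b′ (ind x dependent))
  where
  open Basis b
  C : Fin d′ → Fin d → ℚ
  C j = proj₁ (span (g j) (gU j))
  x : Fun d′
  x = Basis.vec b′ Fin.zero
  solves : ∀ k → sumℚ (λ j → x j *ℚ C j k) ≡ 0ℚ
  solves k = AllP.tabulate⁻ (Basis.inU b′ Fin.zero) k
  dependent : ∀ i → sumℚ (λ j → x j *ℚ g j i) ≡ 0ℚ
  dependent i = trans (sumℚ-cong (λ j → trans (cong (x j *ℚ_) (proj₂ (span (g j) (gU j)) i)) (sym (sumℚ-* (x j) (λ k → C j k *ℚ vec k i)))))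
    (trans (sumℚ-swap (λ j k → x j *ℚ (C j k *ℚ vec k i))) (sumℚ-zero (λ k → trans (sumℚ-cong (λ j → lem (x j) (C j k) (vec k i)))
      (trans (sumℚ-* (vec k i) (λ j → x j *ℚ C j k)) (trans (cong (vec k i *ℚ_) (solves k)) (ℚP.*-zeroʳ (vec k i)))))))
    where
    lem : ∀ a b c → a *ℚ (b *ℚ c) ≡ c *ℚ (a *ℚ b)
    lem = RS.solve-∀ ringℚ

basis-unique : ∀ {N d d′} {U : Fun N → Set} → Basis U d → Basis U d′ → d ≡ d′
basis-unique b b′ = ℕP.≤-antisym (indep-≤ b′ (Basis.vec b) (Basis.inU b) (Basis.indep b)) (indep-≤ b (Basis.vec b′) (Basis.inU b′) (Basis.indep b′))

vanishes? : ∀ {N d} {U : Fun N → Set} → Basis U d → ∀ φ → Dec (∀ f → U f → dot φ f ≡ 0ℚ)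
vanishes? b φ with FinP.all? (λ j → dot φ (Basis.vec b j) ℚP.≟ 0ℚ)
... | no ¬h = no λ h → ¬h (λ j → h (Basis.vec b j) (Basis.inU b j))
... | yes h = yes λ f u → let (c , e) = Basis.span b f u in trans (dot-cong φ e) (trans (dot-combination φ c (Basis.vec b))
    (sumℚ-zero (λ j → trans (cong (c j *ℚ_) (h j)) (ℚP.*-zeroʳ (c j)))))

_≃_ : ∀ {N} → List (Fun N) → List (Fun N) → Set
K ≃ K′ = ∀ f → (Ker K f → Ker K′ f) × (Ker K′ f → Ker K f)

nullity : ∀ {N} → List (Fun N) → ℕ
nullity {N} K = proj₁ (kerBasis N K)

kernel-basis : ∀ {N} (K : List (Fun N)) → Basis (Ker K) (nullity K)
kernel-basis {N} K = proj₁ (proj₂ (kerBasis N K))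

nullity-basis : ∀ {N d} (K : List (Fun N)) → Basis (Ker K) d → nullity K ≡ d
nullity-basis K b = basis-unique (kernel-basis K) b

nullity-≃ : ∀ {N} {K K′ : List (Fun N)} → K ≃ K′ → nullity K ≡ nullity K′
nullity-≃ {K = K} {K′} e = nullity-basis K (basis-⇔ (λ f → proj₂ (e f)) (λ f → proj₁ (e f)) (kernel-basis K′))

-- The characteristic polynomial as an alternating sum

ratl : ∀ {N} → Vecℤ N → Fun N
ratl v i = toℚ (v i)

Σℚ : ∀ {X : Set} → List X → (X → ℚ) → ℚ
Σℚ []       h = 0ℚ
Σℚ (x ∷ xs) h = h x +ℚ Σℚ xs h

Σℚ-cong : ∀ {X : Set} (xs : List X) {h h′ : X → ℚ} → (∀ x → h x ≡ h′ x) → Σℚ xs h ≡ Σℚ xs h′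
Σℚ-cong []       e = refl
Σℚ-cong (x ∷ xs) e = cong₂ _+ℚ_ (e x) (Σℚ-cong xs e)

Σℚ-All : ∀ {X : Set} {xs : List X} {h : X → ℚ} → All (λ x → h x ≡ 0ℚ) xs → Σℚ xs h ≡ 0ℚ
Σℚ-All []       = refl
Σℚ-All (p ∷ ps) = cong₂ _+ℚ_ p (Σℚ-All ps)

Σℚ-minus : ∀ {X : Set} (xs : List X) (h h′ : X → ℚ) → Σℚ xs (λ x → h x -ℚ h′ x) ≡ Σℚ xs h -ℚ Σℚ xs h′
Σℚ-minus []       h h′ = refl
Σℚ-minus (x ∷ xs) h h′ = trans (cong (h x -ℚ h′ x +ℚ_) (Σℚ-minus xs h h′)) (lem (h x) (h′ x) (Σℚ xs h) (Σℚ xs h′))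
  where
  lem : ∀ a b c d → (a -ℚ b) +ℚ (c -ℚ d) ≡ (a +ℚ c) -ℚ (b +ℚ d)
  lem = RS.solve-∀ ringℚ

-- Elements satisfying P are related by R, while the members of the list are pairwise unrelated; so
-- exactly one term survives.
Σℚ-pick : ∀ {X : Set} {R : X → X → Set} (P : X → Set) → (∀ x → Dec (P x)) → (∀ {x y} → P x → P y → R x y) →
          ∀ {xs} → AllPairs (λ x y → ¬ R x y) xs → ∀ h v → All (λ x → (P x → h x ≡ v) × (¬ P x → h x ≡ 0ℚ)) xs → Any P xs → Σℚ xs h ≡ v
Σℚ-pick P P? PR {x ∷ xs} (ps ∷ pss) h v ((a , b) ∷ hs) an with P? x
... | yes px = trans (cong₂ _+ℚ_ (a px) (Σℚ-All (All.zipWith (λ {y} (¬r , _ , z) → z (λ py → ¬r (PR px py))) (ps , hs)))) (ℚP.+-identityʳ v)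
... | no ¬px with an
...   | here px = ⊥-elim (¬px px)
...   | there an′ = trans (cong₂ _+ℚ_ (b ¬px) (Σℚ-pick P P? PR pss h v hs an′)) (ℚP.+-identityˡ v)

indicator : ∀ {P : Set} → Dec P → ℚ
indicator (yes _) = 1ℚ
indicator (no _)  = 0ℚ

indicator-yes : ∀ {P : Set} (d : Dec P) → P → indicator d ≡ 1ℚ
indicator-yes (yes _) p = refl
indicator-yes (no ¬p) p = ⊥-elim (¬p p)

indicator-no : ∀ {P : Set} (d : Dec P) → ¬ P → indicator d ≡ 0ℚ
indicator-no (yes p) ¬p = ⊥-elim (¬p p)
indicator-no (no _)  ¬p = refl

-- Σ over the sublists S of the second argument of (-1)^|S| Ψ(S ++ K).
whitney : ∀ {N} → (List (Fun N) → ℚ) → List (Fun N) → List (Fun N) → ℚ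
whitney Ψ []       K = Ψ K
whitney Ψ (φ ∷ Ms) K = whitney Ψ Ms K -ℚ whitney Ψ Ms (φ ∷ K)

-- An induction principle in relational form. Any relation between lists that survives adjoining
-- forms transports an equality of summands to the alternating sums.
whitney-rel : ∀ {N} (R : List (Fun N) → List (Fun N) → Set) {Ψ Ψ′} → (∀ K K′ → R K K′ → Ψ K ≡ Ψ′ K′) →
              ∀ Ms → All (λ φ → ∀ K K′ → R K K′ → R (φ ∷ K) (φ ∷ K′)) Ms → ∀ K K′ → R K K′ → whitney Ψ Ms K ≡ whitney Ψ′ Ms K′
whitney-rel R e []       []       K K′ r = e K K′ r
whitney-rel R e (φ ∷ Ms) (c ∷ cs) K K′ r = cong₂ _-ℚ_ (whitney-rel R e Ms cs K K′ r) (whitney-rel R e Ms cs (φ ∷ K) (φ ∷ K′) (c K K′ r))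

whitney-cong : ∀ {N} (P : List (Fun N) → Set) {Ψ Ψ′} → (∀ K → P K → Ψ K ≡ Ψ′ K) → ∀ Ms → All (λ φ → ∀ K → P K → P (φ ∷ K)) Ms →
               ∀ K → P K → whitney Ψ Ms K ≡ whitney Ψ′ Ms K
whitney-cong P e Ms cs K p = whitney-rel (λ K K′ → K ≡ K′ × P K) (λ { K .K (refl , p) → e K p }) Ms
    (All.map (λ c → λ { K .K (refl , p) → refl , c K p }) cs) K K (refl , p)

whitney-zero : ∀ {N} (Ms K : List (Fun N)) → whitney (λ _ → 0ℚ) Ms K ≡ 0ℚ
whitney-zero []       K = refl
whitney-zero (φ ∷ Ms) K = cong₂ _-ℚ_ (whitney-zero Ms K) (whitney-zero Ms (φ ∷ K))

whitney-Σ : ∀ {N} {X : Set} (xs : List X) (Ψ : X → List (Fun N) → ℚ) Ms K → whitney (λ K → Σℚ xs (λ x → Ψ x K)) Ms K ≡ Σℚ xs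
    (λ x → whitney (Ψ x) Ms K)
whitney-Σ xs Ψ []       K = refl
whitney-Σ xs Ψ (φ ∷ Ms) K = trans (cong₂ _-ℚ_ (whitney-Σ xs Ψ Ms K) (whitney-Σ xs Ψ Ms (φ ∷ K)))
    (sym (Σℚ-minus xs (λ x → whitney (Ψ x) Ms K) (λ x → whitney (Ψ x) Ms (φ ∷ K))))

whitney-* : ∀ {N} (Ψ : List (Fun N) → ℚ) c Ms K → whitney (λ K → c *ℚ Ψ K) Ms K ≡ c *ℚ whitney Ψ Ms K
whitney-* Ψ c []       K = refl
whitney-* Ψ c (φ ∷ Ms) K = trans (cong₂ _-ℚ_ (whitney-* Ψ c Ms K) (whitney-* Ψ c Ms (φ ∷ K))) (lem c (whitney Ψ Ms K) (whitney Ψ Ms (φ ∷ K)))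
  where
  lem : ∀ c a b → c *ℚ a -ℚ c *ℚ b ≡ c *ℚ (a -ℚ b)
  lem = RS.solve-∀ ringℚ

allSubfams : ∀ k → List (Subfam k)
allSubfams zero    = (λ ()) ∷ []
allSubfams (suc k) = map (consᵇ true) (allSubfams k) ++ map (consᵇ false) (allSubfams k)
  where
  consᵇ : Bool → Subfam k → Subfam (suc k)
  consᵇ b S Fin.zero    = b
  consᵇ b S (Fin.suc i) = S i

allSubfams-complete : ∀ k (C : Subfam k) → Any (λ C′ → ∀ i → C i ≡ C′ i) (allSubfams k)
allSubfams-complete zero    C = here λ ()
allSubfams-complete (suc k) C with C Fin.zero in eq
... | true  = AnyP.++⁺ˡ (AnyP.map⁺ (Any.map (λ h → λ { Fin.zero → eq ; (Fin.suc i) → h i }) (allSubfams-complete k (λ i → C (Fin.suc i)))))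
... | false = AnyP.++⁺ʳ _ (AnyP.map⁺ (Any.map (λ h → λ { Fin.zero → eq ; (Fin.suc i) → h i }) (allSubfams-complete k (λ i → C (Fin.suc i)))))

module Representatives {X : Set} {R : X → X → Set} (R? : ∀ x y → Dec (R x y)) (R-refl : ∀ {x} → R x x)
    (R-trans : ∀ {x y z} → R x y → R y z → R x z) where

  representatives : List X → List X
  insert : (x : X) (ys : List X) → Dec (Any (R x) ys) → List X
  representatives []       = []
  representatives (x ∷ xs) = insert x (representatives xs) (Any.any? (R? x) (representatives xs))
  insert x ys (yes _) = ys
  insert x ys (no _)  = x ∷ ys

  representatives-distinct : ∀ xs → AllPairs (λ x y → ¬ R x y) (representatives xs)
  representatives-distinct []       = []
  representatives-distinct (x ∷ xs) with Any.any? (R? x) (representatives xs)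
  ... | yes _ = representatives-distinct xs
  ... | no ¬a = AllP.¬Any⇒All¬ (representatives xs) ¬a ∷ representatives-distinct xs

  representatives-All : ∀ {P : X → Set} {xs} → All P xs → All P (representatives xs)
  representatives-All []       = []
  representatives-All {xs = x ∷ xs} (p ∷ ps) with Any.any? (R? x) (representatives xs)
  ... | yes _ = representatives-All ps
  ... | no _  = p ∷ representatives-All ps

  representatives-Any : ∀ xs → All (λ x → Any (R x) (representatives xs)) xs
  representatives-Any []       = []
  representatives-Any (x ∷ xs) with Any.any? (R? x) (representatives xs)
  ... | yes a = a ∷ representatives-Any xs
  ... | no _  = here R-refl ∷ All.map there (representatives-Any xs)

  representatives-complete : ∀ {xs z} → Any (R z) xs → Any (R z) (representatives xs)
  representatives-complete {xs} a = go (representatives-Any xs) a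
    where
    go : ∀ {ys z} → All (λ x → Any (R x) (representatives xs)) ys → Any (R z) ys → Any (R z) (representatives xs)
    go (p ∷ ps) (here r)  = Any.map (R-trans r) p
    go (p ∷ ps) (there a) = go ps a

count : ∀ {k} → (Fin k → Bool) → ℕ
count {zero}  Q = 0
count {suc k} Q = (if Q Fin.zero then 1 else 0) ℕ.+ count (λ i → Q (Fin.suc i))

count-mono : ∀ {k} (Q Q′ : Fin k → Bool) → (∀ i → Q i ≡ true → Q′ i ≡ true) → count Q ℕ.≤ count Q′
count-mono {zero}  Q Q′ h = ℕ.z≤n
count-mono {suc k} Q Q′ h = ℕP.+-mono-≤ (first (Q Fin.zero) (Q′ Fin.zero) (h Fin.zero))
    (count-mono (λ i → Q (Fin.suc i)) (λ i → Q′ (Fin.suc i)) (λ i → h (Fin.suc i)))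
  where
  first : ∀ a b → (a ≡ true → b ≡ true) → (if a then 1 else 0) ℕ.≤ (if b then 1 else 0)
  first false b     h = ℕ.z≤n
  first true  true  h = ℕP.≤-refl
  first true  false h with h refl
  ... | ()

count-strict : ∀ {k} (Q Q′ : Fin k → Bool) → (∀ i → Q i ≡ true → Q′ i ≡ true) → ∀ i → Q i ≡ false → Q′ i ≡ true → count Q ℕ.< count Q′
count-strict {suc k} Q Q′ h Fin.zero a b rewrite a | b = ℕ.s≤s (count-mono (λ i → Q (Fin.suc i)) (λ i → Q′ (Fin.suc i)) (λ i → h (Fin.suc i)))
count-strict {suc k} Q Q′ h (Fin.suc i) a b = ℕP.+-mono-≤-< (first (Q Fin.zero) (Q′ Fin.zero) (h Fin.zero))
    (count-strict (λ i → Q (Fin.suc i)) (λ i → Q′ (Fin.suc i)) (λ i → h (Fin.suc i)) i a b)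
  where
  first : ∀ a b → (a ≡ true → b ≡ true) → (if a then 1 else 0) ℕ.≤ (if b then 1 else 0)
  first false b     h = ℕ.z≤n
  first true  true  h = ℕP.≤-refl
  first true  false h with h refl
  ... | ()

does-true : ∀ {P : Set} (d : Dec P) → P → does d ≡ true
does-true (yes _) p = refl
does-true (no ¬p) p = ⊥-elim (¬p p)

does-false : ∀ {P : Set} (d : Dec P) → ¬ P → does d ≡ false
does-false (yes p) ¬p = ⊥-elim (¬p p)
does-false (no _)  ¬p = refl

true-does : ∀ {P : Set} (d : Dec P) → does d ≡ true → P
true-does (yes p) _ = p

toℚ-sum : ∀ {X : Set} (μ : X → ℤ) xs → toℚ (sumℤList (map μ xs)) ≡ Σℚ xs (λ x → toℚ (μ x))
toℚ-sum μ []       = refl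
toℚ-sum μ (x ∷ xs) = trans (toℚ-+ (μ x) (sumℤList (map μ xs))) (cong (toℚ (μ x) +ℚ_) (toℚ-sum μ xs))

sumℚList-map : ∀ {X : Set} (h : X → ℚ) xs → sumℚList (map h xs) ≡ Σℚ xs h
sumℚList-map h []       = refl
sumℚList-map h (x ∷ xs) = cong (h x +ℚ_) (sumℚList-map h xs)

selected : ∀ {N k} → Subfam k → (Fin k → Vecℤ N) → List (Fun N)
selected {k = zero}  S Fs = []
selected {k = suc k} S Fs = if S Fin.zero then ratl (Fs Fin.zero) ∷ selected (λ i → S (Fin.suc i)) (λ i → Fs (Fin.suc i)) else selected
    (λ i → S (Fin.suc i)) (λ i → Fs (Fin.suc i))

selected⇒ : ∀ {N k} (S : Subfam k) (Fs : Fin k → Vecℤ N) f → Ker (selected S Fs) f → ∀ i → S i ≡ true → pair f (Fs i) ≡ 0ℚ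
selected⇒ {k = suc k} S Fs f u i e with S Fin.zero in eq
selected⇒ {k = suc k} S Fs f (u ∷ us) Fin.zero    e | true  = u
selected⇒ {k = suc k} S Fs f (u ∷ us) (Fin.suc i) e | true  = selected⇒ (λ i → S (Fin.suc i)) (λ i → Fs (Fin.suc i)) f us i e
selected⇒ {k = suc k} S Fs f us       (Fin.suc i) e | false = selected⇒ (λ i → S (Fin.suc i)) (λ i → Fs (Fin.suc i)) f us i e
selected⇒ {k = suc k} S Fs f us       Fin.zero    e | false with trans (sym eq) e
... | ()

⇒selected : ∀ {N k} (S : Subfam k) (Fs : Fin k → Vecℤ N) f → (∀ i → S i ≡ true → pair f (Fs i) ≡ 0ℚ) → Ker (selected S Fs) f
⇒selected {k = zero}  S Fs f h = []
⇒selected {k = suc k} S Fs f h with S Fin.zero in eq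
... | true  = h Fin.zero eq ∷ ⇒selected (λ i → S (Fin.suc i)) (λ i → Fs (Fin.suc i)) f (λ i → h (Fin.suc i))
... | false = ⇒selected (λ i → S (Fin.suc i)) (λ i → Fs (Fin.suc i)) f (λ i → h (Fin.suc i))

all-vanish? : ∀ {N d} {U : Fun N → Set} → Basis U d → ∀ K → Dec (∀ f → U f → Ker K f)
all-vanish? b K with All.all? (vanishes? b) K
... | yes h = yes λ f u → All.map (λ v → v f u) h
... | no ¬h = no λ h → ¬h (All.tabulate (λ φ∈K f u → All.lookup (h f u) φ∈K))

module Moebius {N k : ℕ} (η : Vecℤ N) (Fs : Fin k → Vecℤ N) (proper : ∀ i → ¬ (∀ f → pair f η ≡ 0ℚ → pair f (Fs i) ≡ 0ℚ)) where

  Flat : Subfam k → Fun N → Set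
  Flat = InFlat η Fs

  K₀ Ms : List (Fun N)
  K₀ = ratl η ∷ []
  Ms = List.tabulate (λ i → ratl (Fs i))

  flatForms : Subfam k → List (Fun N)
  flatForms S = ratl η ∷ selected S Fs

  flat-basis : ∀ S → Basis (Flat S) (nullity (flatForms S))
  flat-basis S = basis-⇔ (λ { f (u ∷ us) → u , selected⇒ S Fs f us }) (λ { f (u , us) → u ∷ ⇒selected S Fs f us }) (kernel-basis (flatForms S))

  OnFlat : Subfam k → Fun N → Set
  OnFlat S φ = ∀ f → Flat S f → dot φ f ≡ 0ℚ

  onFlat? : ∀ S φ → Dec (OnFlat S φ)
  onFlat? S φ = vanishes? (flat-basis S) φ

  sub? : ∀ S C → Dec (FlatSub η Fs S C)
  sub? S C with FinP.all? (λ i → (C i BoolP.≟ true) →-dec onFlat? S (ratl (Fs i)))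
  ... | yes h = yes λ f u → proj₁ u , λ i e → h i e f u
  ... | no ¬h = no λ h → ¬h (λ i e f u → proj₂ (h f u) i e)

  Rep : List (Fun N) → Subfam k → Set
  Rep K C = (∀ f → Ker K f → Flat C f) × (∀ f → Flat C f → Ker K f)

  rep? : ∀ K C → Dec (Rep K C)
  rep? K C with all-vanish? (kernel-basis K) (flatForms C) ×-dec all-vanish? (flat-basis C) K
  ... | yes (a , b) = yes ((λ f u → flat f (a f u)) , b)
    where
    flat : ∀ f → Ker (flatForms C) f → Flat C f
    flat f (v ∷ vs) = v , selected⇒ C Fs f vs
  ... | no ¬h = no λ (a , b) → ¬h ((λ f u → proj₁ (a f u) ∷ ⇒selected C Fs f (proj₂ (a f u))) , b)

  Represented : List (Fun N) → Set
  Represented K = Σ (Subfam k) λ C → Rep K C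

  add : Fin k → Subfam k → Subfam k
  add i C j = if does (i Fin.≟ j) then true else C j

  represented-∷ : All (λ φ → ∀ K → Represented K → Represented (φ ∷ K)) Ms
  represented-∷ = AllP.tabulate⁺ λ i K (C , a , b) → add i C ,
      (λ { f (u ∷ us) → proj₁ (a f us) , λ j → both i C f u (proj₂ (a f us)) j }) ,
      λ f (u , us) → us i (add-self i C) ∷ b f (u , λ j e → us j (add-other i C j e))
    where
    both : ∀ i C f → pair f (Fs i) ≡ 0ℚ → (∀ j → C j ≡ true → pair f (Fs j) ≡ 0ℚ) → ∀ j → add i C j ≡ true → pair f (Fs j) ≡ 0ℚ
    both i C f u us j e with i Fin.≟ j
    ... | yes refl = u
    ... | no _     = us j e
    add-self : ∀ i C → add i C i ≡ true
    add-self i C with i Fin.≟ i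
    ... | yes _ = refl
    ... | no ¬e = ⊥-elim (¬e refl)
    add-other : ∀ i C j → C j ≡ true → add i C j ≡ true
    add-other i C j e with i Fin.≟ j
    ... | yes _ = refl
    ... | no _  = e

  represented₀ : Represented K₀
  represented₀ = emptyS , (λ { f (u ∷ []) → u , λ i () }) , λ f (u , _) → u ∷ []

  -- `δ C` tests whether K cuts out exactly the flat of C, and `ζ S` whether the kernel of K
  -- contains the flat of S.
  δ ζ : Subfam k → List (Fun N) → ℚ
  δ C K = indicator (rep? K C)
  ζ S K = indicator (all-vanish? (flat-basis S) K)

  ν : Subfam k → ℚ
  ν C = whitney (δ C) Ms K₀

  flatEq-refl : ∀ {C} → FlatEq η Fs C C
  flatEq-refl = (λ f u → u) , λ f u → u

  flatEq-trans : ∀ {C D G} → FlatEq η Fs C D → FlatEq η Fs D G → FlatEq η Fs C G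
  flatEq-trans (a , b) (c , d) = (λ f u → c f (a f u)) , λ f u → b f (d f u)

  flatEq? : ∀ C D → Dec (FlatEq η Fs C D)
  flatEq? C D = sub? C D ×-dec sub? D C

  ν-cong : ∀ {C D} → FlatEq η Fs C D → ν C ≡ ν D
  ν-cong {C} {D} (a , b) = whitney-cong (λ K → Represented K) (λ K _ → same K) Ms represented-∷ K₀ represented₀
    where
    same : ∀ K → δ C K ≡ δ D K
    same K with rep? K C
    ... | yes (x , y) = sym (indicator-yes (rep? K D) ((λ f u → a f (x f u)) , λ f u → y f (b f u)))
    ... | no ¬r = sym (indicator-no (rep? K D) λ (x , y) → ¬r ((λ f u → b f (x f u)) , λ f u → y f (a f u)))

  pick-rep : ∀ {S Ls} → EnumAbove η Fs S Ls → ∀ (h : Subfam k → ℚ) K C → Rep K C → FlatSub η Fs S C →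
             (∀ {D} → FlatEq η Fs C D → h D ≡ h C) → Σℚ Ls (λ D → h D *ℚ δ D K) ≡ h C
  pick-rep {S} {Ls} (_ , distinct , complete) h K C (a , b) sub h-cong = Σℚ-pick {R = FlatEq η Fs} (Rep K) (rep? K)
      (λ (a , b) (c , d) → (λ f u → c f (b f u)) , λ f u → a f (d f u)) distinct (λ D → h D *ℚ δ D K) (h C)
      (All.universal value Ls) (Any.map (λ (c , d) → (λ f u → c f (a f u)) , λ f u → b f (d f u)) (complete C sub))
    where
    value : ∀ D → (Rep K D → h D *ℚ δ D K ≡ h C) × (¬ Rep K D → h D *ℚ δ D K ≡ 0ℚ)
    value D = (λ (c , d) → trans (cong₂ _*ℚ_ (h-cong ((λ f u → c f (b f u)) , λ f u → a f (d f u))) (indicator-yes (rep? K D) (c , d)))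
        (ℚP.*-identityʳ (h C))) ,
              λ ¬r → trans (cong (h D *ℚ_) (indicator-no (rep? K D) ¬r)) (ℚP.*-zeroʳ (h D))

  -- The kernel of a represented K equals the flat of exactly one entry of `Ls` if it contains the
  -- flat of S, and of none otherwise. So the sum of the `δ C` is `ζ S`.
  ν-sum : ∀ S Ls → EnumAbove η Fs S Ls → Σℚ Ls ν ≡ whitney (ζ S) Ms K₀
  ν-sum S Ls enum = trans (sym (whitney-Σ Ls δ Ms K₀)) (whitney-cong Represented value Ms represented-∷ K₀ represented₀)
    where
    value : ∀ K → Represented K → Σℚ Ls (λ C → δ C K) ≡ ζ S K
    value K (C , a , b) with all-vanish? (flat-basis S) K
    ... | yes h = trans (Σℚ-cong Ls (λ D → sym (ℚP.*-identityˡ (δ D K)))) (pick-rep enum (λ _ → 1ℚ) K C (a , b) (λ f u → a f (h f u)) (λ _ → refl))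
    ... | no ¬h = Σℚ-All (All.map (λ {D} sub → indicator-no (rep? K D) λ (c , d) → ¬h (λ f u → d f (sub f u))) (proj₁ enum))

  -- A form vanishing on the flat of S can be put into a subfamily or taken out without affecting
  -- `ζ S`, so the terms cancel in pairs.
  ζ-whitney-zero : ∀ S Ms → Any (OnFlat S) Ms → ∀ K → whitney (ζ S) Ms K ≡ 0ℚ
  ζ-whitney-zero S (φ ∷ Ms) (there a) K = cong₂ _-ℚ_ (ζ-whitney-zero S Ms a K) (ζ-whitney-zero S Ms a (φ ∷ K))
  ζ-whitney-zero S (φ ∷ Ms) (here v)  K = trans (cong (λ a → whitney (ζ S) Ms K -ℚ a) (sym (whitney-rel R same Ms (All.universal closed Ms) K (φ ∷ K)
      ((λ h f u → v f u ∷ h f u) , λ h f u → All.tail (h f u))))) (ℚP.+-inverseʳ (whitney (ζ S) Ms K))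
    where
    R : List (Fun N) → List (Fun N) → Set
    R K K′ = ((∀ f → Flat S f → Ker K f) → ∀ f → Flat S f → Ker K′ f) × ((∀ f → Flat S f → Ker K′ f) → ∀ f → Flat S f → Ker K f)
    closed : ∀ ψ K K′ → R K K′ → R (ψ ∷ K) (ψ ∷ K′)
    closed ψ K K′ (a , b) = (λ h f u → All.head (h f u) ∷ a (λ f u → All.tail (h f u)) f u) , λ h f u → All.head (h f u) ∷ b
        (λ f u → All.tail (h f u)) f u
    same : ∀ K K′ → R K K′ → ζ S K ≡ ζ S K′
    same K K′ (a , b) with all-vanish? (flat-basis S) K
    ... | yes h = sym (indicator-yes (all-vanish? (flat-basis S) K′) (a h))
    ... | no ¬h = sym (indicator-no (all-vanish? (flat-basis S) K′) (λ h → ¬h (b h)))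

  -- Every form chosen from `Ms` makes `ζ S` vanish, so only the empty subfamily contributes.
  ζ-whitney-one : ∀ S Ms → All (λ φ → ¬ OnFlat S φ) Ms → ∀ K → (∀ f → Flat S f → Ker K f) → whitney (ζ S) Ms K ≡ 1ℚ
  ζ-whitney-one S []       []       K h = indicator-yes (all-vanish? (flat-basis S) K) h
  ζ-whitney-one S (φ ∷ Ms) (n ∷ ns) K h = trans (cong₂ _-ℚ_ (ζ-whitney-one S Ms ns K h)
      (trans (whitney-rel (λ K _ → ¬ (∀ f → Flat S f → Ker K f)) (λ K _ → indicator-no (all-vanish? (flat-basis S) K)) Ms
        (All.universal (λ ψ K _ ¬h h → ¬h (λ f u → All.tail (h f u))) Ms) (φ ∷ K) K (λ h → n (λ f u → All.head (h f u)))) (whitney-zero Ms K))) refl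

  empty-sum : ∀ S → FlatEq η Fs S emptyS → whitney (ζ S) Ms K₀ ≡ 1ℚ
  empty-sum S (a , b) = ζ-whitney-one S Ms (AllP.tabulate⁺ λ i v → proper i (λ f e → v f (b f (e , λ j ())))) K₀ (λ f u → proj₁ u ∷ [])

  nonempty-sum : ∀ S → ¬ FlatEq η Fs S emptyS → whitney (ζ S) Ms K₀ ≡ 0ℚ
  nonempty-sum S ¬e with FinP.any? (λ i → S i BoolP.≟ true)
  ... | yes (i , e) = ζ-whitney-zero S Ms (AnyP.tabulate⁺ i (λ f u → proj₂ u i e)) K₀
  ... | no ¬i = ⊥-elim (¬e ((λ f u → proj₁ u , λ j ()) , λ f u → proj₁ u , λ i e → ⊥-elim (¬i (i , e))))

  enumeration : ∀ S → Σ (List (Subfam k)) (EnumAbove η Fs S)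
  enumeration S = representatives above , representatives-All (AllP.all-filter (sub? S) (allSubfams k)) , representatives-distinct above ,
      λ C sub → representatives-complete {above} (any-filter (sub? S) (λ (a , _) f u → a f (sub f u)) (marked C))
    where
    open Representatives flatEq? flatEq-refl flatEq-trans
    above : List (Subfam k)
    above = List.filter (sub? S) (allSubfams k)
    marked : ∀ C → Any (FlatEq η Fs C) (allSubfams k)
    marked C = Any.map (λ h → (λ f u → proj₁ u , λ i e → proj₂ u i (trans (h i) e)) , λ f u → proj₁ u , λ i e → proj₂ u i (trans (sym (h i)) e))
        (allSubfams-complete k C)

  closure : Subfam k → Fin k → Bool
  closure S i = does (onFlat? S (ratl (Fs i)))

  -- A strictly larger flat lies in fewer of the hyperplanes. Their number is the measure for the
  -- induction in `mobius-ν`.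
  closure-strict : ∀ S Y → FlatSub η Fs S Y → ¬ FlatEq η Fs S Y → count (closure Y) ℕ.< count (closure S)
  closure-strict S Y sub ¬eq with FinP.any? (λ i → (S i BoolP.≟ true) ×-dec ¬? (onFlat? Y (ratl (Fs i))))
  ... | yes (i , e , n) = count-strict (closure Y) (closure S)
          (λ j h → does-true (onFlat? S (ratl (Fs j))) (λ f u → true-does (onFlat? Y (ratl (Fs j))) h f (sub f u))) i
          (does-false (onFlat? Y (ratl (Fs i))) n) (does-true (onFlat? S (ratl (Fs i))) (λ f u → proj₂ u i e))
  ... | no ¬i = ⊥-elim (¬eq (sub , λ f u → proj₁ u , λ i e → onY i e f u))
    where
    onY : ∀ i → S i ≡ true → OnFlat Y (ratl (Fs i))
    onY i e with onFlat? Y (ratl (Fs i))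
    ... | yes h = h
    ... | no ¬h = ⊥-elim (¬i (i , e , ¬h))

  -- The Möbius function is the signed count of the subfamilies with a given intersection.
  module _ (μ : Subfam k → ℤ) (mob : IsMobius η Fs μ) where

    sums-agree : ∀ S Ls → EnumAbove η Fs S Ls → Σℚ Ls (λ C → toℚ (μ C)) ≡ Σℚ Ls ν
    sums-agree S Ls enum with flatEq? S emptyS
    ... | yes e = trans (sym (toℚ-sum μ Ls)) (trans (cong toℚ (proj₁ (proj₂ mob S Ls enum) e)) (sym (trans (ν-sum S Ls enum) (empty-sum S e))))
    ... | no ¬e = trans (sym (toℚ-sum μ Ls)) (trans (cong toℚ (proj₂ (proj₂ mob S Ls enum) ¬e)) (sym (trans (ν-sum S Ls enum) (nonempty-sum S ¬e))))

    -- The sums of μ and ν over the flats containing that of S agree. All terms but the one at S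
    -- agree by induction, hence so does that one.
    mobius-ν : ∀ S → toℚ (μ S) ≡ ν S
    mobius-ν S = go (suc (count (closure S))) S ℕP.≤-refl
      where
      go : ∀ r S → count (closure S) ℕ.< r → toℚ (μ S) ≡ ν S
      go (suc r) S l = ℚ-equal (trans (sym (Σℚ-pick {R = FlatEq η Fs} (FlatEq η Fs S) (flatEq? S)
          (λ (a , b) (c , d) → (λ f u → c f (b f u)) , λ f u → a f (d f u)) (proj₁ (proj₂ enum)) diff (diff S)
          (All.map (λ {Y} sub → (λ e → cong₂ _-ℚ_ (cong toℚ (sym (proj₁ mob S Y e))) (sym (ν-cong e))) , λ ¬e → trans
              (cong (_-ℚ ν Y) (go r Y (ℕP.<-≤-trans (closure-strict S Y sub ¬e) (ℕP.≤-pred l)))) (ℚP.+-inverseʳ (ν Y))) (proj₁ enum))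
          (proj₂ (proj₂ enum) S (λ f u → u)))) total)
        where
        Ls : List (Subfam k)
        Ls = proj₁ (enumeration S)
        enum : EnumAbove η Fs S Ls
        enum = proj₂ (enumeration S)
        diff : Subfam k → ℚ
        diff Y = toℚ (μ Y) -ℚ ν Y
        total : Σℚ Ls diff ≡ 0ℚ
        total = trans (Σℚ-minus Ls (λ C → toℚ (μ C)) ν) (trans (cong (_-ℚ Σℚ Ls ν) (sums-agree S Ls enum)) (ℚP.+-inverseʳ (Σℚ Ls ν)))
        ℚ-equal : ∀ {a b} → a -ℚ b ≡ 0ℚ → a ≡ b
        ℚ-equal {a} {b} e = trans (lem a b) (trans (cong (_+ℚ b) e) (ℚP.+-identityˡ b))
          where
          lem : ∀ a b → a ≡ (a -ℚ b) +ℚ b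
          lem = RS.solve-∀ ringℚ

  flat-dimension : ∀ C d → DimIs η Fs C d → d ≡ nullity (flatForms C)
  flat-dimension C d ((g , gU , ind) , maximal) = ℕP.≤-antisym (indep-≤ (flat-basis C) g gU ind)
    (ℕP.≮⇒≥ λ l → maximal (nullity (flatForms C)) l (Basis.vec (flat-basis C)) (Basis.inU (flat-basis C)) (Basis.indep (flat-basis C)))

  -- With μ replaced by the signed count ν, the order of summation is exchanged: each subfamily
  -- picks out the one flat that it represents and contributes its power of q.
  charPoly-whitney : ∀ {χ} → IsCharPoly η Fs χ → ∀ q → χ q ≡ whitney (λ K → q ^ℚ nullity K) Ms K₀
  charPoly-whitney {χ} (μ , mob , Ls , enum , dim , dimIs , e) q = trans (e q) (trans (sumℚList-map (λ C → toℚ (μ C) *ℚ (q ^ℚ dim C)) Ls)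
    (trans (Σℚ-cong Ls λ C → trans (cong₂ _*ℚ_ (mobius-ν μ mob C) (cong (q ^ℚ_) (flat-dimension C (dim C) (dimIs C))))
        (trans (ℚP.*-comm (ν C) (h C)) (sym (whitney-* (δ C) (h C) Ms K₀))))
    (trans (sym (whitney-Σ Ls (λ C K → h C *ℚ δ C K) Ms K₀)) (whitney-cong Represented value Ms represented-∷ K₀ represented₀))))
    where
    h : Subfam k → ℚ
    h C = q ^ℚ nullity (flatForms C)
    same-nullity : ∀ {d} C → Basis (Flat C) d → d ≡ nullity (flatForms C)
    same-nullity C b = basis-unique b (flat-basis C)
    value : ∀ K → Represented K → Σℚ Ls (λ C → h C *ℚ δ C K) ≡ q ^ℚ nullity K
    value K (C , a , b) = trans (pick-rep enum h K C (a , b) (λ f u → proj₁ u , λ i _ → proj₂ u i refl)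
        (λ {D} (c , d) → cong (q ^ℚ_) (same-nullity C (basis-⇔ d c (flat-basis D)) )))
      (cong (q ^ℚ_) (sym (same-nullity C (basis-⇔ a b (kernel-basis K)))))

-- Elimination of the path coordinates

≃-refl : ∀ {N} {K : List (Fun N)} → K ≃ K
≃-refl f = (λ u → u) , λ u → u

≃-sym : ∀ {N} {K K′ : List (Fun N)} → K ≃ K′ → K′ ≃ K
≃-sym e f = proj₂ (e f) , proj₁ (e f)

≃-trans : ∀ {N} {K K′ K″ : List (Fun N)} → K ≃ K′ → K′ ≃ K″ → K ≃ K″
≃-trans a b f = (λ u → proj₁ (b f) (proj₁ (a f) u)) , λ u → proj₂ (a f) (proj₂ (b f) u)

≃-∷ : ∀ {N} (φ : Fun N) {K K′} → K ≃ K′ → (φ ∷ K) ≃ (φ ∷ K′)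
≃-∷ φ e f = (λ { (v ∷ u) → v ∷ proj₁ (e f) u }) , λ { (v ∷ u) → v ∷ proj₂ (e f) u }

≃-swap : ∀ {N} (φ ψ : Fun N) K → (φ ∷ ψ ∷ K) ≃ (ψ ∷ φ ∷ K)
≃-swap φ ψ K f = (λ { (v ∷ w ∷ u) → w ∷ v ∷ u }) , λ { (v ∷ w ∷ u) → w ∷ v ∷ u }

Forces : ∀ {N} → List (Fun N) → Fun N → Set
Forces K φ = ∀ f → Ker K f → dot φ f ≡ 0ℚ

forces-∷ : ∀ {N} {K : List (Fun N)} {φ} ψ → Forces K φ → Forces (ψ ∷ K) φ
forces-∷ ψ h f (_ ∷ u) = h f u

forces-≃ : ∀ {N} (φ : Fun N) K → Forces K φ → K ≃ (φ ∷ K)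
forces-≃ φ K h f = (λ u → h f u ∷ u) , λ { (_ ∷ u) → u }

Inv : ∀ {N} → (List (Fun N) → ℚ) → Set
Inv F = ∀ K K′ → K ≃ K′ → F K ≡ F K′

Closed : ∀ {N} → (List (Fun N) → List (Fun N) → Set) → Set
Closed R = ∀ φ K K′ → R K K′ → R (φ ∷ K) (φ ∷ K′)

whitney-closed : ∀ {N} (R : List (Fun N) → List (Fun N) → Set) → Closed R → ∀ {Ψ Ψ′} → (∀ K K′ → R K K′ → Ψ K ≡ Ψ′ K′) →
                 ∀ Ms K K′ → R K K′ → whitney Ψ Ms K ≡ whitney Ψ′ Ms K′
whitney-closed R c e Ms = whitney-rel R e Ms (All.universal c Ms)

whitney-++ : ∀ {N} (Ψ : List (Fun N) → ℚ) Xs Ys K → whitney Ψ (Xs ++ Ys) K ≡ whitney (whitney Ψ Ys) Xs K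
whitney-++ Ψ []       Ys K = refl
whitney-++ Ψ (φ ∷ Xs) Ys K = cong₂ _-ℚ_ (whitney-++ Ψ Xs Ys K) (whitney-++ Ψ Xs Ys (φ ∷ K))

-- The pairing of `ζ-whitney-zero`, for any summand that depends only on the common kernel.
whitney-forced : ∀ {N} {F : List (Fun N) → ℚ} → Inv F → ∀ Ms K → Any (Forces K) Ms → whitney F Ms K ≡ 0ℚ
whitney-forced inv (φ ∷ Ms) K (here h)  = trans (cong (_-ℚ whitney _ Ms (φ ∷ K))
    (whitney-closed _≃_ (λ φ K K′ → ≃-∷ φ) inv Ms K (φ ∷ K) (forces-≃ φ K h))) (ℚP.+-inverseʳ (whitney _ Ms (φ ∷ K)))
whitney-forced inv (φ ∷ Ms) K (there a) = cong₂ _-ℚ_ (whitney-forced inv Ms K a) (whitney-forced inv Ms (φ ∷ K) (Any.map (forces-∷ φ) a))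

-- A sublist containing φ is evaluated at a list that forces φ, where F vanishes. Only the empty
-- sublist is left.
whitney-unit : ∀ {N} {F : List (Fun N) → ℚ} Ms → (∀ K → Any (Forces K) Ms → F K ≡ 0ℚ) → ∀ K → whitney F Ms K ≡ F K
whitney-unit []       h K = refl
whitney-unit {F = F} (φ ∷ Ms) h K = trans (cong₂ _-ℚ_ (whitney-unit Ms (λ K a → h K (there a)) K)
  (trans (whitney-closed (λ K _ → Forces K φ) (λ ψ K _ → forces-∷ ψ) (λ K _ f → h K (here f)) Ms (φ ∷ K) K (λ f u → All.head u)) (whitney-zero Ms K)))
      (lem (F K))
  where
  lem : ∀ a → a -ℚ 0ℚ ≡ a
  lem = RS.solve-∀ ringℚ

whitney-+ : ∀ {N} (F G : List (Fun N) → ℚ) Ms K → whitney (λ K → F K +ℚ G K) Ms K ≡ whitney F Ms K +ℚ whitney G Ms K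
whitney-+ F G []       K = refl
whitney-+ F G (φ ∷ Ms) K = trans (cong₂ _-ℚ_ (whitney-+ F G Ms K) (whitney-+ F G Ms (φ ∷ K)))
    (lem (whitney F Ms K) (whitney G Ms K) (whitney F Ms (φ ∷ K)) (whitney G Ms (φ ∷ K)))
  where
  lem : ∀ a b c d → (a +ℚ b) -ℚ (c +ℚ d) ≡ (a -ℚ c) +ℚ (b -ℚ d)
  lem = RS.solve-∀ ringℚ

_∸ᶠ_ : ∀ {N} → Fun N → Fun N → Fun N
(φ ∸ᶠ ψ) i = φ i -ℚ ψ i

-- Eliminates one coordinate a subject to the hyperplanes a + h = 0, one for each h in the list: either the coordinate is free
-- (factor c), or a nonempty subfamily is chosen, whose first member determines a while the others impose equations on the base.
eliminate : ∀ {N} → ℚ → List (Fun N) → (List (Fun N) → ℚ) → List (Fun N) → ℚ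
eliminate c []       F K = c *ℚ F K
eliminate c (g ∷ gs) F K = eliminate c gs F K -ℚ whitney F (map (_∸ᶠ g) gs) K

iterate : ∀ {N} → ℚ → List (Fun N) → (List (Fun N) → ℚ) → ℕ → List (Fun N) → ℚ
iterate c H F zero    = F
iterate c H F (suc n) = eliminate c H (iterate c H F n)

eliminate-rel : ∀ {N} (R : List (Fun N) → List (Fun N) → Set) → Closed R → ∀ c H {F F′} → (∀ K K′ → R K K′ → F K ≡ F′ K′) →
                ∀ K K′ → R K K′ → eliminate c H F K ≡ eliminate c H F′ K′
eliminate-rel R cl c []       e K K′ r = cong (c *ℚ_) (e K K′ r)
eliminate-rel R cl c (g ∷ gs) e K K′ r = cong₂ _-ℚ_ (eliminate-rel R cl c gs e K K′ r) (whitney-closed R cl e (map (_∸ᶠ g) gs) K K′ r)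

iterate-rel : ∀ {N} (R : List (Fun N) → List (Fun N) → Set) → Closed R → ∀ c H {F F′} → (∀ K K′ → R K K′ → F K ≡ F′ K′) →
              ∀ n K K′ → R K K′ → iterate c H F n K ≡ iterate c H F′ n K′
iterate-rel R cl c H e zero    = e
iterate-rel R cl c H e (suc n) = eliminate-rel R cl c H (iterate-rel R cl c H e n)

iterate-inv : ∀ {N} c H {F : List (Fun N) → ℚ} → Inv F → ∀ n → Inv (iterate c H F n)
iterate-inv c H inv = iterate-rel _≃_ (λ φ K K′ → ≃-∷ φ) c H inv

eliminate-+ : ∀ {N} c H (F G : List (Fun N) → ℚ) K → eliminate c H (λ K → F K +ℚ G K) K ≡ eliminate c H F K +ℚ eliminate c H G K
eliminate-+ c []       F G K = ℚP.*-distribˡ-+ c (F K) (G K)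
eliminate-+ c (g ∷ gs) F G K = trans (cong₂ _-ℚ_ (eliminate-+ c gs F G K) (whitney-+ F G (map (_∸ᶠ g) gs) K))
  (lem (eliminate c gs F K) (eliminate c gs G K) (whitney F (map (_∸ᶠ g) gs) K) (whitney G (map (_∸ᶠ g) gs) K))
  where
  lem : ∀ a b c d → (a +ℚ b) -ℚ (c +ℚ d) ≡ (a -ℚ c) +ℚ (b -ℚ d)
  lem = RS.solve-∀ ringℚ

Same : ∀ {N} → List (Fun N) → List (Fun N) → Set
Same K K′ = K ≡ K′

same-closed : ∀ {N} → Closed (Same {N})
same-closed φ K .K refl = refl

iterate-+ : ∀ {N} c H (F G : List (Fun N) → ℚ) n K → iterate c H (λ K → F K +ℚ G K) n K ≡ iterate c H F n K +ℚ iterate c H G n K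
iterate-+ c H F G zero    K = refl
iterate-+ c H F G (suc n) K = trans (eliminate-rel Same same-closed c H (λ { K .K refl → iterate-+ c H F G n K }) K K refl)
    (eliminate-+ c H (iterate c H F n) (iterate c H G n) K)

eliminate-0 : ∀ {N} c H (K : List (Fun N)) → eliminate c H (λ _ → 0ℚ) K ≡ 0ℚ
eliminate-0 c []       K = ℚP.*-zeroʳ c
eliminate-0 c (g ∷ gs) K = cong₂ _-ℚ_ (eliminate-0 c gs K) (whitney-zero (map (_∸ᶠ g) gs) K)

-- The factor c enters only through the term in which the coordinate stays free. This is how q - k
-- turns into q - (k + 1).
eliminate-shift : ∀ {N} c H (F : List (Fun N) → ℚ) K → eliminate c H F K -ℚ F K ≡ eliminate (c -ℚ 1ℚ) H F K
eliminate-shift c [] F K = lem c (F K)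
  where
  lem : ∀ c a → c *ℚ a -ℚ a ≡ (c -ℚ 1ℚ) *ℚ a
  lem = RS.solve-∀ ringℚ
eliminate-shift c (g ∷ gs) F K = trans (lem (eliminate c gs F K) (whitney F (map (_∸ᶠ g) gs) K) (F K))
    (cong (_-ℚ whitney F (map (_∸ᶠ g) gs) K) (eliminate-shift c gs F K))
  where
  lem : ∀ a b d → a -ℚ b -ℚ d ≡ a -ℚ d -ℚ b
  lem = RS.solve-∀ ringℚ

-- On K the value of g repeats that of a later r. Among the terms in which g is chosen first, those
-- with and without r cancel because `r ∸ᶠ g` is forced.
iterate-drop : ∀ {N} c g gs {F : List (Fun N) → ℚ} → Inv F → ∀ n K → Any (λ r → Forces K (r ∸ᶠ g)) gs → iterate c (g ∷ gs) F n K ≡ iterate c gs F n K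
iterate-drop c g gs inv zero    K a = refl
iterate-drop c g gs {F} inv (suc n) K a = trans (cong₂ _-ℚ_
    (eliminate-rel R closed c gs (λ { K .K (refl , a) → iterate-drop c g gs inv n K a }) K K (refl , a))
    (whitney-forced (iterate-inv c (g ∷ gs) inv n) (map (_∸ᶠ g) gs) K (AnyP.map⁺ a))) (lem (eliminate c gs (iterate c gs F n) K))
  where
  R : List (Fun _) → List (Fun _) → Set
  R K K′ = K ≡ K′ × Any (λ r → Forces K (r ∸ᶠ g)) gs
  closed : Closed R
  closed φ K .K (refl , a) = refl , Any.map (forces-∷ φ) a
  lem : ∀ a → a -ℚ 0ℚ ≡ a
  lem = RS.solve-∀ ringℚ

-- If F vanishes wherever g coincides with a later element, choosing g always excludes the later elements.
iterate-separated : ∀ {N} c g gs {F : List (Fun N) → ℚ} → (∀ K → Any (λ r → Forces K (r ∸ᶠ g)) gs → F K ≡ 0ℚ) →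
                    ∀ n K → iterate c (g ∷ gs) F n K ≡ iterate (c -ℚ 1ℚ) gs F n K
iterate-separated c g gs vanish zero    K = refl
iterate-separated c g gs {F} vanish (suc n) K = trans (eliminate-rel Same same-closed c (g ∷ gs)
    (λ { K .K refl → iterate-separated c g gs vanish n K }) K K refl)
  (trans (cong (λ a → eliminate c gs G K -ℚ a) (whitney-unit (map (_∸ᶠ g) gs) (λ K a → G-vanish K (AnyP.map⁻ a)) K)) (eliminate-shift c gs G K))
  where
  G : List (Fun _) → ℚ
  G = iterate (c -ℚ 1ℚ) gs F n
  iterate-0 : ∀ n K → iterate (c -ℚ 1ℚ) gs (λ _ → 0ℚ) n K ≡ 0ℚ
  iterate-0 zero    K = refl
  iterate-0 (suc n) K = trans (eliminate-rel Same same-closed (c -ℚ 1ℚ) gs (λ { K .K refl → iterate-0 n K }) K K refl) (eliminate-0 (c -ℚ 1ℚ) gs K)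
  G-vanish : ∀ K → Any (λ r → Forces K (r ∸ᶠ g)) gs → G K ≡ 0ℚ
  G-vanish K a = trans (iterate-rel (λ K _ → Any (λ r → Forces K (r ∸ᶠ g)) gs) (λ φ K _ a → Any.map (forces-∷ φ) a) (c -ℚ 1ℚ) gs
      (λ K _ → vanish K) n K K a) (iterate-0 n K)

-- Polynomials and exponential sums in q

power : ∀ {N} → ℚ → List (Fun N) → ℚ
power q K = q ^ℚ nullity K

power-inv : ∀ {N} q → Inv {N} (power q)
power-inv q K K′ e = cong (q ^ℚ_) (nullity-≃ e)

whitney-inv : ∀ {N} {Ψ : List (Fun N) → ℚ} → Inv Ψ → ∀ Ms → Inv (whitney Ψ Ms)
whitney-inv inv Ms K K′ = whitney-closed _≃_ (λ φ K K′ → ≃-∷ φ) inv Ms K K′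

addP : Poly → Poly → Poly
addP []       r        = r
addP (a ∷ p)  []       = a ∷ p
addP (a ∷ p)  (b ∷ r)  = (a +ℚ b) ∷ addP p r

negP : Poly → Poly
negP = map (λ a → -ℚ a)

monomial : ℕ → Poly
monomial zero    = 1ℚ ∷ []
monomial (suc d) = 0ℚ ∷ monomial d

eval-addP : ∀ p r q → eval (addP p r) q ≡ eval p q +ℚ eval r q
eval-addP []      r       q = sym (ℚP.+-identityˡ (eval r q))
eval-addP (a ∷ p) []      q = sym (ℚP.+-identityʳ (eval (a ∷ p) q))
eval-addP (a ∷ p) (b ∷ r) q = trans (cong (λ x → a +ℚ b +ℚ q *ℚ x) (eval-addP p r q)) (lem a b q (eval p q) (eval r q))
  where
  lem : ∀ a b q x y → a +ℚ b +ℚ q *ℚ (x +ℚ y) ≡ (a +ℚ q *ℚ x) +ℚ (b +ℚ q *ℚ y)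
  lem = RS.solve-∀ ringℚ

eval-negP : ∀ p q → eval (negP p) q ≡ -ℚ eval p q
eval-negP []      q = refl
eval-negP (a ∷ p) q = trans (cong (λ x → (-ℚ a) +ℚ q *ℚ x) (eval-negP p q)) (lem a q (eval p q))
  where
  lem : ∀ a q x → (-ℚ a) +ℚ q *ℚ (-ℚ x) ≡ -ℚ (a +ℚ q *ℚ x)
  lem = RS.solve-∀ ringℚ

eval-monomial : ∀ d q → eval (monomial d) q ≡ q ^ℚ d
eval-monomial zero    q = trans (cong (1ℚ +ℚ_) (ℚP.*-zeroʳ q)) (ℚP.+-identityʳ 1ℚ)
eval-monomial (suc d) q = trans (ℚP.+-identityˡ (q *ℚ eval (monomial d) q)) (cong (q *ℚ_) (eval-monomial d q))

whitneyP : ∀ {N} → List (Fun N) → List (Fun N) → Poly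
whitneyP []       K = monomial (nullity K)
whitneyP (φ ∷ Ms) K = addP (whitneyP Ms K) (negP (whitneyP Ms (φ ∷ K)))

eval-whitneyP : ∀ {N} (Ms K : List (Fun N)) q → eval (whitneyP Ms K) q ≡ whitney (power q) Ms K
eval-whitneyP []       K q = eval-monomial (nullity K) q
eval-whitneyP (φ ∷ Ms) K q = trans (eval-addP (whitneyP Ms K) (negP (whitneyP Ms (φ ∷ K))) q)
    (cong₂ _+ℚ_ (eval-whitneyP Ms K q) (trans (eval-negP (whitneyP Ms (φ ∷ K)) q) (cong (λ a → -ℚ a) (eval-whitneyP Ms (φ ∷ K) q))))

module Exponential (t : ℕ) where

  base-at : ℚ → ℕ → ℚ
  base-at q k = q -ℚ toℚ (+ k)

  Good : (ℕ → ℚ → ℚ) → Set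
  Good F = Σ (Fin (suc t) → Poly) λ p → ∀ n q → F n q ≡ sumℚ (λ (j : Fin (suc t)) → eval (p j) q *ℚ (base-at q (toℕ j) ^ℚ n))

  good-+ : ∀ {F G} → Good F → Good G → Good (λ n q → F n q +ℚ G n q)
  good-+ (p , e) (r , f) = (λ j → addP (p j) (r j)) , λ n q → trans (cong₂ _+ℚ_ (e n q) (f n q))
    (trans (sym (sumℚ-+ (λ j → eval (p j) q *ℚ (base-at q (toℕ j) ^ℚ n)) (λ j → eval (r j) q *ℚ (base-at q (toℕ j) ^ℚ n))))
      (sumℚ-cong (λ j → trans (sym (ℚP.*-distribʳ-+ (base-at q (toℕ j) ^ℚ n) (eval (p j) q) (eval (r j) q)))
          (cong (_*ℚ (base-at q (toℕ j) ^ℚ n)) (sym (eval-addP (p j) (r j) q))))))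

  good-≡ : ∀ {F G} → (∀ n q → G n q ≡ F n q) → Good F → Good G
  good-≡ h (p , e) = p , λ n q → trans (h n q) (e n q)

  sumℚ-at : ∀ {N} (i : Fin N) (f : Fin N → ℚ) → (∀ j → i ≢ j → f j ≡ 0ℚ) → sumℚ f ≡ f i
  sumℚ-at Fin.zero    f h = trans (cong (f Fin.zero +ℚ_) (sumℚ-zero (λ j → h (Fin.suc j) (λ ())))) (ℚP.+-identityʳ (f Fin.zero))
  sumℚ-at (Fin.suc i) f h = trans (cong₂ _+ℚ_ (h Fin.zero (λ ())) (sumℚ-at i (λ j → f (Fin.suc j))
      (λ j ne → h (Fin.suc j) (λ e → ne (FinP.suc-injective e))))) (ℚP.+-identityˡ (f (Fin.suc i)))

  good-term : ∀ k → k ℕ.≤ t → ∀ P → Good (λ n q → eval P q *ℚ (base-at q k ^ℚ n))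
  good-term k l P = p , λ n q → sym (trans (sumℚ-at k′ (λ j → eval (p j) q *ℚ (base-at q (toℕ j) ^ℚ n))
      (λ j ne → trans (cong (λ P → eval P q *ℚ (base-at q (toℕ j) ^ℚ n)) (p-other ne)) (ℚP.*-zeroˡ (base-at q (toℕ j) ^ℚ n))))
    (cong₂ (λ P j → eval P q *ℚ (base-at q j ^ℚ n)) p-self (FinP.toℕ-fromℕ< (ℕ.s≤s l))))
    where
    k′ : Fin (suc t)
    k′ = Fin.fromℕ< (ℕ.s≤s l)
    p : Fin (suc t) → Poly
    p j = if does (k′ Fin.≟ j) then P else []
    p-self : p k′ ≡ P
    p-self = cong (λ b → if b then P else []) (does-true (k′ Fin.≟ k′) refl)
    p-other : ∀ {j} → k′ ≢ j → p j ≡ []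
    p-other {j} ne = cong (λ b → if b then P else []) (does-false (k′ Fin.≟ j) ne)

  module _ {N : ℕ} where

    -- Here `s` counts the values already known to be distinct from all others, `H` holds those
    -- still to be compared, and `L` consists of the forms of the base, including the inserted ones.
    value : ℕ → List (Fun N) → List (Fun N) → List (Fun N) → ℕ → ℚ → ℚ
    value s H L K n q = iterate (base-at q s) H (whitney (power q) L) n K

    iterate-[] : ∀ c (F : List (Fun N) → ℚ) n K → iterate c [] F n K ≡ F K *ℚ (c ^ℚ n)
    iterate-[] c F zero    K = sym (ℚP.*-identityʳ (F K))
    iterate-[] c F (suc n) K = trans (cong (c *ℚ_) (iterate-[] c F n K)) (lem c (F K) (c ^ℚ n))
      where
      lem : ∀ c a b → c *ℚ (a *ℚ b) ≡ a *ℚ (c *ℚ b)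
      lem = RS.solve-∀ ringℚ

    base-at-suc : ∀ q s → base-at q s -ℚ 1ℚ ≡ base-at q (suc s)
    base-at-suc q s = trans (lem q (toℚ (+ s))) (cong (λ a → q -ℚ a) (sym (toℚ-+ 1ℤ (+ s))))
      where
      lem : ∀ q a → q -ℚ a -ℚ 1ℚ ≡ q -ℚ (1ℚ +ℚ a)
      lem = RS.solve-∀ ringℚ

    -- The hyperplane of r ∸ᶠ g is inserted by deletion and restriction, for every later r.
    good-value : ∀ H s L K → s ℕ.+ length H ℕ.≤ t → Good (value s H L K)
    good-value [] s L K l = good-≡ (λ n q → trans (iterate-[] (base-at q s) (whitney (power q) L) n K)
        (cong (_*ℚ (base-at q s ^ℚ n)) (sym (eval-whitneyP L K q))))
      (good-term s (subst (ℕ._≤ t) (ℕP.+-identityʳ s) l) (whitneyP L K))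
    good-value (g ∷ gs) s L K l = separate [] gs refl L []
      where
      l-drop : s ℕ.+ length gs ℕ.≤ t
      l-drop = ℕP.≤-trans (ℕP.+-monoʳ-≤ s (ℕP.n≤1+n (length gs))) l
      Kills : List (Fun N) → Fun N → Set
      Kills L r = ∀ q K → Forces K (r ∸ᶠ g) → whitney (power q) L K ≡ 0ℚ
      -- The alternating sum over `φ ∷ L` is F(K) - F(φ ∷ K). Hence F is the sum for the arrangement
      -- with φ inserted plus the sum for the restriction to φ, and this is preserved by the
      -- elimination.
      deletion : ∀ φ L n q → value s (g ∷ gs) L K n q ≡ value s (g ∷ gs) (φ ∷ L) K n q +ℚ value s (g ∷ gs) L (φ ∷ K) n q
      deletion φ L n q = trans (iterate-rel Same same-closed c (g ∷ gs) (λ { K .K refl → lem (F K) (F (φ ∷ K)) }) n K K refl)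
        (trans (iterate-+ c (g ∷ gs) (whitney (power q) (φ ∷ L)) (λ K → F (φ ∷ K)) n K)
          (cong (value s (g ∷ gs) (φ ∷ L) K n q +ℚ_) (iterate-rel (λ K K′ → (φ ∷ K) ≃ K′)
              (λ ψ K K′ e → ≃-trans {K = φ ∷ ψ ∷ K} {ψ ∷ φ ∷ K} {ψ ∷ K′} (≃-swap φ ψ K) (≃-∷ ψ {φ ∷ K} {K′} e)) c (g ∷ gs)
            (λ K K′ e → whitney-inv (power-inv q) L (φ ∷ K) K′ e) n K (φ ∷ K) (≃-refl {K = φ ∷ K}))))
        where
        c : ℚ
        c = base-at q s
        F : List (Fun N) → ℚ
        F = whitney (power q) L
        lem : ∀ a b → a ≡ (a -ℚ b) +ℚ b
        lem = RS.solve-∀ ringℚ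
      -- `done` collects the values r whose coincidence with g has been excluded by an inserted
      -- hyperplane. Once all of gs is done, g splits off and `s` increases by one.
      separate : ∀ done todo → gs ≡ done ++ todo → ∀ L → All (Kills L) done → Good (value s (g ∷ gs) L K)
      separate done [] e L kills = good-≡ (λ n q → trans (iterate-separated (base-at q s) g gs (λ K a → vanish q K (AllP.++⁺ kills []) a) n K)
          (cong (λ c → iterate c gs (whitney (power q) L) n K) (base-at-suc q s)))
              (good-value gs (suc s) L K (subst (ℕ._≤ t) (ℕP.+-suc s (length gs)) l))
        where
        vanish : ∀ q K → All (Kills L) (done ++ []) → Any (λ r → Forces K (r ∸ᶠ g)) gs → whitney (power q) L K ≡ 0ℚ
        vanish q K ks a = go ks (subst (Any (λ r → Forces K (r ∸ᶠ g))) e a)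
          where
          go : ∀ {rs} → All (Kills L) rs → Any (λ r → Forces K (r ∸ᶠ g)) rs → whitney (power q) L K ≡ 0ℚ
          go (k ∷ ks) (here h)  = k q K h
          go (k ∷ ks) (there a) = go ks a
      -- With the hyperplane inserted, r joins `done`. On the restriction r and g coincide, so g is
      -- dropped while `s` stays, and `s` plus the number of values decreases.
      separate done (r ∷ todo) e L kills = good-≡ (deletion (r ∸ᶠ g) L)
        (good-+ (separate (done ++ r ∷ []) todo (trans e (sym (ListP.++-assoc done (r ∷ []) todo))) ((r ∸ᶠ g) ∷ L)
                  (AllP.++⁺ (All.map (λ {r′} k q K h → cong₂ _-ℚ_ (k q K h) (k q ((r ∸ᶠ g) ∷ K) (forces-∷ {φ = r′ ∸ᶠ g} (r ∸ᶠ g) h))) kills)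
                    ((λ q K h → whitney-forced (power-inv q) ((r ∸ᶠ g) ∷ L) K (here h)) ∷ [])))
                (good-≡ (λ n q → iterate-drop (base-at q s) g gs (whitney-inv (power-inv q) L) n ((r ∸ᶠ g) ∷ K)
                    (subst (Any (λ r′ → Forces ((r ∸ᶠ g) ∷ K) (r′ ∸ᶠ g))) (sym e) (AnyP.++⁺ʳ done (here (λ f u → All.head u)))))
                  (good-value gs s L ((r ∸ᶠ g) ∷ K) l-drop)))

-- Comparison of arrangements and towers of path coordinates

whitney-rel₂ : ∀ {X : Set} {N N′} (a : X → Fun N) (b : X → Fun N′) (R : List (Fun N) → List (Fun N′) → Set) →
               (∀ x K K′ → R K K′ → R (a x ∷ K) (b x ∷ K′)) → ∀ {Ψ Ψ′} → (∀ K K′ → R K K′ → Ψ K ≡ Ψ′ K′) →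
               ∀ xs K K′ → R K K′ → whitney Ψ (map a xs) K ≡ whitney Ψ′ (map b xs) K′
whitney-rel₂ a b R c e []       K K′ r = e K K′ r
whitney-rel₂ a b R c e (x ∷ xs) K K′ r = cong₂ _-ℚ_ (whitney-rel₂ a b R c e xs K K′ r) (whitney-rel₂ a b R c e xs (a x ∷ K) (b x ∷ K′) (c x K K′ r))

whitney-↭ : ∀ {N} {F : List (Fun N) → ℚ} → Inv F → ∀ {Xs Ys} → Xs ↭ Ys → ∀ K → whitney F Xs K ≡ whitney F Ys K
whitney-↭ inv Perm.refl K = refl
whitney-↭ inv (Perm.prep φ p) K = cong₂ _-ℚ_ (whitney-↭ inv p K) (whitney-↭ inv p (φ ∷ K))
whitney-↭ {F = F} inv (Perm.swap {Xs} {Ys} φ ψ p) K = trans (lem (whitney F Xs K) (whitney F Xs (ψ ∷ K)) (whitney F Xs (φ ∷ K))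
    (whitney F Xs (ψ ∷ φ ∷ K)))
  (cong₂ _-ℚ_ (cong₂ _-ℚ_ (whitney-↭ inv p K) (whitney-↭ inv p (φ ∷ K)))
    (cong₂ _-ℚ_ (whitney-↭ inv p (ψ ∷ K)) (trans (whitney-↭ inv p (ψ ∷ φ ∷ K)) (whitney-inv inv Ys (ψ ∷ φ ∷ K) (φ ∷ ψ ∷ K) (≃-swap ψ φ K)))))
  where
  lem : ∀ a b c d → (a -ℚ b) -ℚ (c -ℚ d) ≡ (a -ℚ c) -ℚ (b -ℚ d)
  lem = RS.solve-∀ ringℚ
whitney-↭ inv (Perm.trans p r) K = trans (whitney-↭ inv p K) (whitney-↭ inv r K)

-- A sublist containing a form of `Xs` forces some form of `Ys`, so by `whitney-forced` the terms
-- containing it cancel. Applied both ways in `whitney-same`, this allows different normal vectors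
-- and repetitions of a hyperplane.
whitney-absorb : ∀ {N} {F : List (Fun N) → ℚ} → Inv F → ∀ Xs Ys K → All (λ φ → Any (Forces (φ ∷ K)) Ys) Xs → whitney F (Xs ++ Ys) K ≡ whitney F Ys K
whitney-absorb inv []       Ys K [] = refl
whitney-absorb {F = F} inv (φ ∷ Xs) Ys K (a ∷ as) = trans (cong₂ _-ℚ_ (whitney-absorb inv Xs Ys K as)
    (whitney-forced inv (Xs ++ Ys) (φ ∷ K) (AnyP.++⁺ʳ Xs a))) (lem (whitney F Ys K))
  where
  lem : ∀ a → a -ℚ 0ℚ ≡ a
  lem = RS.solve-∀ ringℚ

whitney-same : ∀ {N} {F : List (Fun N) → ℚ} → Inv F → ∀ Xs Ys K → All (λ φ → Any (Forces (φ ∷ K)) Ys) Xs → All (λ φ → Any (Forces (φ ∷ K)) Xs) Ys →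
    whitney F Xs K ≡ whitney F Ys K
whitney-same inv Xs Ys K a b = trans (sym (whitney-absorb inv Ys Xs K b))
    (trans (whitney-↭ inv (PermP.++-comm Ys Xs) K) (whitney-absorb inv Xs Ys K a))

dot-cons : ∀ {N} c (φ : Fun N) f → dot (cons c φ) f ≡ c *ℚ f Fin.zero +ℚ dot φ (tail f)
dot-cons c φ f = cong (_+ℚ dot φ (tail f)) (ℚP.*-comm (f Fin.zero) c)

dot-cons₀ : ∀ {N} (φ : Fun N) f → dot (cons 0ℚ φ) f ≡ dot φ (tail f)
dot-cons₀ φ f = trans (dot-cons 0ℚ φ f) (trans (cong (_+ℚ dot φ (tail f)) (ℚP.*-zeroˡ (f Fin.zero))) (ℚP.+-identityˡ (dot φ (tail f))))

dot-cons₁ : ∀ {N} (φ : Fun N) f → dot (cons 1ℚ φ) f ≡ f Fin.zero +ℚ dot φ (tail f)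
dot-cons₁ φ f = trans (dot-cons 1ℚ φ f) (cong (_+ℚ dot φ (tail f)) (ℚP.*-identityˡ (f Fin.zero)))

Ker-cons₀ : ∀ {N} (K : List (Fun N)) f → (Ker (map (cons 0ℚ) K) f → Ker K (tail f)) × (Ker K (tail f) → Ker (map (cons 0ℚ) K) f)
Ker-cons₀ []      f = (λ u → []) , λ u → []
Ker-cons₀ (φ ∷ K) f = (λ { (v ∷ u) → trans (sym (dot-cons₀ φ f)) v ∷ proj₁ (Ker-cons₀ K f) u }) ,
    λ { (v ∷ u) → trans (dot-cons₀ φ f) v ∷ proj₂ (Ker-cons₀ K f) u }

nullity-free : ∀ {N} (K : List (Fun N)) → nullity (map (cons 0ℚ) K) ≡ suc (nullity K)
nullity-free K = nullity-basis (map (cons 0ℚ) K) (basis-⇔ (λ f → proj₂ (Ker-cons₀ K f)) (λ f → proj₁ (Ker-cons₀ K f))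
    (basis-free (Ker-zero K) (kernel-basis K)))

nullity-graph : ∀ {N} g (K : List (Fun N)) → nullity (cons 1ℚ g ∷ map (cons 0ℚ) K) ≡ nullity K
nullity-graph {N} g K = nullity-basis (cons 1ℚ g ∷ map (cons 0ℚ) K) (basis-⇔ back forth (basis-graph h (kernel-basis K)))
  where
  h : Fun N
  h i = (-ℚ 1ℚ) *ℚ g i
  dot-h : ∀ f → dot h f ≡ -ℚ dot g f
  dot-h f = trans (dot-* (-ℚ 1ℚ) g f) (trans (sym (ℚP.neg-distribˡ-* 1ℚ (dot g f))) (cong (λ a → -ℚ a) (ℚP.*-identityˡ (dot g f))))
  back : ∀ f → f Fin.zero ≡ dot h (tail f) × Ker K (tail f) → Ker (cons 1ℚ g ∷ map (cons 0ℚ) K) f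
  back f (e , u) = trans (dot-cons₁ g f) (trans (cong (_+ℚ dot g (tail f)) (trans e (dot-h (tail f)))) (ℚP.+-inverseˡ (dot g (tail f)))) ∷ proj₂
      (Ker-cons₀ K f) u
  forth : ∀ f → Ker (cons 1ℚ g ∷ map (cons 0ℚ) K) f → f Fin.zero ≡ dot h (tail f) × Ker K (tail f)
  forth f (v ∷ u) = trans (lem (f Fin.zero) (dot g (tail f))) (trans (cong (_-ℚ dot g (tail f)) (trans (sym (dot-cons₁ g f)) v))
      (trans (ℚP.+-identityˡ (-ℚ dot g (tail f))) (sym (dot-h (tail f))))) , proj₁ (Ker-cons₀ K f) u
    where
    lem : ∀ a b → a ≡ a +ℚ b -ℚ b
    lem = RS.solve-∀ ringℚ

dot-∸ : ∀ {N} (φ ψ f : Fun N) → dot (φ ∸ᶠ ψ) f ≡ dot φ f -ℚ dot ψ f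
dot-∸ φ ψ f = trans (sumℚ-cong (λ i → lem″ (f i) (φ i) (ψ i))) (trans (sumℚ-+ (λ i → f i *ℚ φ i) (λ i → (-ℚ 1ℚ) *ℚ (f i *ℚ ψ i)))
  (cong (dot φ f +ℚ_) (trans (sumℚ-* (-ℚ 1ℚ) (λ i → f i *ℚ ψ i)) (trans (sym (ℚP.neg-distribˡ-* 1ℚ (dot ψ f)))
      (cong (λ a → -ℚ a) (ℚP.*-identityˡ (dot ψ f)))))))
  where
  lem″ : ∀ a b c → a *ℚ (b -ℚ c) ≡ a *ℚ b +ℚ (-ℚ 1ℚ) *ℚ (a *ℚ c)
  lem″ = RS.solve-∀ ringℚ

module _ {m : ℕ} where

  liftⁿ : ∀ n → Fun m → Fun (n ℕ.+ m)
  liftⁿ zero    φ = φ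
  liftⁿ (suc n) φ = cons 0ℚ (liftⁿ n φ)

  dropⁿ : ∀ n → Fun (n ℕ.+ m) → Fun m
  dropⁿ zero    f = f
  dropⁿ (suc n) f = dropⁿ n (tail f)

  dot-liftⁿ : ∀ n φ f → dot (liftⁿ n φ) f ≡ dot φ (dropⁿ n f)
  dot-liftⁿ zero    φ f = refl
  dot-liftⁿ (suc n) φ f = trans (dot-cons₀ (liftⁿ n φ) f) (dot-liftⁿ n φ (tail f))

  towers : List (Fun m) → List (Fun m) → ∀ n → List (Fun (n ℕ.+ m))
  towers L H zero    = L
  towers L H (suc n) = map (λ g → cons 1ℚ (liftⁿ n g)) H ++ map (cons 0ℚ) (towers L H n)

  whitney-free : ∀ {N} q (Ms : List (Fun N)) Kb Ks → Kb ≃ map (cons 0ℚ) Ks → whitney (power q) (map (cons 0ℚ) Ms) Kb ≡ q *ℚ whitney (power q) Ms Ks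
  whitney-free q Ms Kb Ks e = trans (whitney-rel₂ (cons 0ℚ) (λ φ → φ) (λ Kb Ks → Kb ≃ map (cons 0ℚ) Ks)
      (λ φ K K′ r → ≃-∷ (cons 0ℚ φ) {K} {map (cons 0ℚ) K′} r)
      (λ K K′ r → cong (q ^ℚ_) (trans (nullity-≃ {K = K} {map (cons 0ℚ) K′} r) (nullity-free K′))) Ms Kb Ks e)
    (trans (whitney-* (power q) q (map (λ φ → φ) Ms) Ks) (cong (λ Ms → q *ℚ whitney (power q) Ms Ks) (ListP.map-id Ms)))

  whitney-graph : ∀ {N} q g (Ms : List (Fun N)) Kb Ks → Kb ≃ (cons 1ℚ g ∷ map (cons 0ℚ) Ks) → whitney (power q) (map (cons 0ℚ) Ms) Kb ≡ whitney
      (power q) Ms Ks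
  whitney-graph q g Ms Kb Ks e = trans (whitney-rel₂ (cons 0ℚ) (λ φ → φ) (λ Kb Ks → Kb ≃ (cons 1ℚ g ∷ map (cons 0ℚ) Ks))
      (λ φ K K′ r → ≃-trans {K = cons 0ℚ φ ∷ K} {cons 0ℚ φ ∷ cons 1ℚ g ∷ map (cons 0ℚ) K′} {cons 1ℚ g ∷ cons 0ℚ φ ∷ map (cons 0ℚ) K′}
          (≃-∷ (cons 0ℚ φ) {K} {cons 1ℚ g ∷ map (cons 0ℚ) K′} r) (≃-swap (cons 0ℚ φ) (cons 1ℚ g) (map (cons 0ℚ) K′)))
      (λ K K′ r → cong (q ^ℚ_) (trans (nullity-≃ {K = K} {cons 1ℚ g ∷ map (cons 0ℚ) K′} r) (nullity-graph g K′))) Ms Kb Ks e)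
    (cong (λ Ms → whitney (power q) Ms Ks) (ListP.map-id Ms))

  -- If no chosen form involves the outermost coordinate, the coordinate is free and adds one to the
  -- nullity, hence the factor q. Otherwise the first chosen form solves for it without changing the
  -- nullity, and each further choice g′ becomes the base equation `g′ ∸ᶠ g`.
  towers-iterate : ∀ q L H n Kb Ks → Kb ≃ map (liftⁿ n) Ks → whitney (power q) (towers L H n) Kb ≡ iterate q H (whitney (power q) L) n Ks
  towers-iterate q L H zero Kb Ks e = whitney-inv (power-inv q) L Kb Ks (subst (Kb ≃_) (ListP.map-id Ks) e)
  towers-iterate q L H (suc n) Kb Ks e = go H Kb Ks e
    where
    G : List (Fun m) → ℚ
    G = iterate q H (whitney (power q) L) n
    Low : List (Fun (n ℕ.+ m))
    Low = towers L H n
    unfold : ∀ Ks → map (liftⁿ (suc n)) Ks ≡ map (cons 0ℚ) (map (liftⁿ n) Ks)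
    unfold Ks = ListP.map-∘ Ks
    restrict : ∀ g g′ Kb Ks → Kb ≃ (cons 1ℚ (liftⁿ n g) ∷ map (liftⁿ (suc n)) Ks) →
               (cons 1ℚ (liftⁿ n g′) ∷ Kb) ≃ (cons 1ℚ (liftⁿ n g) ∷ map (liftⁿ (suc n)) ((g′ ∸ᶠ g) ∷ Ks))
    restrict g g′ Kb Ks e f =
      (λ { (v ∷ u) → let k = proj₁ (e f) u in All.head k ∷ trans (difference f) (cong₂ _-ℚ_ v (All.head k)) ∷ All.tail k }) ,
      λ { (w ∷ v ∷ u) → trans (lem (dot (cons 1ℚ (liftⁿ n g′)) f) (dot (cons 1ℚ (liftⁿ n g)) f)) (cong₂ _+ℚ_ (trans (sym (difference f)) v) w) ∷ proj₂
          (e f) (w ∷ u) }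
      where
      lem : ∀ a b → a ≡ (a -ℚ b) +ℚ b
      lem = RS.solve-∀ ringℚ
      lem′ : ∀ a b c → b -ℚ c ≡ (a +ℚ b) -ℚ (a +ℚ c)
      lem′ = RS.solve-∀ ringℚ
      difference : ∀ f → dot (liftⁿ (suc n) (g′ ∸ᶠ g)) f ≡ dot (cons 1ℚ (liftⁿ n g′)) f -ℚ dot (cons 1ℚ (liftⁿ n g)) f
      difference f = trans (dot-liftⁿ (suc n) (g′ ∸ᶠ g) f) (trans (dot-∸ g′ g (dropⁿ n (tail f)))
        (trans (lem′ (f Fin.zero) (dot g′ (dropⁿ n (tail f))) (dot g (dropⁿ n (tail f))))
          (sym (cong₂ _-ℚ_ (trans (dot-cons₁ (liftⁿ n g′) f) (cong (f Fin.zero +ℚ_) (dot-liftⁿ n g′ (tail f))))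
              (trans (dot-cons₁ (liftⁿ n g) f) (cong (f Fin.zero +ℚ_) (dot-liftⁿ n g (tail f))))))))
    go : ∀ H Kb Ks → Kb ≃ map (liftⁿ (suc n)) Ks → whitney (power q) (map (λ g → cons 1ℚ (liftⁿ n g)) H ++ map (cons 0ℚ) Low) Kb ≡ eliminate q H G Ks
    go [] Kb Ks e = trans (whitney-free q Low Kb (map (liftⁿ n) Ks) (subst (Kb ≃_) (unfold Ks) e))
        (cong (q *ℚ_) (towers-iterate q L H n (map (liftⁿ n) Ks) Ks (≃-refl {K = map (liftⁿ n) Ks})))
    go (g ∷ gs) Kb Ks e = cong₂ _-ℚ_ (go gs Kb Ks e)
      (trans (whitney-++ (power q) (map (λ g → cons 1ℚ (liftⁿ n g)) gs) (map (cons 0ℚ) Low) (cons 1ℚ (liftⁿ n g) ∷ Kb))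
        (whitney-rel₂ (λ g → cons 1ℚ (liftⁿ n g)) (_∸ᶠ g) (λ Kb Ks → Kb ≃ (cons 1ℚ (liftⁿ n g) ∷ map (liftⁿ (suc n)) Ks))
            (λ g′ Kb Ks → restrict g g′ Kb Ks)
          (λ Kb Ks r → trans (whitney-graph q (liftⁿ n g) Low Kb (map (liftⁿ n) Ks) (subst (λ K → Kb ≃ (cons 1ℚ (liftⁿ n g) ∷ K)) (unfold Ks) r))
            (towers-iterate q L H n (map (liftⁿ n) Ks) Ks (≃-refl {K = map (liftⁿ n) Ks})))
          gs (cons 1ℚ (liftⁿ n g) ∷ Kb) Ks (≃-∷ (cons 1ℚ (liftⁿ n g)) {Kb} {map (liftⁿ (suc n)) Ks} e)))

-- Symbolic names of the fractures. One list of names is read as vectors of the stretched space by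
-- `canonicalVec` and as forms in tower coordinates by `towerForm`.
data Canonical (m : ℕ) : Set where
  baseᶜ  : Vecℤ m → Canonical m
  shiftᶜ : ℕ → Vecℤ m → Canonical m

module _ {m : ℕ} where

  nextᶜ : Canonical m → Canonical m
  nextᶜ (baseᶜ b)    = baseᶜ b
  nextᶜ (shiftᶜ i g) = shiftᶜ (suc i) g

  canonical : List (Vecℤ m) → List (Vecℤ m) → ℕ → List (Canonical m)
  canonical bs gs zero    = map baseᶜ bs
  canonical bs gs (suc n) = map (shiftᶜ 0) gs ++ map nextᶜ (canonical bs gs n)

  towerForm : ∀ n → Canonical m → Fun (n ℕ.+ m)
  towerForm n       (baseᶜ b)          = liftⁿ n (ratl b)
  towerForm zero    (shiftᶜ i g)       = ratl g
  towerForm (suc n) (shiftᶜ zero g)    = cons 1ℚ (liftⁿ n (ratl g))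
  towerForm (suc n) (shiftᶜ (suc i) g) = cons 0ℚ (towerForm n (shiftᶜ i g))

  towerForm-next : ∀ n c → towerForm (suc n) (nextᶜ c) ≡ cons 0ℚ (towerForm n c)
  towerForm-next n (baseᶜ b)    = refl
  towerForm-next n (shiftᶜ i g) = refl

  canonical-towers : ∀ bs gs n → map (towerForm n) (canonical bs gs n) ≡ towers (map ratl bs) (map ratl gs) n
  canonical-towers bs gs zero    = sym (ListP.map-∘ bs)
  canonical-towers bs gs (suc n) = trans (ListP.map-++ (towerForm (suc n)) (map (shiftᶜ 0) gs) (map nextᶜ (canonical bs gs n)))
    (cong₂ _++_ (trans (sym (ListP.map-∘ gs)) (ListP.map-∘ gs))
      (trans (sym (ListP.map-∘ (canonical bs gs n))) (trans (ListP.map-cong (towerForm-next n) (canonical bs gs n))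
          (trans (ListP.map-∘ (canonical bs gs n)) (cong (map (cons 0ℚ)) (canonical-towers bs gs n))))))

  canonical-All : ∀ {P : Canonical m → Set} bs gs n → All (λ b → P (baseᶜ b)) bs → (∀ i → i ℕ.< n → All (λ g → P (shiftᶜ i g)) gs) → All P
      (canonical bs gs n)
  canonical-All bs gs zero    hb hg = AllP.map⁺ hb
  canonical-All {P} bs gs (suc n) hb hg = AllP.++⁺ (AllP.map⁺ (hg 0 (ℕ.s≤s ℕ.z≤n)))
    (AllP.map⁺ (canonical-All {λ c → P (nextᶜ c)} bs gs n hb (λ i l → hg (suc i) (ℕ.s≤s l))))

  canonical-base : ∀ {P : Canonical m → Set} bs gs n → Any (λ b → P (baseᶜ b)) bs → Any P (canonical bs gs n)
  canonical-base bs gs zero    a = AnyP.map⁺ a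
  canonical-base {P} bs gs (suc n) a = AnyP.++⁺ʳ (map (shiftᶜ 0) gs) (AnyP.map⁺ (canonical-base {λ c → P (nextᶜ c)} bs gs n a))

  canonical-shift : ∀ {P : Canonical m → Set} bs gs n i → i ℕ.< n → Any (λ g → P (shiftᶜ i g)) gs → Any P (canonical bs gs n)
  canonical-shift bs gs (suc n) zero    l a = AnyP.++⁺ˡ (AnyP.map⁺ a)
  canonical-shift {P} bs gs (suc n) (suc i) (ℕ.s≤s l) a = AnyP.++⁺ʳ (map (shiftᶜ 0) gs)
      (AnyP.map⁺ (canonical-shift {λ c → P (nextᶜ c)} bs gs n i l a))

module Coordinates {N N′ : ℕ} (C : Fin N′ → Fun N)
  (injective : ∀ f → (∀ i → dot (C i) f ≡ 0ℚ) → ∀ v → f v ≡ 0ℚ)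
  (surjective : ∀ (F : Fun N′) → Σ (Fun N) λ f → ∀ i → dot (C i) f ≡ F i) where

  Φ : Fun N → Fun N′
  Φ f i = dot (C i) f

  Matches : List (Fun N) → List (Fun N′) → Set
  Matches K K′ = ∀ f → (Ker K f → Ker K′ (Φ f)) × (Ker K′ (Φ f) → Ker K f)

  matches-∷ : ∀ φ ψ → (∀ f → dot φ f ≡ dot ψ (Φ f)) → ∀ K K′ → Matches K K′ → Matches (φ ∷ K) (ψ ∷ K′)
  matches-∷ φ ψ h K K′ r f = (λ { (v ∷ u) → trans (sym (h f)) v ∷ proj₁ (r f) u }) , λ { (v ∷ u) → trans (h f) v ∷ proj₂ (r f) u }

  Ker-cong : ∀ (K : List (Fun N′)) {f g} → (∀ i → f i ≡ g i) → Ker K f → Ker K g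
  Ker-cong K e = All.map (λ {φ} v → trans (sym (dot-cong φ e)) v)

  matches-nullity : ∀ K K′ → Matches K K′ → nullity K ≡ nullity K′
  matches-nullity K K′ r = sym (nullity-basis K′ (record
    { vec   = λ j → Φ (vec j)
    ; inU   = λ j → proj₁ (r (vec j)) (inU j)
    ; indep = λ c h → indep c (injective (combination c vec) (λ i → trans (dot-combination (C i) c vec) (h i)))
    ; span  = λ F u → let (f , e) = surjective F ; (c , s) = span f (proj₂ (r f) (Ker-cong K′ (λ i → sym (e i)) u)) in
        c , λ i → trans (sym (e i)) (trans (dot-cong (C i) s) (dot-combination (C i) c vec)) }))
    where open Basis (kernel-basis K)

-- Coordinates on the stretched space

pair-simple : ∀ {N} (f : Fun N) v → pair f (simple v) ≡ f v
pair-simple f v = trans (Exponential.sumℚ-at 0 v (λ i → f i *ℚ toℚ (simple v i))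
    (λ j ne → trans (cong (λ a → f j *ℚ toℚ a) (simple-other ne)) (ℚP.*-zeroʳ (f j))))
  (trans (cong (λ a → f v *ℚ toℚ a) (simple-self v)) (ℚP.*-identityʳ (f v)))

simple-sym : ∀ {N} (u v : Fin N) → simple u v ≡ simple v u
simple-sym u v = by-cases (u Fin.≟ v)
  where
  by-cases : Dec (u ≡ v) → simple u v ≡ simple v u
  by-cases (yes refl) = refl
  by-cases (no ne)    = trans (simple-other ne) (sym (simple-other (λ e → ne (sym e))))

module _ {m : ℕ} where

  join : ∀ {X : Set} n → (ℕ → X) → (Fin m → X) → Fin (n ℕ.+ m) → X
  join zero    a y = y
  join (suc n) a y Fin.zero    = a 0
  join (suc n) a y (Fin.suc i) = join n (λ i → a (suc i)) y i

  coord : ∀ n → ℕ → Fun (n ℕ.+ m) → ℚ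
  coord zero    i       F = 0ℚ
  coord (suc n) zero    F = F Fin.zero
  coord (suc n) (suc i) F = coord n i (tail F)

  coord-join : ∀ {X : Set} n a y (h : X → ℚ) i → i ℕ.< n → coord n i (λ j → h (join n a y j)) ≡ h (a i)
  coord-join (suc n) a y h zero    _         = refl
  coord-join (suc n) a y h (suc i) (ℕ.s≤s l) = coord-join n (λ i → a (suc i)) y h i l

  drop-join : ∀ {X : Set} n a y (h : X → ℚ) z → dropⁿ n (λ j → h (join n a y j)) z ≡ h (y z)
  drop-join zero    a y h z = refl
  drop-join (suc n) a y h z = drop-join n (λ i → a (suc i)) y h z

  join-ext : ∀ {X : Set} n a y (h : X → ℚ) F → (∀ i → i ℕ.< n → h (a i) ≡ coord n i F) → (∀ z → h (y z) ≡ dropⁿ n F z) → ∀ j → h (join n a y j) ≡ F j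
  join-ext zero    a y h F p q j           = q j
  join-ext (suc n) a y h F p q Fin.zero    = p 0 (ℕ.s≤s ℕ.z≤n)
  join-ext (suc n) a y h F p q (Fin.suc j) = join-ext n (λ i → a (suc i)) y h (tail F) (λ i l → p (suc i) (ℕ.s≤s l)) q j

  join-all : ∀ {X : Set} n a y (P : X → Set) → (∀ j → P (join n a y j)) → (∀ i → i ℕ.< n → P (a i)) × (∀ z → P (y z))
  join-all zero    a y P h = (λ i ()) , h
  join-all (suc n) a y P h = let (p , q) = join-all n (λ i → a (suc i)) y P (λ j → h (Fin.suc j)) in
    (λ { zero _ → h Fin.zero ; (suc i) (ℕ.s≤s l) → p i l }) , q

  dot-towerForm : ∀ n i g F → i ℕ.< n → dot (towerForm n (shiftᶜ i g)) F ≡ coord n i F +ℚ dot (ratl g) (dropⁿ n F)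
  dot-towerForm (suc n) zero    g F _         = trans (dot-cons₁ (liftⁿ n (ratl g)) F) (cong (F Fin.zero +ℚ_) (dot-liftⁿ n (ratl g) (tail F)))
  dot-towerForm (suc n) (suc i) g F (ℕ.s≤s l) = trans (dot-cons₀ (towerForm n (shiftᶜ i g)) F) (dot-towerForm n i g (tail F) l)

-- Equality of g and g′ as functions on α^⊥ in the unstretched space. This is the condition for e_j
-- + st(g) and e_j + st(g′) to give the same fracture.
Agree : ∀ {m} → Vecℤ m → Vecℤ m → Vecℤ m → Set
Agree α g g′ = ∀ y → dot (ratl α) y ≡ 0ℚ → dot (ratl g) y ≡ dot (ratl g′) y

agree? : ∀ {m} (α g g′ : Vecℤ m) → Dec (Agree α g g′)
agree? α g g′ with vanishes? (kernel-basis (ratl α ∷ [])) (ratl g ∸ᶠ ratl g′)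
... | yes h = yes λ y u → trans (lem (dot (ratl g) y) (dot (ratl g′) y))
    (trans (cong (_+ℚ dot (ratl g′) y) (trans (sym (dot-∸ (ratl g) (ratl g′) y)) (h y (u ∷ [])))) (ℚP.+-identityˡ (dot (ratl g′) y)))
  where
  lem : ∀ a b → a ≡ (a -ℚ b) +ℚ b
  lem = RS.solve-∀ ringℚ
... | no ¬h = no λ a → ¬h λ { y (u ∷ []) → trans (dot-∸ (ratl g) (ratl g′) y)
    (trans (cong (_-ℚ dot (ratl g′) y) (a y u)) (ℚP.+-inverseʳ (dot (ratl g′) y))) }

module StCoordinates {m : ℕ} (A : Matrix m) (cartan : IsCartan A) (E : Elastic m) (n′ : ℕ) where
  open StFractures A cartan E n′ public
  open Elastic E

  coordVec : Fin (n ℕ.+ m) → Vecℤ (m ℕ.+ n)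
  coordVec = join n (λ i → eps (suc i)) (λ y → St (simple y))

  -- The prescribed values at e_0, ..., e_{n+1}: zero, the n path coordinates, and at X = e_{n+1}
  -- the base coordinate of x. The functional at x_k is the difference of consecutive values.
  vertex-values : Fun (n ℕ.+ m) → ℕ → ℚ
  vertex-values F zero    = 0ℚ
  vertex-values F (suc k) = if does (k ℕP.<? n) then coord n k F else dropⁿ n F x

  placeValue : Fun (n ℕ.+ m) → Place m → ℚ
  placeValue F (off y) = dropⁿ n F y
  placeValue F (on k)  = vertex-values F (suc k) -ℚ vertex-values F k

  lower : Fun (n ℕ.+ m) → Fun (m ℕ.+ n)
  lower F v = placeValue F (pl v)

  pair-eps-suc : ∀ f k → pair f (eps (suc k)) ≡ pair f (eps k) +ℚ f (path k)
  pair-eps-suc f k = trans (pair-⊞ f (eps k) (simple (path k))) (cong (pair f (eps k) +ℚ_) (pair-simple f (path k)))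

  pair-eps-zero : ∀ f → pair f (eps 0) ≡ 0ℚ
  pair-eps-zero f = sumℚ-zero (λ v → ℚP.*-zeroʳ (f v))

  lower-eps : ∀ F k → k ℕ.≤ suc n → pair (lower F) (eps k) ≡ vertex-values F k
  lower-eps F zero    l = pair-eps-zero (lower F)
  lower-eps F (suc k) l = trans (pair-eps-suc (lower F) k) (trans
      (cong₂ _+ℚ_ (lower-eps F k (ℕP.≤-trans (ℕP.n≤1+n k) l)) (cong (placeValue F) (pl-path (ℕP.≤-pred l))))
      (lem (vertex-values F k) (vertex-values F (suc k))))
    where
    lem : ∀ a b → a +ℚ (b -ℚ a) ≡ b
    lem = RS.solve-∀ ringℚ

  lower-coord : ∀ F i → i ℕ.< n → pair (lower F) (eps (suc i)) ≡ coord n i F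
  lower-coord F i l = trans (lower-eps F (suc i) (ℕP.≤-trans l (ℕP.n≤1+n n)))
      (cong (λ b → if b then coord n i F else dropⁿ n F x) (does-true (i ℕP.<? n) l))

  lower-base : ∀ F y → pair (lower F) (St (simple y)) ≡ dropⁿ n F y
  lower-base F y = by-cases (y Fin.≟ x)
    where
    by-cases : Dec (y ≡ x) → pair (lower F) (St (simple y)) ≡ dropⁿ n F y
    by-cases (yes refl) = trans (pair-≈ (lower F) (≈-sym eps-St)) (trans (lower-eps F (suc n) ℕP.≤-refl)
      (cong (λ b → if b then coord n n F else dropⁿ n F x) (does-false (n ℕP.<? n) (ℕP.<-irrefl refl))))
    by-cases (no y≢x)   = trans (pair-≈ (lower F) (≈-sym (simple-St y≢x)))
        (trans (pair-simple (lower F) (base-vertex y)) (cong (placeValue F) (pl-base y≢x)))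

  coordinates-injective : ∀ f → (∀ i → dot (ratl (coordVec i)) f ≡ 0ℚ) → ∀ v → f v ≡ 0ℚ
  coordinates-injective f h v = by-view (vertex v)
    where
    both : (∀ i → i ℕ.< n → pair f (eps (suc i)) ≡ 0ℚ) × (∀ y → pair f (St (simple y)) ≡ 0ℚ)
    both = join-all n (λ i → eps (suc i)) (λ y → St (simple y)) (λ u → pair f u ≡ 0ℚ) h
    eps-vanish : ∀ k → k ℕ.≤ suc n → pair f (eps k) ≡ 0ℚ
    eps-vanish zero    l = pair-eps-zero f
    eps-vanish (suc k) l with ℕP.m≤n⇒m<n∨m≡n (ℕP.≤-pred l)
    ... | inj₁ k<n  = proj₁ both k k<n
    ... | inj₂ refl = trans (pair-≈ f eps-St) (proj₂ both x)
    by-view : ∀ {v} → Vertex v → f v ≡ 0ℚ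
    by-view (baseᵥ y y≢x) = trans (sym (pair-simple f (base-vertex y))) (trans (pair-≈ f (simple-St y≢x)) (proj₂ both y))
    by-view (pathᵥ k l)   = trans (lem (pair f (eps k)) (f (path k))) (trans
        (cong₂ _-ℚ_ (trans (sym (pair-eps-suc f k)) (eps-vanish (suc k) (ℕ.s≤s l))) (eps-vanish k (ℕP.≤-trans l (ℕP.n≤1+n n)))) refl)
      where
      lem : ∀ a b → b ≡ (a +ℚ b) -ℚ a
      lem = RS.solve-∀ ringℚ

  coordinates-surjective : ∀ F → Σ (Fun (m ℕ.+ n)) λ f → ∀ i → dot (ratl (coordVec i)) f ≡ F i
  coordinates-surjective F = lower F , join-ext n (λ i → eps (suc i)) (λ y → St (simple y)) (pair (lower F)) F (lower-coord F) (lower-base F)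

  open Coordinates (λ i → ratl (coordVec i)) coordinates-injective coordinates-surjective public

  pair-St : ∀ f b → pair f (St b) ≡ dot (ratl b) (λ y → pair f (St (simple y)))
  pair-St f b = trans (sumℚ-cong (λ v → trans (cong (f v *ℚ_) (expand-at v)) (sym (sumℚ-* (f v) (λ y → toℚ (b y) *ℚ toℚ (St (simple y) v))))))
    (trans (sumℚ-swap (λ v y → f v *ℚ (toℚ (b y) *ℚ toℚ (St (simple y) v))))
      (sumℚ-cong (λ y → trans (sumℚ-cong (λ v → lem (f v) (toℚ (b y)) (toℚ (St (simple y) v))))
          (trans (sumℚ-* (toℚ (b y)) (λ v → f v *ℚ toℚ (St (simple y) v))) (ℚP.*-comm (toℚ (b y)) (pair f (St (simple y))))))))
    where
    lem : ∀ a b c → a *ℚ (b *ℚ c) ≡ b *ℚ (a *ℚ c)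
    lem = RS.solve-∀ ringℚ
    expand-at : ∀ v → toℚ (St b v) ≡ sumℚ (λ y → toℚ (b y) *ℚ toℚ (St (simple y) v))
    expand-at v = trans (cong toℚ (trans (St-proj b v) (sym (sumℤ-simple b (proj (pl v))))))
      (trans (sym (sumℚ-toℚ (λ y → b y * simple (proj (pl v)) y))) (sumℚ-cong (λ y → trans (toℚ-* (b y) (simple (proj (pl v)) y))
        (cong (λ a → toℚ (b y) *ℚ toℚ a) (trans (simple-sym (proj (pl v)) y) (sym (St-proj (simple y) v)))))))

  canonicalVec : Canonical m → Vecℤ (m ℕ.+ n)
  canonicalVec (baseᶜ b)    = St b
  canonicalVec (shiftᶜ i g) = Shifted i g

  data Indexed : Canonical m → Set where
    base-indexed  : ∀ {b} → Indexed (baseᶜ b)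
    shift-indexed : ∀ {i g} → i ℕ.< n → Indexed (shiftᶜ i g)

  drop-Φ : ∀ f y → dropⁿ n (Φ f) y ≡ pair f (St (simple y))
  drop-Φ f y = drop-join n (λ i → eps (suc i)) (λ y → St (simple y)) (pair f) y

  dot-base : ∀ f b → pair f (St b) ≡ dot (ratl b) (dropⁿ n (Φ f))
  dot-base f b = trans (pair-St f b) (dot-cong (ratl b) (λ y → sym (drop-Φ f y)))

  canonical-coordinates : ∀ c → Indexed c → ∀ f → dot (ratl (canonicalVec c)) f ≡ dot (towerForm n c) (Φ f)
  canonical-coordinates (baseᶜ b)    _                 f = trans (dot-base f b) (sym (dot-liftⁿ n (ratl b) (Φ f)))
  canonical-coordinates (shiftᶜ i g) (shift-indexed l) f = trans (pair-⊞ f (eps (suc i)) (St g))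
      (trans (cong₂ _+ℚ_ (sym (coord-join n (λ i → eps (suc i)) (λ y → St (simple y)) (pair f) i l)) (dot-base f g))
    (sym (dot-towerForm n i g (Φ f) l)))

  canonical-whitney : ∀ q α cs → All Indexed cs → whitney (power q) (map (λ c → ratl (canonicalVec c)) cs) (ratl (St α) ∷ []) ≡ whitney (power q)
      (map (towerForm n) cs) (liftⁿ n (ratl α) ∷ [])
  canonical-whitney q α cs ix = go cs ix (ratl (St α) ∷ []) (liftⁿ n (ratl α) ∷ [])
      (matches-∷ (ratl (St α)) (liftⁿ n (ratl α)) (λ f → canonical-coordinates (baseᶜ α) base-indexed f) [] [] (λ f → (λ u → []) , λ u → []))
    where
    go : ∀ cs → All Indexed cs → ∀ K K′ → Matches K K′ → whitney (power q) (map (λ c → ratl (canonicalVec c)) cs) K ≡ whitney (power q)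
        (map (towerForm n) cs) K′
    go []       []       K K′ r = cong (q ^ℚ_) (matches-nullity K K′ r)
    go (c ∷ cs) (i ∷ is) K K′ r = cong₂ _-ℚ_ (go cs is K K′ r)
      (go cs is (ratl (canonicalVec c) ∷ K) (towerForm n c ∷ K′) (matches-∷ (ratl (canonicalVec c)) (towerForm n c)
          (canonical-coordinates c i) K K′ r))

  agree⇒sameFracture : ∀ α j g g′ → Agree α g g′ → SameFracture (St α) (Shifted j g) (Shifted j g′)
  agree⇒sameFracture α j g g′ h f u = (λ v → trans (sym same) v) , λ v → trans same v
    where
    y : Fun m
    y = dropⁿ n (Φ f)
    same : pair f (Shifted j g) ≡ pair f (Shifted j g′)
    same = trans (pair-⊞ f (eps (suc j)) (St g)) (trans
        (cong (pair f (eps (suc j)) +ℚ_) (trans (dot-base f g) (trans (h y (trans (sym (dot-base f α)) u)) (sym (dot-base f g′)))))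
        (sym (pair-⊞ f (eps (suc j)) (St g′))))

  point : (ℕ → ℚ) → Fun m → Fun (m ℕ.+ n)
  point a y = lower (join n a y)

  point-St : ∀ a y b → pair (point a y) (St b) ≡ dot (ratl b) y
  point-St a y b = trans (pair-St (point a y) b) (dot-cong (ratl b) (λ z → trans (lower-base (join n a y) z) (drop-join n a y (λ v → v) z)))

  point-Shifted : ∀ a y j g → j ℕ.< n → pair (point a y) (Shifted j g) ≡ a j +ℚ dot (ratl g) y
  point-Shifted a y j g l = trans (pair-⊞ (point a y) (eps (suc j)) (St g))
      (cong₂ _+ℚ_ (trans (lower-coord (join n a y) j l) (coord-join n a y (λ v → v) j l)) (point-St a y g))

  sameFracture⇒index : ∀ α j g j′ g′ → j ℕ.< n → j′ ℕ.< n → SameFracture (St α) (Shifted j g) (Shifted j′ g′) → j ≡ j′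
  sameFracture⇒index α j g j′ g′ l l′ h with j ℕP.≟ j′
  ... | yes e = e
  ... | no ne = ⊥-elim (contra (trans (sym at-j′) (proj₁ (h (point a zeroᶠ) (trans (point-St a zeroᶠ α) (dot-zero (ratl α)))) at-j)))
    where
    contra : ¬ (1ℚ ≡ 0ℚ)
    contra ()
    zeroᶠ : Fun m
    zeroᶠ _ = 0ℚ
    -- Over the base point 0, only the path coordinate of index j′ is nonzero; the functional lies
    -- on the fracture of index j and off the other.
    a : ℕ → ℚ
    a k = if does (j′ ℕP.≟ k) then 1ℚ else 0ℚ
    at-j : pair (point a zeroᶠ) (Shifted j g) ≡ 0ℚ
    at-j = trans (point-Shifted a zeroᶠ j g l) (cong₂ _+ℚ_ (cong (λ b → if b then 1ℚ else 0ℚ) (does-false (j′ ℕP.≟ j) (λ e → ne (sym e))))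
        (dot-zero (ratl g)))
    at-j′ : pair (point a zeroᶠ) (Shifted j′ g′) ≡ 1ℚ
    at-j′ = trans (point-Shifted a zeroᶠ j′ g′ l′) (cong₂ _+ℚ_ (cong (λ b → if b then 1ℚ else 0ℚ) (does-true (j′ ℕP.≟ j′) refl)) (dot-zero (ratl g′)))

  sameFracture⇒agree : ∀ α j g g′ → j ℕ.< n → SameFracture (St α) (Shifted j g) (Shifted j g′) → Agree α g g′
  sameFracture⇒agree α j g g′ l h y u = trans (lem (dot (ratl g) y) (dot (ratl g′) y))
      (trans (cong (λ a → dot (ratl g′) y -ℚ a) at-g′) (lem′ (dot (ratl g′) y)))
    where
    -- Every path coordinate is -g(y), which makes `Shifted j g` vanish; the value at `Shifted j g′`
    -- is then g′(y) - g(y).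
    a : ℕ → ℚ
    a _ = -ℚ dot (ratl g) y
    lem : ∀ p r → p ≡ r -ℚ ((-ℚ p) +ℚ r)
    lem = RS.solve-∀ ringℚ
    lem′ : ∀ r → r -ℚ 0ℚ ≡ r
    lem′ = RS.solve-∀ ringℚ
    at-g′ : (-ℚ dot (ratl g) y) +ℚ dot (ratl g′) y ≡ 0ℚ
    at-g′ = trans (sym (point-Shifted a y j g′ l)) (proj₁ (h (point a y) (trans (point-St a y α) u))
        (trans (point-Shifted a y j g l) (ℚP.+-inverseˡ (dot (ratl g) y))))

-- The bound on the number of shifts, and assembly

allPairs-lookup : ∀ {X : Set} {R : X → X → Set} {xs} → AllPairs R xs → ∀ i j → i Fin.< j → R (List.lookup xs i) (List.lookup xs j)
allPairs-lookup {xs = x ∷ xs} (ps ∷ pss) Fin.zero    (Fin.suc j) _         = All.lookup ps (MemP.∈-lookup j)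
allPairs-lookup {xs = x ∷ xs} (ps ∷ pss) (Fin.suc i) (Fin.suc j) (ℕ.s≤s l) = allPairs-lookup pss i j l

split-unique : ∀ {X : Set} (p p′ : List X) {k k′ r r′} → p ++ k ∷ r ≡ p′ ++ k′ ∷ r′ → length p ≡ length p′ → p ≡ p′ × k ≡ k′
split-unique []      []        refl _ = refl , refl
split-unique (_ ∷ p) (_ ∷ p′) e l with ListP.∷-injective e
... | refl , e′ with split-unique p p′ e′ (ℕP.suc-injective l)
...   | refl , refl = refl , refl

injection-≤ : ∀ {a b c} (f : Fin a → Fin b → Fin c) → (∀ i j i′ j′ → f i j ≡ f i′ j′ → i ≡ i′ × j ≡ j′) → a ℕ.* b ℕ.≤ c
injection-≤ {a} {b} {c} f inj = ℕP.≮⇒≥ λ l → collision (FinP.pigeonhole l flat)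
  where
  flat : Fin (a ℕ.* b) → Fin c
  flat z = f (proj₁ (Fin.remQuot {a} b z)) (proj₂ (Fin.remQuot {a} b z))
  collision : (Σ (Fin (a ℕ.* b)) λ y → Σ (Fin (a ℕ.* b)) λ z → y Fin.< z × flat y ≡ flat z) → ⊥
  collision (y , z , y<z , same) = ℕP.<-irrefl (cong toℕ
      (trans (sym (FinP.combine-remQuot {a} b y)) (trans (cong₂ Fin.combine (proj₁ equal) (proj₂ equal)) (FinP.combine-remQuot {a} b z)))) y<z
    where
    equal : proj₁ (Fin.remQuot {a} b y) ≡ proj₁ (Fin.remQuot {a} b z) × proj₂ (Fin.remQuot {a} b y) ≡ proj₂ (Fin.remQuot {a} b z)
    equal = inj (proj₁ (Fin.remQuot {a} b y)) (proj₂ (Fin.remQuot {a} b y)) (proj₁ (Fin.remQuot {a} b z)) (proj₂ (Fin.remQuot {a} b z)) same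

module Crossings {N : ℕ} (B : Matrix N) (cartan : IsCartan B) (u : List (Fin N)) (k : Fin N) {η : Vecℤ N} (u-root : Reflections.root B cartan u k ≈ η)
    (η-pos : Pos η) where
  open Cutting B cartan

  CutBy : Vecℤ N → Set
  CutBy v = Σ (Vecℤ N) λ γ → Cuts B γ η × SameFracture η v γ

  record CrossedBy (v : Vecℤ N) : Set where
    field
      prefix   : List (Fin N)
      last   : Fin N
      suffix   : List (Fin N)
      is-split : u ≡ prefix ++ last ∷ suffix
      fracture : SameFracture η v (root prefix last)
  open CrossedBy

  crossed : ∀ v → CutBy v → CrossedBy v
  crossed v (γ , c , f) = let (p , l , r , eq , h , _) = cut⇒crossing u k u-root η-pos c in record
    { prefix = p ; last = l ; suffix = r ; is-split = eq ; fracture = sameFracture-trans η v γ (root p l) f h }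

  prefix-short : ∀ {v} (c : CrossedBy v) → length (prefix c) ℕ.< length u
  prefix-short c = subst (length (prefix c) ℕ.<_) (sym
      (trans (cong length (is-split c)) (trans (ListP.length-++ (prefix c)) (ℕP.+-suc (length (prefix c)) (length (suffix c))))))
    (ℕ.s≤s (ℕP.m≤m+n (length (prefix c)) (length (suffix c))))

  -- The length of the prefix determines the prefix root, and with it the fracture. Different
  -- fractures thus occupy different letters of u.
  position : ∀ {v} → CrossedBy v → Fin (length u)
  position c = Fin.fromℕ< (prefix-short c)

  position-injective : ∀ {v v′} (c : CrossedBy v) (c′ : CrossedBy v′) → position c ≡ position c′ → SameFracture η v v′
  position-injective {v} {v′} c c′ pos = same (split-unique (prefix c) (prefix c′) (trans (sym (is-split c)) (is-split c′))
      (trans (sym (FinP.toℕ-fromℕ< (prefix-short c))) (trans (cong toℕ pos) (FinP.toℕ-fromℕ< (prefix-short c′)))))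
    where
    same : prefix c ≡ prefix c′ × last c ≡ last c′ → SameFracture η v v′
    same (p , l) = sameFracture-trans η v (root (prefix c) (last c)) v′ (fracture c)
      (subst (λ r → SameFracture η r v′) (sym (cong₂ root p l)) (sameFracture-sym η v′ (root (prefix c′) (last c′)) (fracture c′)))

module StretchedFractures {m : ℕ} (A : Matrix m) (cartan : IsCartan A) (E : Elastic m) (n′ : ℕ) (α : Vecℤ m) (bs gs : List (Vecℤ m)) where
  open StCoordinates A cartan E n′

  η : Vecℤ (m ℕ.+ n)
  η = St α

  CutBy : Vecℤ (m ℕ.+ n) → Set
  CutBy v = Σ (Vecℤ (m ℕ.+ n)) λ γ → Cuts B γ η × SameFracture η v γ

  module _ (gs-cuts : ∀ j → suc j ℕ.≤ n → All (λ g → CutBy (Shifted j g)) gs) where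

    -- The pairs of an index j and an entry of `gs` give pairwise different fractures, each with its
    -- own letter of u. As u is any word for the stretched root, a shortest one may be taken, which
    -- compares their number with the depth.
    shifts-bounded : AllPairs (λ g g′ → ¬ Agree α g g′) gs → ∀ u k → 𝔹.root u k ≈ η → Pos η → n ℕ.* length gs ℕ.≤ length u
    shifts-bounded distinct u k u-root η-pos = injection-≤ (λ j a → position (crossing-at j a))
        (λ j a j′ a′ h → shifts-injective j a j′ a′ (position-injective (crossing-at j a) (crossing-at j′ a′) h))
      where
      open Crossings B st-cartan u k u-root η-pos using (CrossedBy; crossed; position; position-injective)
      shift-at : Fin n → Fin (length gs) → Vecℤ (m ℕ.+ n)
      shift-at j a = Shifted (toℕ j) (List.lookup gs a)
      crossing-at : ∀ j a → CrossedBy (shift-at j a)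
      crossing-at j a = crossed (shift-at j a) (All.lookup (gs-cuts (toℕ j) (FinP.toℕ<n j)) (MemP.∈-lookup a))
      same-shift : ∀ j a a′ → SameFracture η (shift-at j a) (shift-at j a′) → a ≡ a′
      same-shift j a a′ h = by-order (ℕP.<-cmp (toℕ a) (toℕ a′))
        where
        agree : Agree α (List.lookup gs a) (List.lookup gs a′)
        agree = sameFracture⇒agree α (toℕ j) (List.lookup gs a) (List.lookup gs a′) (FinP.toℕ<n j) h
        by-order : Tri (toℕ a ℕ.< toℕ a′) (toℕ a ≡ toℕ a′) (toℕ a′ ℕ.< toℕ a) → a ≡ a′
        by-order (tri< l _ _) = ⊥-elim (allPairs-lookup distinct a a′ l agree)
        by-order (tri≈ _ e _) = FinP.toℕ-injective e
        by-order (tri> _ _ l) = ⊥-elim (allPairs-lookup distinct a′ a l (λ y z → sym (agree y z)))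
      shifts-injective : ∀ j a j′ a′ → SameFracture η (shift-at j a) (shift-at j′ a′) → j ≡ j′ × a ≡ a′
      shifts-injective j a j′ a′ h = by-index (FinP.toℕ-injective (sameFracture⇒index α (toℕ j) (List.lookup gs a) (toℕ j′) (List.lookup gs a′)
          (FinP.toℕ<n j) (FinP.toℕ<n j′) h))
        where
        by-index : j ≡ j′ → j ≡ j′ × a ≡ a′
        by-index refl = refl , same-shift j a a′ h

    module _ (bs-cuts : All (λ b → CutBy (St b)) bs)
             (complete : ∀ β → Cuts B β η → Any (λ b → SameFracture η β (St b)) bs ⊎ Σ ℕ λ j → suc j ℕ.≤ n × Any
                 (λ g → SameFracture η β (Shifted j g)) gs) where

      cs : List (Canonical m)
      cs = canonical bs gs n

      cs-indexed : All Indexed cs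
      cs-indexed = canonical-All {P = Indexed} bs gs n (All.universal (λ _ → base-indexed) bs) (λ j l → All.universal (λ _ → shift-indexed l) gs)

      cs-cuts : All (λ c → CutBy (canonicalVec c)) cs
      cs-cuts = canonical-All {P = λ c → CutBy (canonicalVec c)} bs gs n bs-cuts gs-cuts

      cs-complete : ∀ β → Cuts B β η → Any (λ c → SameFracture η β (canonicalVec c)) cs
      cs-complete β c = [ canonical-base {P = λ c → SameFracture η β (canonicalVec c)} bs gs n ,
                          (λ (j , l , a) → canonical-shift {P = λ c → SameFracture η β (canonicalVec c)} bs gs n j l a) ]′ (complete β c)

      cut-at : ∀ j → CutBy (canonicalVec (List.lookup cs j))
      cut-at j = All.lookup cs-cuts (MemP.∈-lookup j)

      fractures : Fin (length cs) → Vecℤ (m ℕ.+ n)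
      fractures j = proj₁ (cut-at j)

      fractures-listed : ListsFractures B η (length cs) fractures
      fractures-listed = (λ j → proj₁ (proj₂ (cut-at j))) , λ β c → at-index β (cs-complete β c)
        where
        at-index : ∀ β → Any (λ c → SameFracture η β (canonicalVec c)) cs → Σ (Fin (length cs)) λ j → SameFracture η β (fractures j)
        at-index β a = Any.index a , sameFracture-trans η β (canonicalVec (List.lookup cs (Any.index a))) (fractures (Any.index a))
            (AnyP.lookup-index a) (proj₂ (proj₂ (cut-at (Any.index a))))

      module _ (η-root : 𝔹.Root η) {k} (Fs : Fin k → Vecℤ (m ℕ.+ n)) (lists : ListsFractures B η k Fs) where

        Fs-proper : ∀ j → ¬ (∀ f → pair f η ≡ 0ℚ → pair f (Fs j) ≡ 0ℚ)
        Fs-proper j h = separates (nonPar-functional (𝔹.¬sameHyp⇒nonPar η-root (𝔹.isRoot⇒ (proj₁ (proj₁ lists j))) (proj₁ (proj₂ (proj₁ lists j)))))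
          where
          separates : (Σ (Fun (m ℕ.+ n)) λ f → pair f η ≡ 0ℚ × 0ℚ <ℚ pair f (Fs j)) → ⊥
          separates (f , a , b) = ℚP.<⇒≢ b (sym (h f a))

        forces : ∀ β δ → SameFracture η β δ → Forces (ratl β ∷ ratl η ∷ []) (ratl δ)
        forces β δ h f (v ∷ u ∷ []) = proj₁ (h f u) v

        listed : List (Fun (m ℕ.+ n))
        listed = List.tabulate (λ j → ratl (Fs j))

        canonicalForms : List (Fun (m ℕ.+ n))
        canonicalForms = map (λ c → ratl (canonicalVec c)) cs

        listed⊆canonical : All (λ φ → Any (Forces (φ ∷ ratl η ∷ [])) canonicalForms) listed
        listed⊆canonical = AllP.tabulate⁺ λ j → AnyP.map⁺ (Any.map (λ {c} → forces (Fs j) (canonicalVec c)) (cs-complete (Fs j) (proj₁ lists j)))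

        canonical⊆listed : All (λ φ → Any (Forces (φ ∷ ratl η ∷ [])) listed) canonicalForms
        canonical⊆listed = AllP.map⁺ (All.map (λ {c} → forced c) cs-cuts)
          where
          forced : ∀ c → CutBy (canonicalVec c) → Any (Forces (ratl (canonicalVec c) ∷ ratl η ∷ [])) listed
          forced c (γ , cut , h) = let (j , h′) = proj₂ lists γ cut in AnyP.tabulate⁺ j (forces (canonicalVec c) (Fs j) (sameFracture-trans η (canonicalVec c) γ (Fs j) h h′))

        -- The listing `Fs` is arbitrary: order, repetitions and normal vectors may differ from
        -- those of `cs`. The alternating sum does not see the difference by `whitney-same`.
        charPoly-iterate : ∀ {χ} → IsCharPoly η Fs χ → ∀ q → χ q ≡ iterate q (map ratl gs) (whitney (power q) (map ratl bs)) n (ratl α ∷ [])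
        charPoly-iterate cp q = trans (Moebius.charPoly-whitney η Fs Fs-proper cp q)
          (trans (whitney-same (power-inv q) listed canonicalForms (ratl η ∷ []) listed⊆canonical canonical⊆listed)
          (trans (canonical-whitney q α cs cs-indexed)
          (trans (cong (λ Ms → whitney (power q) Ms (liftⁿ n (ratl α) ∷ [])) (canonical-towers bs gs n))
                 (towers-iterate q (map ratl bs) (map ratl gs) n (liftⁿ n (ratl α) ∷ []) (ratl α ∷ []) (≃-refl {K = liftⁿ n (ratl α) ∷ []})))))


module Assembly {m : ℕ} (A : Matrix m) (cartan : IsCartan A) (E : Elastic m) (α : Vecℤ m) (α-pos : Pos α)
                (w : List (Fin m)) (i : Fin m) (e : Reflections.root A cartan w i ≈ α) where

  private
    module Distinct = Representatives {R = Agree α} (agree? α) (λ y u → refl) (λ a b y u → trans (a y u) (b y u))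

    all-shifts : List (Vecℤ m)
    all-shifts = Shapes.invShifts A cartan E w i α

  -- Shifts that agree on α^⊥ give the same fractures in every stretch. One is kept from each class,
  -- since the count against the depth requires different fractures.
  bs gs : List (Vecℤ m)
  bs = Shapes.invBases A cartan E w i α
  gs = Distinct.representatives all-shifts

  gs-distinct : AllPairs (λ g g′ → ¬ Agree α g g′) gs
  gs-distinct = Distinct.representatives-distinct all-shifts

  module Stretched (n′ : ℕ) where
    open StCoordinates A cartan E n′ using (n; B; St; Shifted; module 𝔹; base-cuts; shift-cuts; cuts-listed; agree⇒sameFracture; η-pos; expand; letter; η-eq)
    module F = StretchedFractures A cartan E n′ α bs gs

    η-nonneg : Pos (St α)
    η-nonneg = η-pos w i e α-pos

    η-root : 𝔹.Root (St α)
    η-root = expand w i , letter i , η-eq w i e α-pos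

    gs-cuts : ∀ j → suc j ℕ.≤ n → All (λ g → F.CutBy (Shifted j g)) gs
    gs-cuts j l = Distinct.representatives-All (shift-cuts w i e α-pos j l)

    bs-cuts : All (λ b → F.CutBy (St b)) bs
    bs-cuts = base-cuts w i e α-pos

    complete : ∀ β → Cuts B β (St α) → Any (λ b → SameFracture (St α) β (St b)) bs ⊎ Σ ℕ λ j → suc j ℕ.≤ n × Any
        (λ g → SameFracture (St α) β (Shifted j g)) gs
    complete β c = [ inj₁ , (λ (j , l , a) → inj₂ (j , l , represent j (Distinct.representatives-Any all-shifts) a)) ]′ (cuts-listed w i e α-pos c)
      where
      represent : ∀ j {xs} → All (λ g → Any (Agree α g) gs) xs → Any (λ g → SameFracture (St α) β (Shifted j g)) xs → Any
          (λ g → SameFracture (St α) β (Shifted j g)) gs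
      represent j {g ∷ _} (r ∷ rs) (here f)  = Any.map (λ {g′} agree → sameFracture-trans (St α) β (Shifted j g) (Shifted j g′) f
          (agree⇒sameFracture α j g g′ agree)) r
      represent j (r ∷ rs) (there a) = represent j rs a

    shifts-bounded : ∀ u k → 𝔹.root u k ≈ St α → n ℕ.* length gs ℕ.≤ length u
    shifts-bounded u k u-root = F.shifts-bounded gs-cuts gs-distinct u k u-root η-nonneg

    listing : Σ ℕ λ k → Σ (Fin k → Vecℤ (m ℕ.+ n)) λ Fs → ListsFractures B (St α) k Fs
    listing = length (F.cs gs-cuts bs-cuts complete) , F.fractures gs-cuts bs-cuts complete , F.fractures-listed gs-cuts bs-cuts complete

    charPoly : ∀ {k} (Fs : Fin k → Vecℤ (m ℕ.+ n)) → ListsFractures B (St α) k Fs → ∀ {χ} → IsCharPoly (St α) Fs χ →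
               ∀ q → χ q ≡ iterate q (map ratl gs) (whitney (power q) (map ratl bs)) n (ratl α ∷ [])
    charPoly Fs lists = F.charPoly-iterate gs-cuts bs-cuts complete η-root Fs lists

theorem4p11 : ∀ {m} (A : Matrix m) → IsCartan A → (E : Elastic m)
    → (α : Vecℤ m) → IsPositiveRoot A α
    → (t d : ℕ) → DepthIs A α d
    → (∀ n → DepthIs (stA A E n) (stVec E n α) (t ℕ.* n ℕ.+ d))
    → Σ (Fin (suc t) → Poly) λ p → Σ ℤ λ e → Σ ℕ λ n₀ → e ℤ.≤ + n₀
    × (∀ n → n₀ ℕ.≤ n →
    Σ ℕ (λ k → Σ (Fin k → Vecℤ (m ℕ.+ n)) λ Fs →
    ListsFractures (stA A E n) (stVec E n α) k Fs)
    × (∀ k (Fs : Fin k → Vecℤ (m ℕ.+ n)) →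
    ListsFractures (stA A E n) (stVec E n α) k Fs →
    ∀ χ → IsCharPoly (stVec E n α) Fs χ →
    ∀ q → χ q ≡ sumℚ (λ (j : Fin (suc t)) →
    eval (p j) q ℚ.* ((q ℚ.- toℚ (+ toℕ j)) ^ℚ ℤ.∣ + n ℤ.- e ∣))))
theorem4p11 {m} A cartan E α (root , α-pos) t d (ℓ , d≡ , _ , _) depth =
  -- The formula holds with e = 0 as soon as n ≥ 1, that is, as soon as x₀ and x_n are distinct.
  proj₁ good , 0ℤ , 1 , ℤ.+≤+ ℕ.z≤n , at-stretch
  where
  word : Inversions.Root A cartan α
  word = Inversions.isRoot⇒ A cartan root
  open Assembly A cartan E α α-pos (proj₁ word) (proj₁ (proj₂ word)) (proj₂ (proj₂ word))

  -- At n = d, each shift contributes n of the fractures, and there are fewer than t n + d = (t + 1) n of them.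
  shifts≤t : length gs ℕ.≤ t
  shifts≤t = bound (depth (suc ℓ))
    where
    bound : DepthIs (stA A E (suc ℓ)) (stVec E (suc ℓ) α) (t ℕ.* suc ℓ ℕ.+ d) → length gs ℕ.≤ t
    bound (ℓ′ , eq , at-ℓ′ , _) = from-word (Inversions.rootAt-word (stA A E (suc ℓ)) (Stretch.st-cartan A cartan E ℓ) at-ℓ′)
      where
      total : suc ℓ′ ≡ suc ℓ ℕ.* suc t
      total = trans (sym eq) (trans (cong (t ℕ.* suc ℓ ℕ.+_) d≡) (trans (ℕP.+-comm (t ℕ.* suc ℓ) (suc ℓ)) (ℕP.*-comm (suc t) (suc ℓ))))
      from-word : _ → length gs ℕ.≤ t
      from-word (u , k , len , u-root) = ℕP.≤-pred (ℕP.*-cancelˡ-< (suc ℓ) (length gs) (suc t)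
        (subst (suc ℓ ℕ.* length gs ℕ.<_) total (ℕ.s≤s (subst (suc ℓ ℕ.* length gs ℕ.≤_) len (Stretched.shifts-bounded ℓ u k u-root)))))

  open Exponential t

  good : Good (value 0 (map ratl gs) (map ratl bs) (ratl α ∷ []))
  good = good-value (map ratl gs) 0 (map ratl bs) (ratl α ∷ []) (subst (ℕ._≤ t) (sym (ListP.length-map ratl gs)) shifts≤t)

  formula : ∀ n′ {χq} q → χq ≡ iterate q (map ratl gs) (whitney (power q) (map ratl bs)) (suc n′) (ratl α ∷ []) →
            χq ≡ sumℚ (λ (j : Fin (suc t)) → eval (proj₁ good j) q *ℚ (base-at q (toℕ j) ^ℚ ℤ.∣ + suc n′ ℤ.- 0ℤ ∣))
  formula n′ q h = trans h (trans (cong (λ c → iterate c (map ratl gs) (whitney (power q) (map ratl bs)) (suc n′) (ratl α ∷ []))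
      (sym (ℚP.+-identityʳ q)))
    (trans (proj₂ good (suc n′) q) (cong (λ e → sumℚ (λ (j : Fin (suc t)) → eval (proj₁ good j) q *ℚ (base-at q (toℕ j) ^ℚ e)))
        (sym (ℕP.+-identityʳ (suc n′))))))

  at-stretch : ∀ n → 1 ℕ.≤ n →
    Σ ℕ (λ k → Σ (Fin k → Vecℤ (m ℕ.+ n)) λ Fs → ListsFractures (stA A E n) (stVec E n α) k Fs)
    × (∀ k (Fs : Fin k → Vecℤ (m ℕ.+ n)) → ListsFractures (stA A E n) (stVec E n α) k Fs → ∀ χ → IsCharPoly (stVec E n α) Fs χ →
       ∀ q → χ q ≡ sumℚ (λ (j : Fin (suc t)) → eval (proj₁ good j) q ℚ.* ((q ℚ.- toℚ (+ toℕ j)) ^ℚ ℤ.∣ + n ℤ.- 0ℤ ∣)))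
  at-stretch (suc n′) _ = Stretched.listing n′ , λ k Fs lists χ cp q → formula n′ q (Stretched.charPoly n′ Fs lists cp q)
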